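{- Let $t\ge2$, $\zeta=e^{2\pi i/t}$, $N=t+2$, and let $\lambda$ be a partition with at most $N$ parts. Let $\mathrm{SSYT}(\lambda,t+2)$ be the set of semistandard Young tableaux of shape $\lambda$ with entries in $\{1,\dots,t+2\}$, and let $m_k(T)$ be the number of entries equal to $k$ in $T$. With $z=e^\theta$, $$\sum_{T\in\mathrm{SSYT}(\lambda,t+2)}\zeta^{\,\sum_{k=1}^t(k-1)m_k(T)}\,z^{\,m_{t+1}(T)-m_{t+2}(T)}=\varepsilon_\lambda\,\frac{\sinh(d_1\theta/2)\sinh(d_2\theta/2)\sinh(d_3\theta/2)}{\sinh^2(t\theta/2)\sinh\theta},$$ where the right-hand side is understood to be $0$ when some residue class modulo $t$ contains no element of $\beta(\lambda)$ or when $\tilde d_3=0$.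
   Context: For $\lambda=(\lambda_1\ge\dots\ge\lambda_N\ge0)$ let $\beta_j=\lambda_j+N-j$ ($1\le j\le N$; $j$ is the column of $\beta_j$), $\beta(\lambda)=\{\beta_1>\dots>\beta_N\}$, and let $n_i$ be the number of $\beta_j\equiv i\pmod t$. Since $\sum_i n_i=t+2$, if no class is empty then either exactly two classes have size $2$ (others $1$) or exactly one has size $3$ (others $1$). In the first case let $r_A<r_B$ be the two residues and $A=\{a_1>a_2\}$, $B=\{b_1>b_2\}$ the elements of $\beta(\lambda)$ in classes $r_A,r_B$; in the second case, with class $\{p>q>r\}$, let $A=\{a_1>a_2\}=\{p,q\}$, $B=\{b_1>b_2\}=\{q,r\}$. Put $d_1=a_1-a_2$, $d_2=b_1-b_2$, $\tilde d_3=a_1+a_2-b_1-b_2$, $d_3=|\tilde d_3|$. For $\tilde d_3\neq0$, $\varepsilon_\lambda=(-1)^{t+\binom{N+1}{2}}(-1)^{j_{A_1}+j_{B_1}+\operatorname{inv}(b_S)}\operatorname{sgn}(a_1-b_1)\operatorname{sgn}(\tilde d_3)$, where $j_{A_1},j_{B_1}$ are the columns of $a_1,b_1$, $S=\{1,\dots,N\}\setminus\{j_{A_1},j_{B_1}\}$, $b_S$ is the word of residues $\beta_j\bmod t\in\{0,\dots,t-1\}$ for $j\in S$ in increasing order of $j$, and $\operatorname{inv}$ counts inversions. The identity is read as one of rational functions. -}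

module Defs where

open import Algebra.Apartness.Bundles using (HeytingCommutativeRing; HeytingField)
import Algebra.Apartness.Properties.HeytingCommutativeRing as HeytingProperties
open import Algebra.Bundles using (CommutativeRing)
import Algebra.Properties.Monoid.Sum as Sum
import Algebra.Properties.Semiring.Exp as Exp
import Algebra.Properties.Semiring.Mult as Mult
open import Data.Bool.Base using (if_then_else_)
open import Data.Fin.Base as Fin using (Fin; zero; suc; toℕ; _↑ˡ_; _↑ʳ_)
import Data.Fin.Properties as Fin
open import Data.Integer.Base as ℤ using (ℤ; +_; +0; +[1+_]; -[1+_]; 0ℤ; 1ℤ; -1ℤ; ∣_∣)
import Data.Integer.Properties as ℤ
open import Data.List.Base as List
  using (List; []; _∷_; filter; length; map; foldr; allFin; upTo; cartesianProductWith)
open import Data.Maybe.Base using (Maybe; just; nothing; maybe′)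
open import Data.Nat.Base as ℕ using (ℕ; zero; suc; _∸_; NonZero)
import Data.Nat.Properties as ℕ
open import Data.Nat.Combinatorics using (_C_)
open import Data.Nat.DivMod using (_%_)
open import Data.Product.Base using (_×_; _,_; ∃; proj₁)
open import Function.Base using (_∘_)
open import Level using (_⊔_)
open import Relation.Binary.PropositionalEquality.Core using (_≡_; _≢_)
open import Relation.Nullary.Decidable using (Dec; does; ¬?; _→-dec_; _×-dec_)
open import Relation.Unary using (Decidable)

open Sum ℕ.+-0-monoid using () renaming (sum to sumℕ)

-- A sequence λ₁, …, λ_N of row lengths; row and column indices are 0-based.
Shape : ℕ → Set
Shape N = Fin N → ℕ

IsPartition : ∀ {N} → Shape N → Set
IsPartition {N} lam = ∀ {i j : Fin N} → i Fin.≤ j → lam j ℕ.≤ lam i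

------------------------------------------------------------------------
-- Semistandard tableaux

-- `T i j` is the entry in row `i` and column `j`; the element `k : Fin N`
-- stands for the entry `toℕ k + 1`.
Filling : ∀ {N} → Shape N → Set
Filling {N} lam = ∀ (i : Fin N) → Fin (lam i) → Fin N

Semistandard : ∀ {N} {lam : Shape N} → Filling lam → Set
Semistandard {N} {lam} T =
    (∀ (i : Fin N) (j j′ : Fin (lam i)) → j Fin.< j′ → T i j Fin.≤ T i j′)
  × (∀ (i i′ : Fin N) → i Fin.< i′ → ∀ (j : Fin (lam i)) (j′ : Fin (lam i′)) →
       toℕ j ≡ toℕ j′ → T i j Fin.< T i′ j′)

semistandard? : ∀ {N} {lam : Shape N} → Decidable (Semistandard {N} {lam})
semistandard? T =
  (Fin.all? λ i → Fin.all? λ j → Fin.all? λ j′ →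
     (j Fin.<? j′) →-dec (T i j Fin.≤? T i j′))
  ×-dec
  (Fin.all? λ i → Fin.all? λ i′ → (i Fin.<? i′) →-dec
     (Fin.all? λ j → Fin.all? λ j′ →
        (toℕ j ℕ.≟ toℕ j′) →-dec (T i j Fin.<? T i′ j′)))

-- All choice functions for a finite family of lists.  If each `xs i` lists
-- every element of `A i` once, then each function occurs exactly once, up to
-- pointwise equality.
choices : ∀ {n} {A : Fin n → Set} → (∀ i → List (A i)) → List (∀ i → A i)
choices {zero}  xs = (λ ()) ∷ []
choices {suc n} xs =
  cartesianProductWith (λ a f → Fin.∀-cons a f) (xs zero) (choices (xs ∘ suc))

fillings : ∀ {N} (lam : Shape N) → List (Filling lam)
fillings {N} lam = choices λ i → choices {lam i} λ _ → allFin N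

ssyt : ∀ {N} (lam : Shape N) → List (Filling lam)
ssyt lam = filter semistandard? (fillings lam)

multiplicity : ∀ {N} {lam : Shape N} → Filling lam → Fin N → ℕ
multiplicity {lam = lam} T k =
  sumℕ λ i → length (filter (λ j → T i j Fin.≟ k) (allFin (lam i)))

------------------------------------------------------------------------
-- Beta-numbers and the sign

beta : ∀ {N} → Shape N → Fin N → ℕ
beta {N} lam j = lam j ℕ.+ (N ∸ suc (toℕ j))

sgn : ℤ → ℤ
sgn +0       = 0ℤ
sgn +[1+ _ ] = 1ℤ
sgn -[1+ _ ] = -1ℤ

inversions : List ℕ → ℕ
inversions []       = 0
inversions (x ∷ xs) = length (filter (ℕ._<? x) xs) ℕ.+ inversions xs

-- The columns of a₁, a₂, b₁, b₂.
record Pairs (N : ℕ) : Set where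
  constructor pairs
  field A₁ A₂ B₁ B₂ : Fin N

-- The argument lists the classes with at least two elements by increasing
-- residue.  Each class is given by its columns in increasing order, hence its
-- beta-numbers decrease.  When the t classes partition t + 2 elements and
-- none is empty, one of the first two clauses applies.
selectPairs : ∀ {N} → List (List (Fin N)) → Maybe (Pairs N)
selectPairs ((a₁ ∷ a₂ ∷ []) ∷ (b₁ ∷ b₂ ∷ []) ∷ []) = just (pairs a₁ a₂ b₁ b₂)
selectPairs ((p ∷ q ∷ r ∷ []) ∷ [])                = just (pairs p q q r)
selectPairs _                                      = nothing

module _ (t : ℕ) .{{_ : NonZero t}} {N : ℕ} (lam : Shape N) where

  residue : Fin N → ℕ
  residue j = beta lam j % t

  residueClass : ℕ → List (Fin N)
  residueClass i = filter (λ j → residue j ℕ.≟ i) (allFin N)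

  HasEmptyClass : Set
  HasEmptyClass = ∃ λ (i : Fin t) → ∀ (j : Fin N) → residue j ≢ toℕ i

  hasEmptyClass? : Dec HasEmptyClass
  hasEmptyClass? = Fin.any? λ i → Fin.all? λ j → ¬? (residue j ℕ.≟ toℕ i)

  multipleClasses : List (List (Fin N))
  multipleClasses = filter (λ c → 2 ℕ.≤? length c) (map residueClass (upTo t))

  module _ (P : Pairs N) where
    open Pairs P

    private
      β : Fin N → ℤ
      β j = + beta lam j

    d₁ d₂ d̃₃ d₃ : ℤ
    d₁ = β A₁ ℤ.- β A₂
    d₂ = β B₁ ℤ.- β B₂
    d̃₃ = β A₁ ℤ.+ β A₂ ℤ.- β B₁ ℤ.- β B₂
    d₃ = + ∣ d̃₃ ∣

    residueWord : List ℕ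
    residueWord =
      map residue (filter (λ j → ¬? (j Fin.≟ A₁) ×-dec ¬? (j Fin.≟ B₁)) (allFin N))

    signε : ℤ
    signε = -1ℤ ℤ.^ (t ℕ.+ (N ℕ.+ 1) C 2)
      ℤ.* -1ℤ ℤ.^ (suc (toℕ A₁) ℕ.+ suc (toℕ B₁) ℕ.+ inversions residueWord)
      ℤ.* sgn (β A₁ ℤ.- β B₁) ℤ.* sgn d̃₃

------------------------------------------------------------------------
-- The identity over a field

-- F is any Heyting field of characteristic zero, in place of the complex
-- numbers, and ζ is any primitive t-th root of unity in it.  The identity is
-- asserted at each w (playing the role of exp(θ/2), so that z = w²) at which
-- the denominator is apart from 0.  The identity of rational functions is the
-- case where F is a field of rational functions and w is its indeterminate.
module _ {c ℓ₁ ℓ₂} (F : HeytingField c ℓ₁ ℓ₂) where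
  open HeytingField F hiding (zero)
  open HeytingProperties heytingCommutativeRing using (x#0y#0→xy#0)

  private
    module R = CommutativeRing (HeytingCommutativeRing.commutativeRing heytingCommutativeRing)
  open Exp R.semiring using (_^_)
  open Mult R.semiring using () renaming (_×_ to _·_)

  CharacteristicZero : Set ℓ₂
  CharacteristicZero = ∀ n → (suc n · 1#) # 0#

  IsPrimitiveRoot : ℕ → Carrier → Set (ℓ₁ ⊔ ℓ₂)
  IsPrimitiveRoot t ζ = ζ ^ t ≈ 1# × (∀ k → 0 ℕ.< k → k ℕ.< t → ζ ^ k # 1#)

  -- `#⇒invertible` yields an inverse of `x - 0#`.
  inverse : ∀ {x} → x # 0# → Carrier
  inverse x#0 = proj₁ (#⇒invertible x#0)

  divide : Carrier → ∀ {y} → y # 0# → Carrier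
  divide x y#0 = x * inverse y#0

  zpow : ∀ {x} → x # 0# → ℤ → Carrier
  zpow {x} x#0 (+ n)    = x ^ n
  zpow     x#0 -[1+ n ] = inverse x#0 ^ suc n

  fromℤ : ℤ → Carrier
  fromℤ (+ n)    = n · 1#
  fromℤ -[1+ n ] = - (suc n · 1#)

  sumOver : ∀ {A : Set} → List A → (A → Carrier) → Carrier
  sumOver xs f = foldr (λ x s → f x + s) 0# xs

  module _ {w : Carrier} (w#0 : w # 0#) where

    z#0 : w * w # 0#
    z#0 = x#0y#0→xy#0 w#0 w#0

    tableauSum : ∀ (t : ℕ) (ζ : Carrier) (lam : Shape (t ℕ.+ 2)) → Carrier
    tableauSum t ζ lam = sumOver (ssyt lam) λ T →
        ζ ^ sumℕ (λ (k : Fin t) → toℕ k ℕ.* multiplicity T (k ↑ˡ 2))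
      * zpow z#0 (+ multiplicity T (t ↑ʳ zero) ℤ.- + multiplicity T (t ↑ʳ suc zero))

    module _ (char0 : CharacteristicZero) where

      -- sinhHalf n = sinh (n θ / 2)
      sinhHalf : ℤ → Carrier
      sinhHalf n = divide (zpow w#0 n - zpow w#0 (ℤ.- n)) (char0 1)

      denominator : ℕ → Carrier
      denominator t = sinhHalf (+ t) ^ 2 * sinhHalf (+ 2)

      module _ (t : ℕ) .{{_ : NonZero t}} (den#0 : denominator t # 0#)
               (lam : Shape (t ℕ.+ 2)) where

        sinhQuotient : Pairs (t ℕ.+ 2) → Carrier
        sinhQuotient P =
          if does (d̃₃ t lam P ℤ.≟ 0ℤ) then 0# else
            fromℤ (signε t lam P)
              * divide (sinhHalf (d₁ t lam P) * sinhHalf (d₂ t lam P) * sinhHalf (d₃ t lam P))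
                       den#0

        rightHandSide : Carrier
        rightHandSide =
          if does (hasEmptyClass? t lam) then 0# else
            maybe′ sinhQuotient 0# (selectPairs (multipleClasses t lam))

{-# OPTIONS --safe #-}

-- Write the tableau sum as a Schur polynomial s_λ(x) in N = t + 2 variables
-- specialised at 1, ζ, …, ζ^(t-1), z, z̄.  Removing the boxes with the largest
-- letter gives the branching rule for s_λ, and eliminating the first row of
-- det (x_i^β_j) gives the same recursion, so the determinant equals
-- vandermonde · s_λ.  On the rows ζ^k a column depends only on β_j mod t.  If a
-- residue is missing, two columns of each t-minor agree and the determinant
-- vanishes.  Otherwise subtract the column of a₂ from that of a₁ and that of b₂
-- from that of b₁: the new columns vanish outside the rows z and z̄, and the
-- determinant becomes the product of a 2 × 2 minor, which factors into the three
-- hyperbolic sines, and a Vandermonde determinant in the ζ^k up to the sign of a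
-- permutation.  For λ = 0 this evaluates the Vandermonde determinant in all
-- variables, which gives the denominator.

module Submission where

open import Defs
open import Algebra.Apartness.Bundles using (HeytingCommutativeRing; HeytingField)
import Algebra.Apartness.Properties.HeytingCommutativeRing as HeytingProperties
open import Algebra.Bundles using (CommutativeRing)
import Algebra.Properties.AbelianGroup as AbelianGroupProperties
import Algebra.Properties.CommutativeMonoid.Sum as CommutativeSum
import Algebra.Properties.CommutativeSemigroup as CommutativeSemigroupProperties
import Algebra.Properties.CommutativeSemiring.Exp as CommutativeExp
import Algebra.Properties.Monoid.Sum as Sum
import Algebra.Properties.Ring as RingProperties
import Algebra.Properties.Semiring.Exp as Exp
import Algebra.Properties.Semiring.Mult as Mult
import Algebra.Solver.Ring as RingSolver
open import Algebra.Solver.Ring.AlmostCommutativeRing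
  using (fromCommutativeRing; _-Raw-AlmostCommutative⟶_)
open import Data.Bool.Base using (Bool; true; false; if_then_else_; _∧_; T)
open import Data.Fin.Base as Fin using (Fin; zero; suc; toℕ; fromℕ<; _↑ˡ_; _↑ʳ_)
import Data.Fin.Properties as Fin
open import Data.Integer.Base as ℤ using (ℤ; +_; +0; +[1+_]; -[1+_]; 0ℤ; 1ℤ; -1ℤ; ∣_∣)
import Data.Integer.Properties as ℤ
open import Data.List.Base as List
  using (List; []; _∷_; _++_; map; length; filter; replicate; allFin; upTo; downFrom;
         cartesianProductWith; foldr; tabulate; lookup)
open import Data.List.Membership.Propositional using (_∈_)
import Data.List.Membership.Propositional.Properties as ∈
open import Data.List.Membership.Propositional.Properties.WithK using (unique∧set⇒bag)
open import Data.List.Properties as List using (++-assoc; map-++; length-map; length-++)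
open import Data.List.Relation.Binary.BagAndSetEquality using (∼bag⇒↭)
open import Data.List.Relation.Binary.Permutation.Propositional as ↭
  using (_↭_; ↭-sym; ↭-trans; ↭-refl)
import Data.List.Relation.Binary.Permutation.Propositional.Properties as ↭
open import Data.List.Relation.Binary.Pointwise as Pointwise using (Pointwise; []; _∷_)
open import Data.List.Relation.Unary.All as All using (All; []; _∷_)
import Data.List.Relation.Unary.All.Properties as All
open import Data.List.Relation.Unary.AllPairs as AllPairs using (AllPairs; []; _∷_)
import Data.List.Relation.Unary.AllPairs.Properties as AllPairs
open import Data.List.Relation.Unary.Any using (here; there)
open import Data.List.Relation.Unary.Unique.Propositional using (Unique)
import Data.List.Relation.Unary.Unique.Propositional.Properties as Unique
open import Data.Maybe.Base using (Maybe; just; nothing; maybe′)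
open import Data.Nat.Base as ℕ using (ℕ; zero; suc; _∸_; NonZero; z≤n; s≤s)
open import Data.Nat.Combinatorics using (_C_; nC1≡n; nCk+nC[k+1]≡[n+1]C[k+1])
open import Data.Nat.DivMod using (_%_)
import Data.Nat.DivMod as ℕ
import Data.Nat.ListAction as ℕ using (sum)
import Data.Nat.Properties as ℕ
import Data.Nat.Solver as NatSolver
open import Data.Product.Base using (_×_; _,_; ∃; proj₁; proj₂)
open import Data.Sum.Base using (_⊎_; inj₁; inj₂)
open import Data.Unit.Base using (⊤; tt)
open import Data.Vec.Base as Vec using (Vec; []; _∷_; _∷ʳ_)
open import Function.Base using (_∘_; id)
open import Function.Bundles using (mk⇔)
open import Level using (_⊔_)
open import Relation.Binary.Definitions using (tri<; tri≈; tri>)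
open import Relation.Binary.PropositionalEquality as ≡ using (_≡_; _≢_)
import Relation.Binary.Reasoning.Setoid as SetoidReasoning
open import Relation.Nullary.Decidable as Dec
  using (Dec; yes; no; does; ¬?; _×-dec_)
open import Relation.Nullary.Negation using (¬_; contradiction)

-- Before the last module only a commutative ring is assumed, and identities are kept multiplied
-- out, with a second element w̄ such that w w̄ = 1. The Vandermonde determinant in the powers of ζ
-- is cancelled only at the end, being apart from 0 by primitivity. What then remains of the full
-- Vandermonde determinant is, up to the factor 1/8, the denominator of the theorem.
--
-- A class of size three makes a₂ and b₁ the same column. The column of a₂ is therefore subtracted
-- while that of b₁ is still unchanged, and b₂ is sought among the columns other than those of a₁
-- and b₁; both cases then run through one argument.
--
-- The sign has three sources: moving the columns of a₁ and b₁ to the front, the inversions of the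
-- remaining residues, and the t(t-1)/2 inversions of the order t-1, ..., 0 into which these are
-- sorted. The constant (-1)^(t + binom(t+3, 2)) is -(-1)^(t(t-1)/2); its minus sign is matched by
-- an off-by-one between the column numbers and the inversions of the first move.

-- Integer coefficients for the ring solver

module IntegerCoefficients {c ℓ} (R : CommutativeRing c ℓ) where
  open CommutativeRing R
  open RingProperties ring
    using (-0#≈0#; -‿distribˡ-*; -‿involutive)
  open AbelianGroupProperties +-abelianGroup using (⁻¹-∙-comm; xyx⁻¹≈y)
  open Mult semiring using (×1-homo-*; ×-homo-+) renaming (_×_ to _·_)
  open SetoidReasoning setoid

  -- The solver needs coefficients with decidable equality, which `R` need not have. As `integer 1ℤ`
  -- unfolds to `1# + 0#`, later calls pass `1#` to the solver as a variable.
  integer : ℤ → Carrier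
  integer (+ n)    = n · 1#
  integer -[1+ n ] = - (suc n · 1#)

  integer-⊖ : ∀ m n → integer (m ℤ.⊖ n) ≈ m · 1# - n · 1#
  integer-⊖ zero    zero    = sym (trans (+-identityˡ _) -0#≈0#)
  integer-⊖ zero    (suc n) = sym (+-identityˡ _)
  integer-⊖ (suc m) zero    = sym (trans (+-congˡ -0#≈0#) (+-identityʳ _))
  integer-⊖ (suc m) (suc n) = begin
    integer (suc m ℤ.⊖ suc n)                    ≡⟨ ≡.cong integer (ℤ.[1+m]⊖[1+n]≡m⊖n m n) ⟩
    integer (m ℤ.⊖ n)                            ≈⟨ integer-⊖ m n ⟩
    m · 1# - n · 1#                            ≈⟨ +-congʳ (xyx⁻¹≈y 1# _) ⟨
    1# + m · 1# - 1# - n · 1#                  ≈⟨ +-assoc _ _ _ ⟩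
    1# + m · 1# + (- 1# - n · 1#)              ≈⟨ +-congˡ (⁻¹-∙-comm _ _) ⟩
    1# + m · 1# - (1# + n · 1#)                ∎

  integer-neg : ∀ i → integer (ℤ.- i) ≈ - integer i
  integer-neg +0       = sym -0#≈0#
  integer-neg +[1+ n ] = refl
  integer-neg -[1+ n ] = sym (-‿involutive _)

  integer-+ : ∀ i j → integer (i ℤ.+ j) ≈ integer i + integer j
  integer-+ (+ m)    (+ n)    = ×-homo-+ 1# m n
  integer-+ (+ m)    -[1+ n ] = integer-⊖ m (suc n)
  integer-+ -[1+ m ] (+ n)    = trans (integer-⊖ n (suc m)) (+-comm _ _)
  integer-+ -[1+ m ] -[1+ n ] = begin
    - (suc (suc (m ℕ.+ n)) · 1#)      ≡⟨ ≡.cong (λ k → - (suc k · 1#)) (ℕ.+-suc m n) ⟨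
    - ((suc m ℕ.+ suc n) · 1#)        ≈⟨ -‿cong (×-homo-+ 1# (suc m) (suc n)) ⟩
    - (suc m · 1# + suc n · 1#)       ≈⟨ ⁻¹-∙-comm _ _ ⟨
    - (suc m · 1#) - (suc n · 1#)     ∎

  private
    integer-+* : ∀ m j → integer (+ m ℤ.* j) ≈ m · 1# * integer j
    integer-+* zero    j = sym (zeroˡ _)
    integer-+* (suc m) j = begin
      integer (ℤ.suc (+ m) ℤ.* j)          ≡⟨ ≡.cong integer (ℤ.suc-* (+ m) j) ⟩
      integer (j ℤ.+ + m ℤ.* j)            ≈⟨ integer-+ j _ ⟩
      integer j + integer (+ m ℤ.* j)        ≈⟨ +-cong (sym (*-identityˡ _)) (integer-+* m j) ⟩
      1# * integer j + m · 1# * integer j    ≈⟨ distribʳ _ _ _ ⟨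
      (1# + m · 1#) * integer j            ∎

  integer-* : ∀ i j → integer (i ℤ.* j) ≈ integer i * integer j
  integer-* (+ m)    j = integer-+* m j
  integer-* -[1+ m ] j = begin
    integer (ℤ.- +[1+ m ] ℤ.* j)        ≡⟨ ≡.cong integer (ℤ.neg-distribˡ-* +[1+ m ] j) ⟨
    integer (ℤ.- (+[1+ m ] ℤ.* j))      ≈⟨ integer-neg (+[1+ m ] ℤ.* j) ⟩
    - integer (+[1+ m ] ℤ.* j)          ≈⟨ -‿cong (integer-+* (suc m) j) ⟩
    - (suc m · 1# * integer j)          ≈⟨ -‿distribˡ-* _ _ ⟩
    - (suc m · 1#) * integer j          ∎

  private
    integer-morphism :
      ℤ.+-*-rawRing -Raw-AlmostCommutative⟶ fromCommutativeRing R
    integer-morphism = record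
      { ⟦_⟧ = integer ; +-homo = integer-+ ; *-homo = integer-* ; -‿homo = integer-neg
      ; 0-homo = refl ; 1-homo = +-identityʳ 1# }

    integer-≟ : ∀ i j → Maybe (integer i ≈ integer j)
    integer-≟ i j with i ℤ.≟ j
    ... | yes ≡.refl = just refl
    ... | no  _      = nothing

  open RingSolver ℤ.+-*-rawRing (fromCommutativeRing R) integer-morphism integer-≟ public
    using (solve; _:=_; con; _:+_; _:*_; _:-_; :-_; _:^_)

-- Determinants as alternating functions of a list of columns

module Determinants {c ℓ} (R : CommutativeRing c ℓ) where
  open CommutativeRing R hiding (zero)
  open RingProperties ring using (-0#≈0#)
  open IntegerCoefficients R using (solve; _:=_; con; _:+_; _:*_; _:-_; :-_)
  open SetoidReasoning setoid

  -- A row is a point of the ring and a column is a function evaluated there.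
  Column : Set c
  Column = Carrier → Carrier

  -- Laplace expansion along the row `r`, with `g` as the minor. A column passed over is pushed into
  -- `g`, and the nested subtraction alternates the signs. Since `g` is arbitrary, inductions can
  -- continue with `g ∘ (c ∷_)`.
  expand : Carrier → (List Column → Carrier) → List Column → Carrier
  expand r g []       = 0#
  expand r g (c ∷ cs) = c r * g cs - expand r (g ∘ (c ∷_)) cs

  det : List Carrier → List Column → Carrier
  det []       []       = 1#
  det []       (_ ∷ _)  = 0#
  det (r ∷ rs) cs       = expand r (det rs) cs

  Agree : List Carrier → Column → Column → Set _
  Agree rs c d = All (λ r → c r ≈ d r) rs

  agree : ∀ {c d} → (∀ r → c r ≈ d r) → ∀ rs → Agree rs c d
  agree p rs = All.universal p rs

  -- Only the values of the columns at `rs` enter. This is what later identifies powers with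
  -- congruent exponents on the rows ζ^k.
  record Alternating (rs : List Carrier) (g : List Column → Carrier) : Set (c ⊔ ℓ) where
    field
      respects    : ∀ {cs ds} → Pointwise (Agree rs) cs ds → g cs ≈ g ds
      linear      : ∀ xs {c d e} a b ys → Agree rs c (λ r → a * d r + b * e r) →
                    g (xs ++ c ∷ ys) ≈ a * g (xs ++ d ∷ ys) + b * g (xs ++ e ∷ ys)
      alternating : ∀ xs c ys → g (xs ++ c ∷ c ∷ ys) ≈ 0#

  open Alternating public

  ≋-refl : ∀ {rs cs} → Pointwise (Agree rs) cs cs
  ≋-refl = Pointwise.refl (agree (λ _ → refl) _)

  -- Freezing the first column is the induction step whenever the position of interest lies further
  -- right.
  prefix : ∀ {rs g} c → Alternating rs g → Alternating rs (g ∘ (c ∷_))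
  prefix c alt = record
    { respects    = λ p → respects alt (agree (λ _ → refl) _ ∷ p)
    ; linear      = λ xs → linear alt (c ∷ xs)
    ; alternating = λ xs → alternating alt (c ∷ xs)
    }

  expand-cong : ∀ {r rs g h} →
    (∀ {cs ds} → Pointwise (Agree rs) cs ds → g cs ≈ h ds) →
    ∀ {cs ds} → Pointwise (Agree (r ∷ rs)) cs ds → expand r g cs ≈ expand r h ds
  expand-cong g≈h []                   = refl
  expand-cong g≈h ((cr≈dr ∷ c≋d) ∷ ps) =
    +-cong (*-cong cr≈dr (g≈h (Pointwise.map All.tail ps)))
           (-‿cong (expand-cong (λ q → g≈h (c≋d ∷ q)) ps))

  expand-congᵍ : ∀ {r g h} → (∀ cs → g cs ≈ h cs) → ∀ cs → expand r g cs ≈ expand r h cs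
  expand-congᵍ g≈h []       = refl
  expand-congᵍ g≈h (c ∷ cs) =
    +-cong (*-congˡ (g≈h cs)) (-‿cong (expand-congᵍ (g≈h ∘ (c ∷_)) cs))

  expand-0 : ∀ {r} cs → expand r (λ _ → 0#) cs ≈ 0#
  expand-0 []       = refl
  expand-0 {r} (c ∷ cs) = begin
    c r * 0# - expand r (λ _ → 0#) cs  ≈⟨ +-cong (zeroʳ _) (-‿cong (expand-0 cs)) ⟩
    0# - 0#                            ≈⟨ -‿inverseʳ 0# ⟩
    0#                                 ∎

  expand-linear : ∀ {r g h} a b cs →
    expand r (λ ds → a * g ds + b * h ds) cs ≈ a * expand r g cs + b * expand r h cs
  expand-linear a b []       =
    solve 2 (λ a b → con 0ℤ := a :* con 0ℤ :+ b :* con 0ℤ) refl a b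
  expand-linear {r} {g} {h} a b (c ∷ cs) = trans
    (+-congˡ (-‿cong (expand-linear {r} {g ∘ (c ∷_)} {h ∘ (c ∷_)} a b cs)))
    (solve 7 (λ a b c g h G H → c :* (a :* g :+ b :* h) :- (a :* G :+ b :* H)
                              := a :* (c :* g :- G) :+ b :* (c :* h :- H))
      refl a b (c r) (g cs) (h cs) (expand r (g ∘ (c ∷_)) cs) (expand r (h ∘ (c ∷_)) cs))

  private
    expand-linearAt : ∀ {r rs g} → Alternating rs g → ∀ xs {c d e} a b ys →
      Agree (r ∷ rs) c (λ s → a * d s + b * e s) →
      expand r g (xs ++ c ∷ ys) ≈ a * expand r g (xs ++ d ∷ ys) + b * expand r g (xs ++ e ∷ ys)
    expand-linearAt {r} {rs} {g} alt [] {c} {d} {e} a b ys (p ∷ q) = begin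
      c r * g ys - expand r (g ∘ (c ∷_)) ys
        ≈⟨ +-cong (*-congʳ p) (-‿cong (trans
             (expand-congᵍ (λ zs → linear alt [] a b zs q) ys)
             (expand-linear {r} {g ∘ (d ∷_)} {g ∘ (e ∷_)} a b ys))) ⟩
      (a * d r + b * e r) * g ys
        - (a * expand r (g ∘ (d ∷_)) ys + b * expand r (g ∘ (e ∷_)) ys)
        ≈⟨ solve 7 (λ a b d e g D E → (a :* d :+ b :* e) :* g :- (a :* D :+ b :* E)
                     := a :* (d :* g :- D) :+ b :* (e :* g :- E))
             refl a b (d r) (e r) (g ys) (expand r (g ∘ (d ∷_)) ys) (expand r (g ∘ (e ∷_)) ys) ⟩
      a * (d r * g ys - expand r (g ∘ (d ∷_)) ys)
        + b * (e r * g ys - expand r (g ∘ (e ∷_)) ys) ∎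
    expand-linearAt {r} {rs} {g} alt (x ∷ xs) {c} {d} {e} a b ys (p ∷ q) = trans
      (+-cong (*-congˡ (linear alt xs a b ys q))
              (-‿cong (expand-linearAt (prefix x alt) xs a b ys (p ∷ q))))
      (solve 7 (λ a b x d e D E → x :* (a :* d :+ b :* e) :- (a :* D :+ b :* E)
                   := a :* (x :* d :- D) :+ b :* (x :* e :- E))
        refl a b (x r) (g (xs ++ d ∷ ys)) (g (xs ++ e ∷ ys))
        (expand r (g ∘ (x ∷_)) (xs ++ d ∷ ys)) (expand r (g ∘ (x ∷_)) (xs ++ e ∷ ys)))

    expand-repeated : ∀ {r rs g} → Alternating rs g → ∀ xs c ys →
      expand r g (xs ++ c ∷ c ∷ ys) ≈ 0#
    -- The two terms that take the row entry from a copy of `c` cancel; in all others both copies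
    -- stay in the minor.
    expand-repeated {r} {rs} {g} alt [] c ys = begin
      c r * g (c ∷ ys) - (c r * g (c ∷ ys) - expand r (λ zs → g (c ∷ c ∷ zs)) ys)
        ≈⟨ +-congˡ (-‿cong (+-congˡ (-‿cong
             (trans (expand-congᵍ (alternating alt [] c) ys) (expand-0 ys))))) ⟩
      c r * g (c ∷ ys) - (c r * g (c ∷ ys) - 0#)
        ≈⟨ solve 1 (λ x → x :- (x :- con 0ℤ) := con 0ℤ) refl (c r * g (c ∷ ys)) ⟩
      0# ∎
    expand-repeated {r} {rs} {g} alt (x ∷ xs) c ys = begin
      x r * g (xs ++ c ∷ c ∷ ys) - expand r (g ∘ (x ∷_)) (xs ++ c ∷ c ∷ ys)
        ≈⟨ +-cong (*-congˡ (alternating alt xs c ys))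
                  (-‿cong (expand-repeated (prefix x alt) xs c ys)) ⟩
      x r * 0# - 0#
        ≈⟨ solve 1 (λ x → x :* con 0ℤ :- con 0ℤ := con 0ℤ) refl (x r) ⟩
      0# ∎

  expand-alternating : ∀ {r rs g} → Alternating rs g → Alternating (r ∷ rs) (expand r g)
  expand-alternating alt = record
    { respects    = expand-cong (respects alt)
    ; linear      = expand-linearAt alt
    ; alternating = expand-repeated alt
    }

  private
    det-linear₀ : ∀ xs {c d e} a b ys →
      det [] (xs ++ c ∷ ys) ≈ a * det [] (xs ++ d ∷ ys) + b * det [] (xs ++ e ∷ ys)
    det-linear₀ []       a b ys =
      solve 2 (λ a b → con 0ℤ := a :* con 0ℤ :+ b :* con 0ℤ) refl a b
    det-linear₀ (x ∷ xs) a b ys =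
      solve 2 (λ a b → con 0ℤ := a :* con 0ℤ :+ b :* con 0ℤ) refl a b

    det-repeated₀ : ∀ xs c ys → det [] (xs ++ c ∷ c ∷ ys) ≈ 0#
    det-repeated₀ []       c ys = refl
    det-repeated₀ (x ∷ xs) c ys = refl

  det-alternating : ∀ rs → Alternating rs (det rs)
  det-alternating [] = record
    { respects    = λ { [] → refl ; (_ ∷ _) → refl }
    ; linear      = λ xs a b ys _ → det-linear₀ xs a b ys
    ; alternating = det-repeated₀
    }
  det-alternating (r ∷ rs) = expand-alternating (det-alternating rs)

  module _ {rs g} (alt : Alternating rs g) where

    vanishing-column : ∀ {c} → Agree rs c (λ _ → 0#) → ∀ xs ys → g (xs ++ c ∷ ys) ≈ 0#
    vanishing-column {c} p xs ys = begin
      g (xs ++ c ∷ ys)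
        ≈⟨ linear alt xs 0# 0# ys (All.map (λ {r} q → trans q
             (solve 1 (λ x → con 0ℤ := con 0ℤ :* x :+ con 0ℤ :* x) refl (c r))) p) ⟩
      0# * g (xs ++ c ∷ ys) + 0# * g (xs ++ c ∷ ys)
        ≈⟨ solve 1 (λ x → con 0ℤ :* x :+ con 0ℤ :* x := con 0ℤ) refl (g (xs ++ c ∷ ys)) ⟩
      0# ∎

    additive : ∀ xs {c d e} ys → Agree rs c (λ r → d r + e r) →
      g (xs ++ c ∷ ys) ≈ g (xs ++ d ∷ ys) + g (xs ++ e ∷ ys)
    additive xs {c} {d} {e} ys p = begin
      g (xs ++ c ∷ ys)
        ≈⟨ linear alt xs 1# 1# ys (All.map (λ q → trans q
             (+-cong (sym (*-identityˡ _)) (sym (*-identityˡ _)))) p) ⟩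
      1# * g (xs ++ d ∷ ys) + 1# * g (xs ++ e ∷ ys)
        ≈⟨ +-cong (*-identityˡ _) (*-identityˡ _) ⟩
      g (xs ++ d ∷ ys) + g (xs ++ e ∷ ys) ∎

    -- Polarisation: the function vanishes when both places hold c + d, and of the four terms
    -- obtained by additivity the two with a repeated column vanish as well.
    transposition : ∀ xs c d ys → g (xs ++ c ∷ d ∷ ys) ≈ - g (xs ++ d ∷ c ∷ ys)
    transposition xs c d ys = begin
      cd                             ≈⟨ solve 2 (λ x y → x := x :+ y :- y) refl cd dc ⟩
      cd + dc - dc                   ≈⟨ +-congʳ (sym sum≈) ⟩
      0# - dc                        ≈⟨ +-identityˡ _ ⟩
      - dc                           ∎
      where
      cd = g (xs ++ c ∷ d ∷ ys)
      dc = g (xs ++ d ∷ c ∷ ys)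
      e : Column
      e r = c r + d r
      shift : ∀ x y zs → g (xs ++ x ∷ y ∷ zs) ≡ g ((xs ++ x ∷ []) ++ y ∷ zs)
      shift x y zs = ≡.cong g (≡.sym (++-assoc xs (x ∷ []) (y ∷ zs)))
      second : ∀ x → g (xs ++ x ∷ e ∷ ys) ≈ g (xs ++ x ∷ c ∷ ys) + g (xs ++ x ∷ d ∷ ys)
      second x = begin
        g (xs ++ x ∷ e ∷ ys)               ≡⟨ shift x e ys ⟩
        g ((xs ++ x ∷ []) ++ e ∷ ys)
          ≈⟨ additive (xs ++ x ∷ []) ys (agree (λ _ → refl) rs) ⟩
        g ((xs ++ x ∷ []) ++ c ∷ ys) + g ((xs ++ x ∷ []) ++ d ∷ ys)
          ≡⟨ ≡.cong₂ _+_ (≡.sym (shift x c ys)) (≡.sym (shift x d ys)) ⟩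
        g (xs ++ x ∷ c ∷ ys) + g (xs ++ x ∷ d ∷ ys) ∎
      sum≈ : 0# ≈ cd + dc
      sum≈ = begin
        0#                                            ≈⟨ alternating alt xs e ys ⟨
        g (xs ++ e ∷ e ∷ ys)
          ≈⟨ additive xs (e ∷ ys) (agree (λ _ → refl) rs) ⟩
        g (xs ++ c ∷ e ∷ ys) + g (xs ++ d ∷ e ∷ ys)   ≈⟨ +-cong (second c) (second d) ⟩
        (g (xs ++ c ∷ c ∷ ys) + cd) + (dc + g (xs ++ d ∷ d ∷ ys))
          ≈⟨ +-cong (+-congʳ (alternating alt xs c ys)) (+-congˡ (alternating alt xs d ys)) ⟩
        (0# + cd) + (dc + 0#)                         ≈⟨ +-cong (+-identityˡ _) (+-identityʳ _) ⟩
        cd + dc                                       ∎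

  -- Adjacent transpositions carry the first copy of `c` next to the second.
  repeated : ∀ {rs g} → Alternating rs g → ∀ c ys zs → g (c ∷ ys ++ c ∷ zs) ≈ 0#
  repeated alt c []       zs = alternating alt [] c zs
  repeated {g = g} alt c (y ∷ ys) zs = begin
    g (c ∷ y ∷ ys ++ c ∷ zs)    ≈⟨ transposition alt [] c y _ ⟩
    - g (y ∷ c ∷ ys ++ c ∷ zs)  ≈⟨ -‿cong (repeated (prefix y alt) c ys zs) ⟩
    - 0#                        ≈⟨ -0#≈0# ⟩
    0#                          ∎

  repeated-∈ : ∀ {rs g} → Alternating rs g → ∀ {d ds} → d ∈ ds → g (d ∷ ds) ≈ 0#
  repeated-∈ alt {d} d∈ with ys , zs , ≡.refl ← ∈.∈-∃++ d∈ = repeated alt d ys zs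

  subtract-column : ∀ {rs g} → Alternating rs g → ∀ {c d ds} → d ∈ ds →
    g (c ∷ ds) ≈ g ((λ r → c r - d r) ∷ ds)
  subtract-column {rs} {g} alt {c} {d} {ds} d∈ = begin
    g (c ∷ ds)                    ≈⟨ additive alt [] ds (agree (λ r →
        solve 2 (λ c d → c := (c :- d) :+ d) refl (c r) (d r)) rs) ⟩
    g ((λ r → c r - d r) ∷ ds) + g (d ∷ ds)  ≈⟨ +-congˡ (repeated-∈ alt d∈) ⟩
    g ((λ r → c r - d r) ∷ ds) + 0#          ≈⟨ +-identityʳ _ ⟩
    g ((λ r → c r - d r) ∷ ds)               ∎

-- The branching rule

private
  ∧-exchange : ∀ a b c → a ∧ (b ∧ c) ≡ b ∧ (a ∧ c)
  ∧-exchange true  b     c = ≡.refl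
  ∧-exchange false true  c = ≡.refl
  ∧-exchange false false c = ≡.refl

<⇒<ᵇ≡true : ∀ {m n} → m ℕ.< n → (m ℕ.<ᵇ n) ≡ true
<⇒<ᵇ≡true {zero}  {suc n} _         = ≡.refl
<⇒<ᵇ≡true {suc m} {suc n} (s≤s m<n) = <⇒<ᵇ≡true m<n

≤⇒<ᵇ≡false : ∀ {m n} → n ℕ.≤ m → (m ℕ.<ᵇ n) ≡ false
≤⇒<ᵇ≡false {m}     {zero}  _         = ≡.refl
≤⇒<ᵇ≡false {suc m} {suc n} (s≤s n≤m) = ≤⇒<ᵇ≡false n≤m

<ᵇ≡true⇒< : ∀ {m n} → (m ℕ.<ᵇ n) ≡ true → m ℕ.< n
<ᵇ≡true⇒< {m} {n} eq = ℕ.<ᵇ⇒< m n (≡.subst T (≡.sym eq) tt)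

-- `columnStrict u v`: the row `v` may stand directly below the row `u`.
columnStrict : List ℕ → List ℕ → Bool
columnStrict _       []      = true
columnStrict []      (_ ∷ _) = false
columnStrict (a ∷ u) (b ∷ v) = (a ℕ.<ᵇ b) ∧ columnStrict u v

-- A letter `n` of the lower row must stand under a smaller letter, hence under `p` and never under
-- an appended `n`. So the boxes with the largest letter form a horizontal strip: the whole lower
-- row is at most as long as `p`, whatever `k` is.
columnStrict-++-replicate : ∀ {n} {p u : List ℕ} k j →
  All (ℕ._< n) p → All (ℕ._< n) u →
  columnStrict (p ++ replicate k n) (u ++ replicate j n) ≡
    (length u ℕ.+ j ℕ.<ᵇ suc (length p)) ∧ columnStrict p u
columnStrict-++-replicate k       zero    []          []          = ≡.refl
columnStrict-++-replicate zero    (suc j) []          []          = ≡.refl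
columnStrict-++-replicate {n} (suc k) (suc j) []      []
  rewrite ≤⇒<ᵇ≡false (ℕ.≤-refl {n}) = ≡.refl
columnStrict-++-replicate zero    j       []          (b<n ∷ bs)  = ≡.refl
columnStrict-++-replicate (suc k) j       []          (b<n ∷ bs)
  rewrite ≤⇒<ᵇ≡false (ℕ.<⇒≤ b<n) = ≡.refl
columnStrict-++-replicate k       zero    (a<n ∷ as)  []          = ≡.refl
columnStrict-++-replicate k       (suc j) (a<n ∷ as)  []
  rewrite <⇒<ᵇ≡true a<n = columnStrict-++-replicate k j as []
columnStrict-++-replicate {n} {a ∷ p} {b ∷ u} k j (a<n ∷ as) (b<n ∷ bs) = ≡.trans
  (≡.cong ((a ℕ.<ᵇ b) ∧_) (columnStrict-++-replicate k j as bs))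
  (∧-exchange (a ℕ.<ᵇ b) (length u ℕ.+ j ℕ.<ᵇ suc (length p)) _)

columnStrict-lower : ∀ {h} p u → columnStrict p u ≡ true →
  All (h ℕ.≤_) p → All (suc h ℕ.≤_) u
columnStrict-lower p       []      _  _        = []
columnStrict-lower (a ∷ p) (b ∷ u) eq (h≤a ∷ as) with a ℕ.<ᵇ b in a<b
... | true = ℕ.≤-<-trans h≤a (<ᵇ≡true⇒< a<b) ∷ columnStrict-lower p u eq as

module Branching {c ℓ} (R : CommutativeRing c ℓ) where
  open CommutativeRing R hiding (zero)
  open Exp semiring using (_^_)
  open IntegerCoefficients R using (solve; _:=_; _:+_; _:*_)
  open SetoidReasoning setoid

  ⟦_⟧ : Bool → Carrier
  ⟦ b ⟧ = if b then 1# else 0#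

  ⟦⟧-∧ : ∀ b c → ⟦ b ∧ c ⟧ ≈ ⟦ b ⟧ * ⟦ c ⟧
  ⟦⟧-∧ true  c = sym (*-identityˡ _)
  ⟦⟧-∧ false c = sym (zeroˡ _)

  sum< : ℕ → (ℕ → Carrier) → Carrier
  sum< zero    f = 0#
  sum< (suc n) f = sum< n f + f n

  sum<-cong : ∀ n {f g} → (∀ m → m ℕ.< n → f m ≈ g m) → sum< n f ≈ sum< n g
  sum<-cong zero    _   = refl
  sum<-cong (suc n) f≈g =
    +-cong (sum<-cong n (λ m m<n → f≈g m (ℕ.m<n⇒m<1+n m<n))) (f≈g n ℕ.≤-refl)

  sum<-+ : ∀ n f g → sum< n (λ m → f m + g m) ≈ sum< n f + sum< n g
  sum<-+ zero    f g = sym (+-identityˡ 0#)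
  sum<-+ (suc n) f g = trans (+-congʳ (sum<-+ n f g))
    (solve 4 (λ a b c d → (a :+ b) :+ (c :+ d) := (a :+ c) :+ (b :+ d)) refl
      (sum< n f) (sum< n g) (f n) (g n))

  sum<-* : ∀ n a f → sum< n (λ m → a * f m) ≈ a * sum< n f
  sum<-* zero    a f = sym (zeroʳ a)
  sum<-* (suc n) a f = trans (+-congʳ (sum<-* n a f)) (sym (distribˡ a _ _))

  sum<-0 : ∀ n → sum< n (λ _ → 0#) ≈ 0#
  sum<-0 zero    = refl
  sum<-0 (suc n) = trans (+-identityʳ _) (sum<-0 n)

  sum<-head : ∀ n f → sum< (suc n) f ≈ f 0 + sum< n (f ∘ suc)
  sum<-head zero    f = +-comm _ _
  sum<-head (suc n) f = trans (+-congʳ (sum<-head n f)) (+-assoc _ _ _)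

  -- The sum over the weakly increasing words of length l in the letters
  -- 0, …, n-1, grouped by the number of occurrences of the largest letter.
  sumSorted : ℕ → ℕ → (List ℕ → Carrier) → Carrier
  sumSorted zero    zero    f = f []
  sumSorted zero    (suc l) f = 0#
  sumSorted (suc n) l       f =
    sum< (suc l) λ m → sumSorted n m λ u → f (u ++ replicate (l ∸ m) n)

  private
    replicate-< : ∀ {n} k → All (ℕ._< suc n) (replicate k n)
    replicate-< k = All.replicate⁺ k ℕ.≤-refl

  sumSorted-cong : ∀ n l {f g} →
    (∀ u → All (ℕ._< n) u → length u ≡ l → f u ≈ g u) → sumSorted n l f ≈ sumSorted n l g
  sumSorted-cong zero    zero    f≈g = f≈g [] [] ≡.refl
  sumSorted-cong zero    (suc l) f≈g = refl
  sumSorted-cong (suc n) l       f≈g = sum<-cong (suc l) λ m m<1+l →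
    sumSorted-cong n m λ u u<n ≡m → f≈g _
      (All.++⁺ (All.map ℕ.m<n⇒m<1+n u<n) (replicate-< (l ∸ m)))
      (≡.trans (length-++ u) (≡.trans
        (≡.cong₂ ℕ._+_ ≡m (List.length-replicate (l ∸ m)))
        (ℕ.m+[n∸m]≡n (ℕ.≤-pred m<1+l))))

  sumSorted-+ : ∀ n l f g →
    sumSorted n l (λ u → f u + g u) ≈ sumSorted n l f + sumSorted n l g
  sumSorted-+ zero    zero    f g = refl
  sumSorted-+ zero    (suc l) f g = sym (+-identityˡ 0#)
  sumSorted-+ (suc n) l       f g = trans
    (sum<-cong (suc l) λ m _ → sumSorted-+ n m _ _) (sum<-+ (suc l) _ _)

  sumSorted-* : ∀ n l a f → sumSorted n l (λ u → a * f u) ≈ a * sumSorted n l f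
  sumSorted-* zero    zero    a f = refl
  sumSorted-* zero    (suc l) a f = sym (zeroʳ a)
  sumSorted-* (suc n) l       a f = trans
    (sum<-cong (suc l) λ m _ → sumSorted-* n m a _) (sum<-* (suc l) a _)

  sumSorted-0 : ∀ n l → sumSorted n l (λ _ → 0#) ≈ 0#
  sumSorted-0 zero    zero    = refl
  sumSorted-0 zero    (suc l) = refl
  sumSorted-0 (suc n) l       =
    trans (sum<-cong (suc l) λ m _ → sumSorted-0 n m) (sum<-0 (suc l))

  sumSorted-sum< : ∀ n l k (f : List ℕ → ℕ → Carrier) →
    sumSorted n l (λ u → sum< k (f u)) ≈ sum< k (λ m → sumSorted n l (λ u → f u m))
  sumSorted-sum< n l zero    f = sumSorted-0 n l
  sumSorted-sum< n l (suc k) f =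
    trans (sumSorted-+ n l _ _) (+-congʳ (sumSorted-sum< n l k f))

  sumSorted-[] : ∀ n f → sumSorted n 0 f ≈ f []
  sumSorted-[] zero    f = refl
  sumSorted-[] (suc n) f = trans (+-identityˡ _) (sumSorted-[] n _)

  -- The sum over the μ that interlace with (l₁, …, lⱼ) when each lᵢ₊₁ is at
  -- most μᵢ, and l₁ at most q.
  interlacing : ∀ {j} → Carrier → ℕ → Vec ℕ j → (Vec ℕ j → Carrier) → Carrier
  interlacing y q []       f = f []
  interlacing y q (l ∷ ls) f =
    ⟦ l ℕ.<ᵇ suc q ⟧ * sum< (suc l) λ m → y ^ (l ∸ m) * interlacing y m ls (f ∘ (m ∷_))

  private
    *-exchange : ∀ a b c → a * (b * c) ≈ b * (a * c)
    *-exchange = solve 3 (λ a b c → a :* (b :* c) := b :* (a :* c)) refl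

  -- Interchange of finite sums: the range of μ does not depend on the word `u`.
  sumSorted-interlacing : ∀ {j} n l y q (ls : Vec ℕ j) (a : List ℕ → Carrier)
    (F : List ℕ → Vec ℕ j → Carrier) →
    sumSorted n l (λ u → a u * interlacing y q ls (F u)) ≈
      interlacing y q ls (λ μ → sumSorted n l (λ u → a u * F u μ))
  sumSorted-interlacing n l y q []       a F = refl
  sumSorted-interlacing n l y q (k ∷ ls) a F = begin
    sumSorted n l (λ u → a u * (b * sum< (suc k) (λ m → y ^ (k ∸ m) * G u m)))
      ≈⟨ sumSorted-cong n l (λ u _ _ → trans (*-exchange _ _ _) (*-congˡ
           (trans (sym (sum<-* (suc k) _ _)) (sum<-cong (suc k) λ m _ → *-exchange _ _ _)))) ⟩
    sumSorted n l (λ u → b * sum< (suc k) (λ m → y ^ (k ∸ m) * (a u * G u m)))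
      ≈⟨ sumSorted-* n l b _ ⟩
    b * sumSorted n l (λ u → sum< (suc k) (λ m → y ^ (k ∸ m) * (a u * G u m)))
      ≈⟨ *-congˡ (sumSorted-sum< n l (suc k) _) ⟩
    b * sum< (suc k) (λ m → sumSorted n l (λ u → y ^ (k ∸ m) * (a u * G u m)))
      ≈⟨ *-congˡ (sum<-cong (suc k) λ m _ → trans (sumSorted-* n l _ _)
           (*-congˡ (sumSorted-interlacing n l y m ls a (λ u → F u ∘ (m ∷_))))) ⟩
    b * sum< (suc k) (λ m → y ^ (k ∸ m) *
      interlacing y m ls (λ μ → sumSorted n l (λ u → a u * F u (m ∷ μ)))) ∎
    where
    b = ⟦ k ℕ.<ᵇ suc q ⟧
    G = λ u m → interlacing y m ls (F u ∘ (m ∷_))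

  -- No row stands above the first one, so `l` carries no bound.
  interlacing₁ : ∀ {j} → Carrier → ℕ → Vec ℕ j → (Vec ℕ (suc j) → Carrier) → Carrier
  interlacing₁ y l ls f = sum< (suc l) λ m → y ^ (l ∸ m) * interlacing y m ls (f ∘ (m ∷_))

  -- As `interlacing₁`, with the last entry of μ omitted.
  interlacing₂ : ∀ {j} → Carrier → ℕ → Vec ℕ j → (Vec ℕ j → Carrier) → Carrier
  interlacing₂ y l []       f = y ^ l * f []
  interlacing₂ y l (k ∷ ls) f = sum< (suc l) λ m →
    y ^ (l ∸ m) * (⟦ k ℕ.<ᵇ suc m ⟧ * interlacing₂ y k ls (f ∘ (m ∷_)))

  -- The hypotheses are those met by Schur polynomials in as many letters as `g` has parts: a column
  -- of a tableau cannot be longer than the alphabet, so a positive last part of μ contributes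
  -- nothing.
  interlacing₁≈interlacing₂ : ∀ {j} y l (ls : Vec ℕ j) {f g} →
    (∀ μ → f (μ ∷ʳ 0) ≈ g μ) → (∀ μ k → f (μ ∷ʳ suc k) ≈ 0#) →
    interlacing₁ y l ls f ≈ interlacing₂ y l ls g
  interlacing₁≈interlacing₂ y l [] {f} {g} f0 f+ = begin
    sum< (suc l) (λ m → y ^ (l ∸ m) * f (m ∷ []))
      ≈⟨ sum<-head l _ ⟩
    y ^ l * f (0 ∷ []) + sum< l (λ m → y ^ (l ∸ suc m) * f (suc m ∷ []))
      ≈⟨ +-cong (*-congˡ (f0 [])) (trans
           (sum<-cong l λ m _ → trans (*-congˡ (f+ [] m)) (zeroʳ _)) (sum<-0 l)) ⟩
    y ^ l * g [] + 0#
      ≈⟨ +-identityʳ _ ⟩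
    y ^ l * g [] ∎
  interlacing₁≈interlacing₂ y l (k ∷ ls) {f} {g} f0 f+ = sum<-cong (suc l) λ m _ →
    *-congˡ (*-congˡ (interlacing₁≈interlacing₂ y k ls {f ∘ (m ∷_)} {g ∘ (m ∷_)}
      (f0 ∘ (m ∷_)) (f+ ∘ (m ∷_))))

  module _ (x : ℕ → Carrier) where

    weight : List ℕ → Carrier
    weight []      = 1#
    weight (a ∷ u) = x a * weight u

    weight-++-replicate : ∀ u k n → weight (u ++ replicate k n) ≈ x n ^ k * weight u
    weight-++-replicate []      zero    n = sym (*-identityˡ _)
    weight-++-replicate []      (suc k) n =
      trans (*-congˡ (weight-++-replicate [] k n)) (sym (*-assoc _ _ _))
    weight-++-replicate (a ∷ u) k       n =
      trans (*-congˡ (weight-++-replicate u k n)) (*-exchange _ _ _)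

    sumBelow : ∀ {j} → ℕ → List ℕ → Vec ℕ j → Carrier
    sumBelow n p []       = 1#
    sumBelow n p (l ∷ ls) =
      sumSorted n l λ u → ⟦ columnStrict p u ⟧ * weight u * sumBelow n u ls

    schur : ∀ {j} → ℕ → Vec ℕ j → Carrier
    schur n []       = 1#
    schur n (l ∷ ls) = sumSorted n l λ u → weight u * sumBelow n u ls

    -- Removing the letters `n` from every row leaves a tableau of interlacing shape. The number `k`
    -- of letters removed above drops out, because only the length of `p` bounds the next row.
    sumBelow-branching : ∀ {j} n {p} k (ls : Vec ℕ j) → All (ℕ._< n) p →
      sumBelow (suc n) (p ++ replicate k n) ls ≈
        interlacing (x n) (length p) ls (sumBelow n p)
    sumBelow-branching n k []       p<n = refl
    sumBelow-branching n {p} k (l ∷ ls) p<n = begin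
      sum< (suc l) (λ m → sumSorted n m (λ u →
        ⟦ columnStrict (p ++ replicate k n) (u ++ replicate (l ∸ m) n) ⟧
          * weight (u ++ replicate (l ∸ m) n) * sumBelow (suc n) (u ++ replicate (l ∸ m) n) ls))
        ≈⟨ sum<-cong (suc l) (λ m m<1+l → trans
             (sumSorted-cong n m (λ u u<n ≡m → step m m<1+l u u<n ≡m))
             (trans (sumSorted-* n m _ _) (trans (*-congˡ (trans (sumSorted-* n m _ _) (*-congˡ
               (sumSorted-interlacing n m (x n) m ls _ (sumBelow n))))) refl))) ⟩
      sum< (suc l) (λ m → b * (x n ^ (l ∸ m) * interlacing (x n) m ls (sumBelow n p ∘ (m ∷_))))
        ≈⟨ sum<-* (suc l) b _ ⟩
      b * sum< (suc l) (λ m → x n ^ (l ∸ m) * interlacing (x n) m ls (sumBelow n p ∘ (m ∷_))) ∎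
      where
      b = ⟦ l ℕ.<ᵇ suc (length p) ⟧
      step : ∀ m → m ℕ.< suc l → ∀ u → All (ℕ._< n) u → length u ≡ m →
        ⟦ columnStrict (p ++ replicate k n) (u ++ replicate (l ∸ m) n) ⟧
          * weight (u ++ replicate (l ∸ m) n) * sumBelow (suc n) (u ++ replicate (l ∸ m) n) ls
        ≈ b * (x n ^ (l ∸ m) *
            (⟦ columnStrict p u ⟧ * weight u * interlacing (x n) m ls (sumBelow n u)))
      step m m<1+l u u<n ≡.refl = begin
        ⟦ columnStrict (p ++ replicate k n) (u ++ replicate (l ∸ m) n) ⟧
          * weight (u ++ replicate (l ∸ m) n) * sumBelow (suc n) (u ++ replicate (l ∸ m) n) ls
          ≈⟨ *-cong (*-cong
               (trans (reflexive (≡.cong ⟦_⟧ (≡.trans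
                  (columnStrict-++-replicate k (l ∸ m) p<n u<n)
                  (≡.cong (λ i → (i ℕ.<ᵇ suc (length p)) ∧ columnStrict p u)
                    (ℕ.m+[n∸m]≡n (ℕ.≤-pred m<1+l))))))
                 (⟦⟧-∧ (l ℕ.<ᵇ suc (length p)) _))
               (weight-++-replicate u (l ∸ m) n))
               (sumBelow-branching n (l ∸ m) ls u<n) ⟩
        b * ⟦ columnStrict p u ⟧ * (x n ^ (l ∸ m) * weight u)
          * interlacing (x n) (length u) ls (sumBelow n u)
          ≈⟨ solve 5 (λ b c y w i → b :* c :* (y :* w) :* i := b :* (y :* (c :* w :* i))) refl
               b ⟦ columnStrict p u ⟧ (x n ^ (l ∸ m)) (weight u) _ ⟩
        b * (x n ^ (l ∸ m) *
          (⟦ columnStrict p u ⟧ * weight u * interlacing (x n) m ls (sumBelow n u))) ∎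

    schur-branching₁ : ∀ {j} n l (ls : Vec ℕ j) →
      schur (suc n) (l ∷ ls) ≈ interlacing₁ (x n) l ls (schur n)
    schur-branching₁ n l ls = sum<-cong (suc l) λ m m<1+l → trans
      (sumSorted-cong n m λ { u u<n ≡.refl → trans
        (*-cong (weight-++-replicate u (l ∸ m) n) (sumBelow-branching n (l ∸ m) ls u<n))
        (*-assoc _ _ _) })
      (trans (sumSorted-* n m _ _) (*-congˡ
        (sumSorted-interlacing n m (x n) m ls weight (sumBelow n))))

    -- Column strictness forces the entries of the (i+1)-st row to be at least i.
    sumBelow-vanishes : ∀ {j} n {h p} (ls : Vec ℕ j) k → All (h ℕ.≤_) p →
      n ℕ.≤ h ℕ.+ suc j → sumBelow n p (ls ∷ʳ suc k) ≈ 0#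
    sumBelow-vanishes n {h} {p} [] k h≤p n≤ = trans
      (sumSorted-cong n (suc k) λ u u<n ≡k → vanish u u<n ≡k)
      (sumSorted-0 n (suc k))
      where
      vanish : ∀ u → All (ℕ._< n) u → length u ≡ suc k →
        ⟦ columnStrict p u ⟧ * weight u * 1# ≈ 0#
      vanish (b ∷ u) (b<n ∷ _) _ with columnStrict p (b ∷ u) in eq
      ... | false = trans (*-congʳ (zeroˡ _)) (zeroˡ _)
      ... | true with h<b ∷ _ ← columnStrict-lower p (b ∷ u) eq h≤p = contradiction
        (ℕ.≤-trans (s≤s h<b) (ℕ.≤-trans b<n (ℕ.≤-trans n≤ (ℕ.≤-reflexive (ℕ.+-comm h 1)))))
        (ℕ.n≮n _)
    sumBelow-vanishes {suc j} n {h} {p} (l ∷ ls) k h≤p n≤ = trans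
      (sumSorted-cong n l λ u _ _ → vanish u) (sumSorted-0 n l)
      where
      vanish : ∀ u →
        ⟦ columnStrict p u ⟧ * weight u * sumBelow n u (ls ∷ʳ suc k) ≈ 0#
      vanish u with columnStrict p u in eq
      ... | false = trans (*-congʳ (zeroˡ _)) (zeroˡ _)
      ... | true  = trans (*-congˡ (sumBelow-vanishes n ls k (columnStrict-lower p u eq h≤p)
        (≡.subst (n ℕ.≤_) (ℕ.+-suc h (suc j)) n≤))) (zeroʳ _)

    schur-vanishes : ∀ {n} (ls : Vec ℕ n) k → schur n (ls ∷ʳ suc k) ≈ 0#
    schur-vanishes         []       k = refl
    schur-vanishes {suc n} (l ∷ ls) k = trans
      (sumSorted-cong (suc n) l λ u _ _ → trans
        (*-congˡ {weight u} (sumBelow-vanishes (suc n) ls k (All.universal (λ _ → z≤n) u) ℕ.≤-refl))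
        (zeroʳ (weight u)))
      (sumSorted-0 (suc n) l)

    sumBelow-∷ʳ0 : ∀ {j} n {p} (ls : Vec ℕ j) → sumBelow n p (ls ∷ʳ 0) ≈ sumBelow n p ls
    sumBelow-∷ʳ0 n []       = trans (sumSorted-[] n _)
      (trans (*-identityʳ _) (*-identityʳ _))
    sumBelow-∷ʳ0 n (l ∷ ls) = sumSorted-cong n l λ u _ _ → *-congˡ (sumBelow-∷ʳ0 n ls)

    schur-∷ʳ0 : ∀ {n} (ls : Vec ℕ n) → schur n (ls ∷ʳ 0) ≈ schur n ls
    schur-∷ʳ0         []       = *-identityʳ _
    schur-∷ʳ0 {suc n} (l ∷ ls) =
      sumSorted-cong (suc n) l λ u _ _ → *-congˡ {weight u} (sumBelow-∷ʳ0 (suc n) {u} ls)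

    schur-branching : ∀ {n} l (ls : Vec ℕ n) →
      schur (suc n) (l ∷ ls) ≈ interlacing₂ (x n) l ls (schur n)
    schur-branching {n} l ls = trans (schur-branching₁ n l ls)
      (interlacing₁≈interlacing₂ (x n) l ls {schur n} {schur n} schur-∷ʳ0 schur-vanishes)

-- The bialternant formula

Decreasing : ∀ {n} → ℕ → Vec ℕ n → Set
Decreasing b []       = ⊤
Decreasing b (l ∷ ls) = l ℕ.≤ b × Decreasing l ls

Decreasing-mono : ∀ {n b b′} (ls : Vec ℕ n) → b ℕ.≤ b′ → Decreasing b ls → Decreasing b′ ls
Decreasing-mono []       _    _         = tt
Decreasing-mono (l ∷ ls) b≤b′ (l≤b , d) = ℕ.≤-trans l≤b b≤b′ , d

betas : ∀ {n} → Vec ℕ n → List ℕ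
betas             []       = []
betas {n = suc n} (l ∷ ls) = l ℕ.+ n ∷ betas ls

private
  excess : ∀ {m n} → m ℕ.≤ n → ∃ λ e → n ≡ e ℕ.+ m
  excess {m} {n} m≤n = n ∸ m , ≡.sym (ℕ.m∸n+n≡m m≤n)

module Bialternants {c ℓ} (R : CommutativeRing c ℓ) where
  open CommutativeRing R hiding (zero)
  open Exp semiring using (_^_; ^-congʳ)
  open IntegerCoefficients R using (solve; _:=_; con; _:+_; _:*_; _:-_; :-_)
  open Determinants R
  open Branching R
  open SetoidReasoning setoid

  monomial : ℕ → Column
  monomial k r = r ^ k

  monomials : List ℕ → List Column
  monomials = map monomial

  interlacing₂-* : ∀ {j} y l (ls : Vec ℕ j) a f →
    interlacing₂ y l ls (λ μ → a * f μ) ≈ a * interlacing₂ y l ls f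
  interlacing₂-* y l []       a f =
    solve 3 (λ y a f → y :* (a :* f) := a :* (y :* f)) refl (y ^ l) a (f [])
  interlacing₂-* y l (k ∷ ls) a f = trans
    (sum<-cong (suc l) λ m _ → trans
      (*-congˡ (*-congˡ (interlacing₂-* y k ls a (f ∘ (m ∷_)))))
      (solve 4 (λ y b a i → y :* (b :* (a :* i)) := a :* (y :* (b :* i))) refl
        (y ^ (l ∸ m)) ⟦ k ℕ.<ᵇ suc m ⟧ a (interlacing₂ y k ls (f ∘ (m ∷_)))))
    (sum<-* (suc l) a _)

  -- Interlacing gives μᵢ₊₁ ≤ λᵢ₊₁ ≤ μᵢ, so each μ that contributes is itself a partition. This
  -- makes the induction hypothesis of `bialternant` applicable.
  interlacing₂-cong : ∀ {j} y l (ls : Vec ℕ j) {f g} → Decreasing l ls →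
    (∀ μ → Decreasing l μ → f μ ≈ g μ) → interlacing₂ y l ls f ≈ interlacing₂ y l ls g
  interlacing₂-cong y l []       _         f≈g = *-congˡ (f≈g [] tt)
  interlacing₂-cong y l (k ∷ ls) {f} {g} (k≤l , d) f≈g =
    sum<-cong (suc l) λ m m<1+l → *-congˡ (body m (ℕ.≤-pred m<1+l))
    where
    body : ∀ m → m ℕ.≤ l →
      ⟦ k ℕ.<ᵇ suc m ⟧ * interlacing₂ y k ls (f ∘ (m ∷_)) ≈
      ⟦ k ℕ.<ᵇ suc m ⟧ * interlacing₂ y k ls (g ∘ (m ∷_))
    body m m≤l with k ℕ.<ᵇ suc m in eq
    ... | false = trans (zeroˡ _) (sym (zeroˡ _))
    ... | true  = *-congˡ (interlacing₂-cong y k ls d λ μ d′ →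
      f≈g (m ∷ μ) (m≤l , Decreasing-mono μ (ℕ.≤-pred (<ᵇ≡true⇒< eq)) d′))

  expand-sum< : ∀ {r} n (a : ℕ → Carrier) (h : ℕ → List Column → Carrier) cs →
    expand r (λ ds → sum< n (λ m → a m * h m ds)) cs ≈ sum< n (λ m → a m * expand r (h m) cs)
  expand-sum<     zero    a h cs = expand-0 cs
  expand-sum< {r} (suc n) a h cs = begin
    expand r (λ ds → sum< n (λ m → a m * h m ds) + a n * h n ds) cs
      ≈⟨ expand-congᵍ (λ ds → +-congʳ (sym (*-identityˡ _))) cs ⟩
    expand r (λ ds → 1# * sum< n (λ m → a m * h m ds) + a n * h n ds) cs
      ≈⟨ expand-linear {r} {λ ds → sum< n (λ m → a m * h m ds)} {h n} 1# (a n) cs ⟩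
    1# * expand r (λ ds → sum< n (λ m → a m * h m ds)) cs + a n * expand r (h n) cs
      ≈⟨ +-congʳ (trans (*-identityˡ _) (expand-sum< n a h cs)) ⟩
    sum< n (λ m → a m * expand r (h m) cs) + a n * expand r (h n) cs ∎

  linear-sum< : ∀ {rs g} → Alternating rs g → ∀ n {c} (a : ℕ → Carrier) (d : ℕ → Column) ds →
    Agree rs c (λ r → sum< n (λ m → a m * d m r)) →
    g (c ∷ ds) ≈ sum< n (λ m → a m * g (d m ∷ ds))
  linear-sum<          alt zero    a d ds p = vanishing-column alt p [] ds
  linear-sum< {rs} {g} alt (suc n) {c} a d ds p = begin
    g (c ∷ ds)
      ≈⟨ linear alt [] {d = λ r → sum< n (λ m → a m * d m r)} 1# (a n) ds
           (All.map (λ q → trans q (+-congʳ (sym (*-identityˡ _)))) p) ⟩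
    1# * g ((λ r → sum< n (λ m → a m * d m r)) ∷ ds) + a n * g (d n ∷ ds)
      ≈⟨ +-congʳ (trans (*-identityˡ _)
           (linear-sum< alt n a d ds (agree (λ _ → refl) rs))) ⟩
    sum< n (λ m → a m * g (d m ∷ ds)) + a n * g (d n ∷ ds) ∎

  -- A geometric sum over k ≤ m ≤ e + k, the bracket removing the smaller m. The right side combines
  -- the monomials of two neighbouring columns with parts e + k and k; the left side shows that the
  -- combination vanishes at r = y.
  telescoping : ∀ e k n y r →
    (y - r) * sum< (suc (e ℕ.+ k))
      (λ m → (y ^ (e ℕ.+ k ∸ m) * ⟦ k ℕ.<ᵇ suc m ⟧) * r ^ (m ℕ.+ n))
    ≈ y ^ suc e * r ^ (k ℕ.+ n) - r ^ (e ℕ.+ k ℕ.+ suc n)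
  telescoping zero k n y r = begin
    (y - r) * (sum< k f + (y ^ (k ∸ k) * ⟦ k ℕ.<ᵇ suc k ⟧) * r ^ (k ℕ.+ n))
      ≈⟨ *-congˡ (+-cong
           (trans (sum<-cong k λ m m<k → trans
             (*-congʳ (trans (*-congˡ (reflexive (≡.cong ⟦_⟧ (≤⇒<ᵇ≡false m<k)))) (zeroʳ _)))
             (zeroˡ _)) (sum<-0 k))
           (*-congʳ (*-cong (^-congʳ y (ℕ.n∸n≡0 k))
             (reflexive (≡.cong ⟦_⟧ (<⇒<ᵇ≡true (ℕ.n<1+n k))))))) ⟩
    (y - r) * (0# + (1# * 1#) * r ^ (k ℕ.+ n))
      ≈⟨ *-congˡ (trans (+-identityˡ _) (trans (*-congʳ (*-identityˡ 1#)) (*-identityˡ _))) ⟩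
    (y - r) * r ^ (k ℕ.+ n)
      ≈⟨ solve 3 (λ y r p → (y :- r) :* p := y :* p :- r :* p) refl y r (r ^ (k ℕ.+ n)) ⟩
    y * r ^ (k ℕ.+ n) - r ^ suc (k ℕ.+ n)
      ≈⟨ +-cong (*-congʳ (sym (*-identityʳ y))) (-‿cong (^-congʳ r (≡.sym (ℕ.+-suc k n)))) ⟩
    (y * 1#) * r ^ (k ℕ.+ n) - r ^ (k ℕ.+ suc n) ∎
    where
    f : ℕ → Carrier
    f m = (y ^ (k ∸ m) * ⟦ k ℕ.<ᵇ suc m ⟧) * r ^ (m ℕ.+ n)
  telescoping (suc e) k n y r = begin
    (y - r) * (sum< (suc (e ℕ.+ k)) f⁺ + f⁺ (suc (e ℕ.+ k)))
      ≈⟨ *-congˡ (+-cong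
           (trans (sum<-cong (suc (e ℕ.+ k)) λ m m<1+l → trans
             (*-congʳ (*-congʳ (^-congʳ y (ℕ.+-∸-assoc 1 (ℕ.≤-pred m<1+l)))))
             (solve 4 (λ y p b q → ((y :* p) :* b) :* q := y :* ((p :* b) :* q)) refl
               y (y ^ (e ℕ.+ k ∸ m)) ⟦ k ℕ.<ᵇ suc m ⟧ (r ^ (m ℕ.+ n))))
             (sum<-* (suc (e ℕ.+ k)) y f))
           (*-congʳ (*-cong (^-congʳ y (ℕ.n∸n≡0 (e ℕ.+ k)))
             (reflexive (≡.cong ⟦_⟧ (<⇒<ᵇ≡true
               (s≤s (ℕ.≤-trans (ℕ.m≤n+m k e) (ℕ.n≤1+n (e ℕ.+ k)))))))))) ⟩
    (y - r) * (y * S + (1# * 1#) * (r * r ^ (e ℕ.+ k ℕ.+ n)))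
      ≈⟨ trans (*-congˡ (+-congˡ (trans (*-congʳ (*-identityˡ 1#)) (*-identityˡ _))))
           (solve 4 (λ y r S q → (y :- r) :* (y :* S :+ r :* q)
              := y :* ((y :- r) :* S) :+ (y :- r) :* (r :* q)) refl
             y r S (r ^ (e ℕ.+ k ℕ.+ n))) ⟩
    y * ((y - r) * S) + (y - r) * r ^ suc (e ℕ.+ k ℕ.+ n)
      ≈⟨ +-cong (*-congˡ (telescoping e k n y r))
           (*-congˡ (^-congʳ r (≡.sym (ℕ.+-suc (e ℕ.+ k) n)))) ⟩
    y * (y ^ suc e * r ^ (k ℕ.+ n) - r ^ (e ℕ.+ k ℕ.+ suc n))
      + (y - r) * r ^ (e ℕ.+ k ℕ.+ suc n)
      ≈⟨ solve 5 (λ y r p q s → y :* (p :* q :- s) :+ (y :- r) :* s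
           := (y :* p) :* q :- r :* s) refl
           y r (y ^ suc e) (r ^ (k ℕ.+ n)) (r ^ (e ℕ.+ k ℕ.+ suc n)) ⟩
    y * y ^ suc e * r ^ (k ℕ.+ n) - r * r ^ (e ℕ.+ k ℕ.+ suc n) ∎
    where
    f f⁺ : ℕ → Carrier
    f  m = (y ^ (e ℕ.+ k ∸ m) * ⟦ k ℕ.<ᵇ suc m ⟧) * r ^ (m ℕ.+ n)
    f⁺ m = (y ^ (suc (e ℕ.+ k) ∸ m) * ⟦ k ℕ.<ᵇ suc m ⟧) * r ^ (m ℕ.+ n)
    S = sum< (suc (e ℕ.+ k)) f

  -- The multiple of `d` repeats the next column and contributes nothing. As `v` vanishes at `y`,
  -- its column stays in the minor, and the sign of the second place in the expansion turns `- v`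
  -- into `v`.
  expand-eliminate : ∀ {y rs g} → Alternating rs g → ∀ a {v} c d ds →
    Agree (y ∷ rs) c (λ r → a * d r + (- 1#) * v r) → v y ≈ 0# →
    expand y g (c ∷ d ∷ ds) ≈ expand y (g ∘ (v ∷_)) (d ∷ ds)
  expand-eliminate {y} {rs} {g} alt a {v} c d ds p vy≈0 = begin
    expand y g (c ∷ d ∷ ds)
      ≈⟨ linear (expand-alternating alt) [] a (- 1#) (d ∷ ds) p ⟩
    a * expand y g (d ∷ d ∷ ds) + (- 1#) * (v y * g (d ∷ ds) - E)
      ≈⟨ +-cong (*-congˡ (alternating (expand-alternating alt) [] d ds))
                (*-congˡ (+-congʳ (*-congʳ vy≈0))) ⟩
    a * 0# + (- 1#) * (0# * g (d ∷ ds) - E)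
      ≈⟨ +-cong (zeroʳ a) (*-congˡ (+-congʳ (zeroˡ _))) ⟩
    0# + (- 1#) * (0# - E)
      ≈⟨ +-congˡ (solve 2 (λ u e → (:- u) :* (con 0ℤ :- e) := u :* e) refl 1# E) ⟩
    0# + 1# * E
      ≈⟨ trans (+-identityˡ _) (*-identityˡ _) ⟩
    E ∎
    where E = expand y (g ∘ (v ∷_)) (d ∷ ds)

  differenceFrom : Carrier → Carrier → Carrier
  differenceFrom y r = y - r

  weighted : (Carrier → Carrier) → Column → Column
  weighted h c r = h r * c r

  expand-betas : ∀ {n y rs g} → Alternating rs g → ∀ l (ls : Vec ℕ n) → Decreasing l ls →
    expand y g (monomials (betas (l ∷ ls))) ≈
      interlacing₂ y l ls (λ μ → g (map (weighted (differenceFrom y)) (monomials (betas μ))))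
  expand-betas {y = y} alt l [] _ = trans
    (+-cong (*-congʳ (^-congʳ y (ℕ.+-identityʳ l)))
            (sym (solve 0 (con 0ℤ := :- con 0ℤ) refl)))
    (+-identityʳ _)
  expand-betas {n = suc n} {y} {rs} {g} alt l (k ∷ ls) (k≤l , d)
    with e , ≡.refl ← excess k≤l = begin
    expand y g (monomial (l ℕ.+ suc n) ∷ cs)
      ≈⟨ expand-eliminate alt (y ^ suc e) {v} (monomial (l ℕ.+ suc n)) (monomial (k ℕ.+ n)) _
           (agree (λ r → trans
             (solve 2 (λ a b → b := a :- (a :- b)) refl
               (y ^ suc e * r ^ (k ℕ.+ n)) (r ^ (l ℕ.+ suc n)))
             (+-congˡ (trans (-‿cong (trans (sym (telescoping e k n y r)) (sym (*-identityˡ _))))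
               (solve 2 (λ u v → :- (u :* v) := (:- u) :* v) refl 1# (v r))))) (y ∷ rs))
           (trans (*-congʳ (-‿inverseʳ y)) (zeroˡ _)) ⟩
    expand y (g ∘ (v ∷_)) cs
      ≈⟨ expand-congᵍ (λ ds → linear-sum< alt (suc l) a w ds (agree (λ r → trans
           (sym (sum<-* (suc l) (y - r) _))
           (sum<-cong (suc l) λ m _ → solve 3 (λ z a p → z :* (a :* p) := a :* (z :* p)) refl
             (y - r) (a m) (r ^ (m ℕ.+ n)))) rs)) cs ⟩
    expand y (λ ds → sum< (suc l) (λ m → a m * g (w m ∷ ds))) cs
      ≈⟨ expand-sum< (suc l) a (λ m ds → g (w m ∷ ds)) cs ⟩
    sum< (suc l) (λ m → a m * expand y (g ∘ (w m ∷_)) cs)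
      ≈⟨ sum<-cong (suc l) (λ m _ → trans
           (*-congˡ (expand-betas (prefix (w m) alt) k ls d)) (*-assoc _ _ _)) ⟩
    interlacing₂ y l (k ∷ ls) (λ μ → g (map (weighted (differenceFrom y)) (monomials (betas μ)))) ∎
    where
    cs = monomials (betas (k ∷ ls))
    a : ℕ → Carrier
    a m = y ^ (l ∸ m) * ⟦ k ℕ.<ᵇ suc m ⟧
    w : ℕ → Column
    w m = weighted (differenceFrom y) (monomial (m ℕ.+ n))
    v : Column
    v r = (y - r) * sum< (suc l) (λ m → a m * r ^ (m ℕ.+ n))

  ∏ : (Carrier → Carrier) → List Carrier → Carrier
  ∏ h []       = 1#
  ∏ h (r ∷ rs) = h r * ∏ h rs

  expand-weighted : ∀ {h r a g g′} → (∀ cs → g (map (weighted h) cs) ≈ a * g′ cs) →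
    ∀ cs → expand r g (map (weighted h) cs) ≈ h r * a * expand r g′ cs
  expand-weighted g≈ []       = sym (zeroʳ _)
  expand-weighted {h} {r} {a} {g} {g′} g≈ (c ∷ cs) = trans
    (+-cong (*-congˡ (g≈ cs))
      (-‿cong (expand-weighted {g = g ∘ (weighted h c ∷_)} {g′ ∘ (c ∷_)} (g≈ ∘ (c ∷_)) cs)))
    (solve 5 (λ h c a g e → (h :* c) :* (a :* g) :- (h :* a) :* e
      := (h :* a) :* (c :* g :- e)) refl (h r) (c r) a (g′ cs) (expand r (g′ ∘ (c ∷_)) cs))

  det-weighted : ∀ h rs cs → det rs (map (weighted h) cs) ≈ ∏ h rs * det rs cs
  det-weighted h []       []       = sym (*-identityˡ _)
  det-weighted h []       (_ ∷ _)  = sym (zeroʳ _)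
  det-weighted h (r ∷ rs) cs       = expand-weighted (det-weighted h rs) cs

  module _ (x : ℕ → Carrier) where

    points : ℕ → List Carrier
    points zero    = []
    points (suc n) = x n ∷ points n

    vandermonde : ℕ → Carrier
    vandermonde zero    = 1#
    vandermonde (suc n) = ∏ (differenceFrom (x n)) (points n) * vandermonde n

    bialternant : ∀ {n b} (ls : Vec ℕ n) → Decreasing b ls →
      det (points n) (monomials (betas ls)) ≈ vandermonde n * schur x n ls
    bialternant         []       _       = sym (*-identityˡ _)
    bialternant {suc n} (l ∷ ls) (_ , d) = begin
      expand (x n) (det (points n)) (monomials (betas (l ∷ ls)))
        ≈⟨ expand-betas (det-alternating (points n)) l ls d ⟩
      interlacing₂ (x n) l ls
        (λ μ → det (points n) (map (weighted (differenceFrom (x n))) (monomials (betas μ))))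
        ≈⟨ interlacing₂-cong (x n) l ls d (λ μ d′ → trans
             (det-weighted (differenceFrom (x n)) (points n) (monomials (betas μ)))
             (trans (*-congˡ (bialternant μ d′)) (sym (*-assoc _ _ _)))) ⟩
      interlacing₂ (x n) l ls (λ μ → vandermonde (suc n) * schur x n μ)
        ≈⟨ interlacing₂-* (x n) l ls _ (schur x n) ⟩
      vandermonde (suc n) * interlacing₂ (x n) l ls (schur x n)
        ≈⟨ *-congˡ (schur-branching x l ls) ⟨
      vandermonde (suc n) * schur x (suc n) (l ∷ ls) ∎

-- Semistandard tableaux as chains of words

private
  ∧-split : ∀ {a b} → a ∧ b ≡ true → a ≡ true × b ≡ true
  ∧-split {true} {true} _ = ≡.refl , ≡.refl

  ∧-join : ∀ {a b} → a ≡ true → b ≡ true → a ∧ b ≡ true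
  ∧-join ≡.refl ≡.refl = ≡.refl

atLeast : ℕ → List ℕ → Bool
atLeast a []      = true
atLeast a (b ∷ u) = (a ℕ.<ᵇ suc b) ∧ atLeast a u

sorted : List ℕ → Bool
sorted []      = true
sorted (a ∷ u) = atLeast a u ∧ sorted u

atLeast-++-replicate : ∀ {a n} u k → a ℕ.< n → atLeast a (u ++ replicate k n) ≡ atLeast a u
atLeast-++-replicate []      zero    a<n = ≡.refl
atLeast-++-replicate []      (suc k) a<n rewrite <⇒<ᵇ≡true (ℕ.m<n⇒m<1+n a<n) =
  atLeast-++-replicate [] k a<n
atLeast-++-replicate (b ∷ u) k       a<n = ≡.cong (_ ∧_) (atLeast-++-replicate u k a<n)

firstBelow : List ℕ → List (List ℕ) → Bool
firstBelow p []      = true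
firstBelow p (u ∷ _) = columnStrict p u

-- Only neighbouring rows are compared, as in the recursion of `sumBelow`. The comparison of distant
-- rows in `Semistandard` is recovered through `columnStrict-trans`.
chain : List (List ℕ) → Bool
chain []       = true
chain (u ∷ us) = sorted u ∧ (firstBelow u us ∧ chain us)

word : ∀ {l N} → (Fin l → Fin N) → List ℕ
word u = tabulate (toℕ ∘ u)

words : ∀ {M N} {lam : Shape M} → (∀ i → Fin (lam i) → Fin N) → List (List ℕ)
words T = tabulate (λ i → word (T i))

atLeast⁺ : ∀ {l a} (f : Fin l → ℕ) → (∀ j → a ℕ.≤ f j) → atLeast a (tabulate f) ≡ true
atLeast⁺ {zero}  f a≤ = ≡.refl
atLeast⁺ {suc l} f a≤ = ∧-join (<⇒<ᵇ≡true (s≤s (a≤ zero))) (atLeast⁺ (f ∘ suc) (a≤ ∘ suc))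

atLeast⁻ : ∀ {l a} (f : Fin l → ℕ) → atLeast a (tabulate f) ≡ true → ∀ j → a ℕ.≤ f j
atLeast⁻ f eq zero    = ℕ.≤-pred (<ᵇ≡true⇒< (proj₁ (∧-split eq)))
atLeast⁻ f eq (suc j) = atLeast⁻ (f ∘ suc) (proj₂ (∧-split eq)) j

sorted⁺ : ∀ {l} (f : Fin l → ℕ) → (∀ j j′ → j Fin.< j′ → f j ℕ.≤ f j′) →
  sorted (tabulate f) ≡ true
sorted⁺ {zero}  f mono = ≡.refl
sorted⁺ {suc l} f mono = ∧-join
  (atLeast⁺ (f ∘ suc) λ j → mono zero (suc j) (s≤s z≤n))
  (sorted⁺ (f ∘ suc) λ j j′ j<j′ → mono (suc j) (suc j′) (s≤s j<j′))

sorted⁻ : ∀ {l} (f : Fin l → ℕ) → sorted (tabulate f) ≡ true →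
  ∀ j j′ → j Fin.< j′ → f j ℕ.≤ f j′
sorted⁻ f eq zero    (suc j′) _          = atLeast⁻ (f ∘ suc) (proj₁ (∧-split eq)) j′
sorted⁻ f eq (suc j) (suc j′) (s≤s j<j′) = sorted⁻ (f ∘ suc) (proj₂ (∧-split eq)) j j′ j<j′

columnStrict⁺ : ∀ {k l} (f : Fin k → ℕ) (g : Fin l → ℕ) → l ℕ.≤ k →
  (∀ j j′ → toℕ j ≡ toℕ j′ → f j ℕ.< g j′) → columnStrict (tabulate f) (tabulate g) ≡ true
columnStrict⁺ {k}     {zero}  f g _         f<g = ≡.refl
columnStrict⁺ {suc k} {suc l} f g (s≤s l≤k) f<g = ∧-join
  (<⇒<ᵇ≡true (f<g zero zero ≡.refl))
  (columnStrict⁺ (f ∘ suc) (g ∘ suc) l≤k λ j j′ eq → f<g (suc j) (suc j′) (≡.cong suc eq))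

columnStrict⁻ : ∀ {k l} (f : Fin k → ℕ) (g : Fin l → ℕ) →
  columnStrict (tabulate f) (tabulate g) ≡ true →
  ∀ j j′ → toℕ j ≡ toℕ j′ → f j ℕ.< g j′
columnStrict⁻ {suc k} {suc l} f g eq zero    zero     _ = <ᵇ≡true⇒< (proj₁ (∧-split eq))
columnStrict⁻ {suc k} {suc l} f g eq (suc j) (suc j′) p =
  columnStrict⁻ (f ∘ suc) (g ∘ suc) (proj₂ (∧-split eq)) j j′ (ℕ.suc-injective p)

-- Every entry of `v` has an entry of `u` above it, because `columnStrict` does not let the lower
-- row be longer.
columnStrict-trans : ∀ p u v →
  columnStrict p u ≡ true → columnStrict u v ≡ true → columnStrict p v ≡ true
columnStrict-trans p       u       []      _ _ = ≡.refl
columnStrict-trans (a ∷ p) (b ∷ u) (c ∷ v) p<u u<v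
  with a<b , p<u′ ← ∧-split {a ℕ.<ᵇ b} p<u | b<c , u<v′ ← ∧-split {b ℕ.<ᵇ c} u<v = ∧-join
  (<⇒<ᵇ≡true {a} {c} (ℕ.<-trans {j = b} (<ᵇ≡true⇒< a<b) (<ᵇ≡true⇒< b<c)))
  (columnStrict-trans p u v p<u′ u<v′)

-- `Semistandard` with the number of rows and the number of letters decoupled.
SemistandardRows : ∀ {M N} {lam : Shape M} → (∀ i → Fin (lam i) → Fin N) → Set
SemistandardRows {M} {N} {lam} T =
    (∀ (i : Fin M) (j j′ : Fin (lam i)) → j Fin.< j′ → T i j Fin.≤ T i j′)
  × (∀ (i i′ : Fin M) → i Fin.< i′ → ∀ (j : Fin (lam i)) (j′ : Fin (lam i′)) →
       toℕ j ≡ toℕ j′ → T i j Fin.< T i′ j′)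

firstBelow⁺ : ∀ {M N p} {lam : Shape M} (T : ∀ i → Fin (lam i) → Fin N) →
  (∀ i → columnStrict p (word (T i)) ≡ true) → firstBelow p (words T) ≡ true
firstBelow⁺ {zero}  T p<T = ≡.refl
firstBelow⁺ {suc M} T p<T = p<T zero

-- `columnStrict` also compares the lengths of the rows, which `SemistandardRows` does not;
-- `IsPartition` supplies this part.
chain⁺ : ∀ {M N} {lam : Shape M} (T : ∀ i → Fin (lam i) → Fin N) → IsPartition lam →
  SemistandardRows T → chain (words T) ≡ true
chain⁺ {zero}  T part ss               = ≡.refl
chain⁺ {suc M} T part (rows , columns) = ∧-join (sorted⁺ _ (rows zero)) (∧-join
  (firstBelow⁺ (λ i → T (suc i)) λ i →
    columnStrict⁺ _ _ (part {zero} {suc i} z≤n) (columns zero (suc i) (s≤s z≤n)))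
  (chain⁺ (λ i → T (suc i)) (λ i≤j → part (s≤s i≤j))
    ((λ i → rows (suc i)) , λ i i′ i<i′ → columns (suc i) (suc i′) (s≤s i<i′))))

firstBelow⁻ : ∀ {M N p} {lam : Shape M} (T : ∀ i → Fin (lam i) → Fin N) →
  firstBelow p (words T) ≡ true → chain (words T) ≡ true →
  ∀ i → columnStrict p (word (T i)) ≡ true
firstBelow⁻ T p<u eq zero    = p<u
firstBelow⁻ {p = p} T p<u eq (suc i)
  with u<us , eq′ ← ∧-split (proj₂ (∧-split {sorted (word (T zero))} eq)) =
  columnStrict-trans p (word (T zero)) (word (T (suc i))) p<u
    (firstBelow⁻ (λ i → T (suc i)) u<us eq′ i)

chain⁻ : ∀ {M N} {lam : Shape M} (T : ∀ i → Fin (lam i) → Fin N) →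
  chain (words T) ≡ true → SemistandardRows T
chain⁻ {zero}  T eq = (λ ()) , (λ ())
chain⁻ {suc M} T eq
  with ≤u , eq′ ← ∧-split {sorted (word (T zero))} eq
  with u<us , eq″ ← ∧-split eq′
  with rows , columns ← chain⁻ (λ i → T (suc i)) eq″ =
    (λ { zero → sorted⁻ _ ≤u ; (suc i) → rows i })
  , λ { zero    (suc i′) _          →
          columnStrict⁻ _ _ (firstBelow⁻ (λ i → T (suc i)) u<us eq″ i′)
      ; (suc i) (suc i′) (s≤s i<i′) → columns i i′ i<i′ }

private
  does-≡true : ∀ {P : Set} {b} (d : Dec P) → (P → b ≡ true) → (b ≡ true → P) → does d ≡ b
  does-≡true             (yes p) P⇒b b⇒P = ≡.sym (P⇒b p)
  does-≡true {b = false} (no ¬p) P⇒b b⇒P = ≡.refl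
  does-≡true {b = true}  (no ¬p) P⇒b b⇒P = contradiction (b⇒P ≡.refl) ¬p

does-semistandard? : ∀ {N} {lam : Shape N} (T : Filling lam) → IsPartition lam →
  does (semistandard? {lam = lam} T) ≡ chain (words T)
does-semistandard? {lam = lam} T part =
  does-≡true (semistandard? {lam = lam} T) (chain⁺ T part) (chain⁻ T)

-- The sum over tableaux as an iterated sum over rows

module TableauSums {c ℓ} (R : CommutativeRing c ℓ) where
  open CommutativeRing R hiding (zero)
  open IntegerCoefficients R using (solve; _:=_; _:*_)
  open Branching R
  open SetoidReasoning setoid

  sumList : ∀ {A : Set} → List A → (A → Carrier) → Carrier
  sumList xs f = foldr (λ x s → f x + s) 0# xs

  sumList-cong : ∀ {A : Set} (xs : List A) {f g} → (∀ x → f x ≈ g x) → sumList xs f ≈ sumList xs g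
  sumList-cong []       f≈g = refl
  sumList-cong (x ∷ xs) f≈g = +-cong (f≈g x) (sumList-cong xs f≈g)

  sumList-* : ∀ {A : Set} (xs : List A) a f → sumList xs (λ x → a * f x) ≈ a * sumList xs f
  sumList-* []       a f = sym (zeroʳ a)
  sumList-* (x ∷ xs) a f = trans (+-congˡ (sumList-* xs a f)) (sym (distribˡ _ _ _))

  sumList-++ : ∀ {A : Set} (xs ys : List A) f → sumList (xs ++ ys) f ≈ sumList xs f + sumList ys f
  sumList-++ []       ys f = sym (+-identityˡ _)
  sumList-++ (x ∷ xs) ys f = trans (+-congˡ (sumList-++ xs ys f)) (sym (+-assoc _ _ _))

  sumList-map : ∀ {A B : Set} (h : A → B) xs f → sumList (map h xs) f ≡ sumList xs (f ∘ h)
  sumList-map h []       f = ≡.refl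
  sumList-map h (x ∷ xs) f = ≡.cong (λ s → f (h x) + s) (sumList-map h xs f)

  sumList-cartesianProductWith : ∀ {A B C : Set} (h : A → B → C) xs ys f →
    sumList (cartesianProductWith h xs ys) f ≈ sumList xs (λ x → sumList ys (λ y → f (h x y)))
  sumList-cartesianProductWith h []       ys f = refl
  sumList-cartesianProductWith h (x ∷ xs) ys f = trans
    (sumList-++ (map (h x) ys) _ f)
    (+-cong (reflexive (sumList-map (h x) ys f)) (sumList-cartesianProductWith h xs ys f))

  sumList-filter : ∀ {A : Set} {P : A → Set} (P? : ∀ x → Dec (P x)) xs f →
    sumList (filter P? xs) f ≈ sumList xs (λ x → ⟦ does (P? x) ⟧ * f x)
  sumList-filter P? []       f = refl
  sumList-filter P? (x ∷ xs) f with does (P? x)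
  ... | true  = +-cong (sym (*-identityˡ _)) (sumList-filter P? xs f)
  ... | false = trans (sumList-filter P? xs f)
    (trans (sym (+-identityˡ _)) (+-congʳ (sym (zeroˡ _))))

  sumList-tabulate : ∀ {A : Set} n (h : Fin n → A) f g → (∀ i → f (h i) ≈ g (toℕ i)) →
    sumList (tabulate h) f ≈ sum< n g
  sumList-tabulate zero    h f g f≈g = refl
  sumList-tabulate (suc n) h f g f≈g = trans
    (+-cong (f≈g zero) (sumList-tabulate n (h ∘ suc) f (g ∘ suc) (f≈g ∘ suc)))
    (sym (sum<-head n g))

  sumWords : ℕ → ℕ → (List ℕ → Carrier) → Carrier
  sumWords n zero    f = f []
  sumWords n (suc l) f = sum< n λ a → sumWords n l (f ∘ (a ∷_))

  sumWords-cong : ∀ n l {f g} → (∀ u → f u ≈ g u) → sumWords n l f ≈ sumWords n l g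
  sumWords-cong n zero    f≈g = f≈g []
  sumWords-cong n (suc l) f≈g = sum<-cong n λ a _ → sumWords-cong n l (f≈g ∘ (a ∷_))

  sumWords-0 : ∀ n l → sumWords n l (λ _ → 0#) ≈ 0#
  sumWords-0 n zero    = refl
  sumWords-0 n (suc l) = trans (sum<-cong n λ a _ → sumWords-0 n l) (sum<-0 n)

  sum<-swap : ∀ m n (f : ℕ → ℕ → Carrier) →
    sum< m (λ a → sum< n (f a)) ≈ sum< n (λ b → sum< m (λ a → f a b))
  sum<-swap zero    n f = sym (sum<-0 n)
  sum<-swap (suc m) n f = trans (+-congʳ (sum<-swap m n f)) (sym (sum<-+ n _ _))

  private
    if-false : ∀ {b x} → b ≡ false → ⟦ b ⟧ * x ≈ 0#
    if-false ≡.refl = zeroˡ _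

    ∧-idem : ∀ a b → (true ∧ a) ∧ (a ∧ b) ≡ a ∧ b
    ∧-idem true  b = ≡.refl
    ∧-idem false b = ≡.refl

    -- After the largest letter `n` a weakly increasing word can only repeat it.
    sumWords-largest : ∀ n l (f : List ℕ → Carrier) →
      sumWords (suc n) l (λ u → ⟦ sorted (n ∷ u) ⟧ * f u) ≈ f (replicate l n)
    sumWords-largest n zero    f = *-identityˡ _
    sumWords-largest n (suc l) f = begin
      sum< n (λ a → sumWords (suc n) l (λ u → ⟦ sorted (n ∷ a ∷ u) ⟧ * f (a ∷ u)))
        + sumWords (suc n) l (λ u → ⟦ sorted (n ∷ n ∷ u) ⟧ * f (n ∷ u))
        ≈⟨ +-cong
             (trans (sum<-cong n λ a a<n → trans
               (sumWords-cong (suc n) l λ u → if-false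
                 (≡.cong (λ b → (b ∧ atLeast n u) ∧ (atLeast a u ∧ sorted u)) (≤⇒<ᵇ≡false a<n)))
               (sumWords-0 (suc n) l)) (sum<-0 n))
             (trans
               (sumWords-cong (suc n) l λ u → *-congʳ (reflexive (≡.cong ⟦_⟧ (≡.trans
                 (≡.cong (λ b → (b ∧ atLeast n u) ∧ (atLeast n u ∧ sorted u))
                   (<⇒<ᵇ≡true (ℕ.n<1+n n)))
                 (∧-idem (atLeast n u) (sorted u))))))
               (sumWords-largest n l (f ∘ (n ∷_)))) ⟩
      0# + f (n ∷ replicate l n)
        ≈⟨ +-identityˡ _ ⟩
      f (n ∷ replicate l n) ∎

    -- By the first letter. If it is some a < n, induction groups the tail by its number m of
    -- letters below `n`, and the whole word has m + 1 of them. If it is `n`, the word is constant,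
    -- which is the term m = 0.
    sumWords-step : ∀ n l (f : List ℕ → Carrier) →
      sumWords (suc n) l (λ u → ⟦ sorted u ⟧ * f u) ≈
        sum< (suc l) (λ m → sumWords n m (λ u → ⟦ sorted u ⟧ * f (u ++ replicate (l ∸ m) n)))
    sumWords-step n zero    f = sym (+-identityˡ _)
    sumWords-step n (suc l) f = begin
      sum< n (λ a → sumWords (suc n) l (λ u → ⟦ sorted (a ∷ u) ⟧ * f (a ∷ u)))
        + sumWords (suc n) l (λ u → ⟦ sorted (n ∷ u) ⟧ * f (n ∷ u))
        ≈⟨ +-cong
             (trans (sum<-cong n smaller) (sum<-swap n (suc l) _))
             (trans (sumWords-largest n l (f ∘ (n ∷_))) (sym (*-identityˡ _))) ⟩
      sum< (suc l) (λ m → sumWords n (suc m) (λ u → ⟦ sorted u ⟧ * f (u ++ replicate (l ∸ m) n)))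
        + 1# * f (replicate (suc l) n)
        ≈⟨ trans (+-comm _ _) (sym (sum<-head (suc l) _)) ⟩
      sum< (suc (suc l))
        (λ m → sumWords n m (λ u → ⟦ sorted u ⟧ * f (u ++ replicate (suc l ∸ m) n))) ∎
      where
      smaller : ∀ a → a ℕ.< n →
        sumWords (suc n) l (λ u → ⟦ sorted (a ∷ u) ⟧ * f (a ∷ u)) ≈
          sum< (suc l) (λ m → sumWords n m (λ u →
            ⟦ sorted (a ∷ u) ⟧ * f (a ∷ u ++ replicate (l ∸ m) n)))
      smaller a a<n = trans
        (sumWords-cong (suc n) l λ u → trans
          (*-congʳ (trans (⟦⟧-∧ (atLeast a u) (sorted u)) (*-comm _ _))) (*-assoc _ _ _))
        (trans (sumWords-step n l (λ u → ⟦ atLeast a u ⟧ * f (a ∷ u)))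
          (sum<-cong (suc l) λ m _ → sumWords-cong n m λ u → trans
            (*-congˡ (*-congʳ (reflexive (≡.cong ⟦_⟧ (atLeast-++-replicate u (l ∸ m) a<n)))))
            (trans (sym (*-assoc _ _ _))
              (*-congʳ (trans (*-comm _ _) (sym (⟦⟧-∧ (atLeast a u) (sorted u))))))))

  sumWords-sorted : ∀ n l (f : List ℕ → Carrier) → sumWords n l (λ u → ⟦ sorted u ⟧ * f u) ≈ sumSorted n l f
  sumWords-sorted zero    zero    f = *-identityˡ _
  sumWords-sorted zero    (suc l) f = refl
  sumWords-sorted (suc n) l       f = trans (sumWords-step n l f)
    (sum<-cong (suc l) λ m _ → sumWords-sorted n m _)

  sumList-rows : ∀ {N} l (f : List ℕ → Carrier) →
    sumList (choices {l} λ _ → allFin N) (λ u → f (word u)) ≈ sumWords N l f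
  sumList-rows     zero    f = +-identityʳ _
  sumList-rows {N} (suc l) f = trans
    (sumList-cartesianProductWith _ (allFin N) (choices {l} λ _ → allFin N) _)
    (sumList-tabulate N id _ (λ a → sumWords N l (f ∘ (a ∷_))) λ a →
      sumList-rows l (f ∘ (toℕ a ∷_)))

  module _ (x : ℕ → Carrier) where

    weights : List (List ℕ) → Carrier
    weights []       = 1#
    weights (u ∷ us) = weight x u * weights us

    private
      fillingRows : ∀ {M} N (lam : Shape M) → List (∀ i → Fin (lam i) → Fin N)
      fillingRows N lam = choices λ i → choices {lam i} λ _ → allFin N

    sumBelow-fillings : ∀ {M} N (lam : Shape M) p →
      sumList (fillingRows N lam)
        (λ T → ⟦ firstBelow p (words T) ∧ chain (words T) ⟧ * weights (words T))
      ≈ sumBelow x N p (Vec.tabulate lam)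
    -- The test `φ` serves two purposes: `columnStrict p` for a row below `p`, and the constant
    -- `true` for the first row of the tableau.
    sumRow : ∀ {M} N (lam : Shape (suc M)) (φ : List ℕ → Bool) →
      sumList (fillingRows N lam)
        (λ T → ⟦ φ (word (T zero)) ∧ chain (words T) ⟧ * weights (words T))
      ≈ sumSorted N (lam zero) (λ u →
          ⟦ φ u ⟧ * weight x u * sumBelow x N u (Vec.tabulate (lam ∘ suc)))

    sumBelow-fillings {zero}  N lam p = trans (+-identityʳ _) (*-identityˡ _)
    sumBelow-fillings {suc M} N lam p = sumRow N lam (columnStrict p)

    sumRow {M} N lam φ = begin
      sumList (fillingRows N lam)
        (λ T → ⟦ φ (word (T zero)) ∧ chain (words T) ⟧ * weights (words T))
        ≈⟨ sumList-cartesianProductWith _ (choices {lam zero} λ _ → allFin N)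
             (fillingRows N (lam ∘ suc)) _ ⟩
      sumList (choices {lam zero} λ _ → allFin N) (λ u →
        sumList (fillingRows N (lam ∘ suc)) (λ T →
          ⟦ φ (word u) ∧ (sorted (word u) ∧ (firstBelow (word u) (words T) ∧ chain (words T))) ⟧
            * (weight x (word u) * weights (words T))))
        ≈⟨ sumList-cong (choices {lam zero} λ _ → allFin N) (λ u → trans
             (sumList-cong (fillingRows N (lam ∘ suc)) λ T → trans
               (*-congʳ (trans (⟦⟧-∧ (φ (word u)) _) (*-congˡ (⟦⟧-∧ (sorted (word u)) _))))
               (solve 5 (λ a b c w W → (a :* (b :* c)) :* (w :* W)
                   := (b :* (a :* w)) :* (c :* W)) refl
                 ⟦ φ (word u) ⟧ ⟦ sorted (word u) ⟧ _ (weight x (word u)) (weights (words T))))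
             (trans (sumList-* (fillingRows N (lam ∘ suc))
                 (⟦ sorted (word u) ⟧ * (⟦ φ (word u) ⟧ * weight x (word u))) _)
               (trans (*-congˡ (sumBelow-fillings N (lam ∘ suc) (word u))) (*-assoc _ _ _)))) ⟩
      sumList (choices {lam zero} λ _ → allFin N) (λ u → ⟦ sorted (word u) ⟧ *
        (⟦ φ (word u) ⟧ * weight x (word u)
          * sumBelow x N (word u) (Vec.tabulate (lam ∘ suc))))
        ≈⟨ sumList-rows (lam zero) _ ⟩
      sumWords N (lam zero) (λ u → ⟦ sorted u ⟧ *
        (⟦ φ u ⟧ * weight x u * sumBelow x N u (Vec.tabulate (lam ∘ suc))))
        ≈⟨ sumWords-sorted N (lam zero) _ ⟩
      sumSorted N (lam zero) (λ u →
        ⟦ φ u ⟧ * weight x u * sumBelow x N u (Vec.tabulate (lam ∘ suc))) ∎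

    schur-fillings : ∀ {M} N (lam : Shape M) →
      sumList (fillingRows N lam) (λ T → ⟦ chain (words T) ⟧ * weights (words T))
      ≈ schur x N (Vec.tabulate lam)
    schur-fillings {zero}  N lam = trans (+-identityʳ _) (*-identityˡ _)
    schur-fillings {suc M} N lam = trans (sumRow N lam (λ _ → true))
      (sumSorted-cong N (lam zero) λ u _ _ → *-congʳ (*-identityˡ _))

    schur-ssyt : ∀ {N} (lam : Shape N) → IsPartition lam →
      sumList (ssyt lam) (λ T → weights (words T)) ≈ schur x N (Vec.tabulate lam)
    schur-ssyt {N} lam part = begin
      sumList (ssyt lam) (λ T → weights (words T))
        ≈⟨ sumList-filter semistandard? (fillings lam) _ ⟩
      sumList (fillings lam) (λ T → ⟦ does (semistandard? {lam = lam} T) ⟧ * weights (words T))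
        ≈⟨ sumList-cong (fillings lam) (λ T →
             *-congʳ (reflexive (≡.cong ⟦_⟧ (does-semistandard? T part)))) ⟩
      sumList (fillings lam) (λ T → ⟦ chain (words T) ⟧ * weights (words T))
        ≈⟨ schur-fillings N lam ⟩
      schur x N (Vec.tabulate lam) ∎

-- Signs of permutations and the 2 × 2 minor

countBelow : ℕ → List ℕ → ℕ
countBelow x ys = length (filter (ℕ._<? x) ys)

countBelow-↭ : ∀ x {ys zs} → ys ↭ zs → countBelow x ys ≡ countBelow x zs
countBelow-↭ x p = ↭.↭-length (↭.filter-↭ (ℕ._<? x) p)

countBelow-< : ∀ {x y} ys → y ℕ.< x → countBelow x (y ∷ ys) ≡ suc (countBelow x ys)
countBelow-< {x} ys y<x = ≡.cong length (List.filter-accept (ℕ._<? x) y<x)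

countBelow-≮ : ∀ {x y} ys → ¬ y ℕ.< x → countBelow x (y ∷ ys) ≡ countBelow x ys
countBelow-≮ {x} ys y≮x = ≡.cong length (List.filter-reject (ℕ._<? x) y≮x)

inversions-swap : ∀ {x y} zs → x ℕ.< y →
  inversions (y ∷ x ∷ zs) ≡ suc (inversions (x ∷ y ∷ zs))
inversions-swap {x} {y} zs x<y = begin
  countBelow y (x ∷ zs) ℕ.+ (countBelow x zs ℕ.+ inversions zs)
    ≡⟨ ≡.cong (ℕ._+ _) (countBelow-< zs x<y) ⟩
  suc (countBelow y zs ℕ.+ (countBelow x zs ℕ.+ inversions zs))
    ≡⟨ ≡.cong suc (ℕ.+-assoc (countBelow y zs) _ _) ⟨
  suc (countBelow y zs ℕ.+ countBelow x zs ℕ.+ inversions zs)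
    ≡⟨ ≡.cong (λ i → suc (i ℕ.+ inversions zs)) (ℕ.+-comm (countBelow y zs) _) ⟩
  suc (countBelow x zs ℕ.+ countBelow y zs ℕ.+ inversions zs)
    ≡⟨ ≡.cong suc (ℕ.+-assoc (countBelow x zs) _ _) ⟩
  suc (countBelow x zs ℕ.+ (countBelow y zs ℕ.+ inversions zs))
    ≡⟨ ≡.cong (λ i → suc (i ℕ.+ _)) (countBelow-≮ zs (ℕ.<⇒≯ x<y)) ⟨
  suc (countBelow x (y ∷ zs) ℕ.+ (countBelow y zs ℕ.+ inversions zs)) ∎
  where open ≡.≡-Reasoning

module Permutations {c ℓ} (R : CommutativeRing c ℓ) where
  open CommutativeRing R hiding (zero)
  open Exp semiring using (_^_; ^-homo-*; ^-congʳ)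
  open IntegerCoefficients R using (solve; _:=_; _:*_; _:-_; :-_)
  open Determinants R
  open SetoidReasoning setoid

  sign : ℕ → Carrier
  sign n = (- 1#) ^ n

  sign-+ : ∀ m n → sign (m ℕ.+ n) ≈ sign m * sign n
  sign-+ = ^-homo-* (- 1#)

  sign-suc : ∀ n → sign (suc n) ≈ - sign n
  sign-suc n = trans
    (solve 2 (λ u s → (:- u) :* s := :- (u :* s)) refl 1# (sign n)) (-‿cong (*-identityˡ _))

  sign-square : ∀ n → sign n * sign n ≈ 1#
  sign-square zero    = *-identityˡ 1#
  sign-square (suc n) = trans (*-cong (sign-suc n) (sign-suc n)) (trans
    (solve 1 (λ s → (:- s) :* (:- s) := s :* s) refl (sign n)) (sign-square n))

  SwapNegates : ∀ {A : Set} → (List A → Carrier) → Set _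
  SwapNegates F = ∀ xs a b ys → F (xs ++ a ∷ b ∷ ys) ≈ - F (xs ++ b ∷ a ∷ ys)

  alternating⇒swapNegates : ∀ {A : Set} {rs g} (h : A → Column) → Alternating rs g →
    SwapNegates (g ∘ map h)
  alternating⇒swapNegates {g = g} h alt xs a b ys = begin
    g (map h (xs ++ a ∷ b ∷ ys))          ≡⟨ ≡.cong g (map-++ h xs (a ∷ b ∷ ys)) ⟩
    g (map h xs ++ h a ∷ h b ∷ map h ys)  ≈⟨ transposition alt (map h xs) (h a) (h b) (map h ys) ⟩
    - g (map h xs ++ h b ∷ h a ∷ map h ys)
      ≡⟨ ≡.cong (λ cs → - g cs) (map-++ h xs (b ∷ a ∷ ys)) ⟨
    - g (map h (xs ++ b ∷ a ∷ ys))        ∎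

  module _ {A : Set} (key : A → ℕ) (key-injective : ∀ {a b} → key a ≡ key b → a ≡ b) where

    private
      inv : List A → ℕ
      inv xs = inversions (map key xs)

      prep′ : ∀ {F : List A → Carrier} a {xs ys} → xs ↭ ys →
        sign (inv xs) * F (a ∷ xs) ≈ sign (inv ys) * F (a ∷ ys) →
        sign (inv (a ∷ xs)) * F (a ∷ xs) ≈ sign (inv (a ∷ ys)) * F (a ∷ ys)
      prep′ {F} a {xs} {ys} p ih = begin
        sign (n ℕ.+ inv xs) * F (a ∷ xs)
          ≈⟨ trans (*-congʳ (sign-+ n _)) (*-assoc _ _ _) ⟩
        sign n * (sign (inv xs) * F (a ∷ xs))
          ≈⟨ *-cong (^-congʳ _ (countBelow-↭ (key a) (↭.map⁺ key p))) ih ⟩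
        sign n′ * (sign (inv ys) * F (a ∷ ys))
          ≈⟨ trans (*-congʳ (sign-+ n′ _)) (*-assoc _ _ _) ⟨
        sign (n′ ℕ.+ inv ys) * F (a ∷ ys) ∎
        where
        n  = countBelow (key a) (map key xs)
        n′ = countBelow (key a) (map key ys)

      swap′ : ∀ {F : List A → Carrier} → SwapNegates F → ∀ a b zs →
        sign (inv (a ∷ b ∷ zs)) * F (a ∷ b ∷ zs) ≈ sign (inv (b ∷ a ∷ zs)) * F (b ∷ a ∷ zs)
      swap′ {F} neg a b zs with ℕ.<-cmp (key a) (key b)
      ... | tri≈ _ eq _ with ≡.refl ← key-injective eq = refl
      ... | tri< a<b _ _ = sym (begin
        sign (inv (b ∷ a ∷ zs)) * F (b ∷ a ∷ zs)
          ≈⟨ *-cong (trans (^-congʳ _ (inversions-swap (map key zs) a<b)) (sign-suc (inv (a ∷ b ∷ zs))))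
               (neg [] b a zs) ⟩
        (- sign (inv (a ∷ b ∷ zs))) * (- F (a ∷ b ∷ zs))
          ≈⟨ solve 2 (λ s f → (:- s) :* (:- f) := s :* f) refl
               (sign (inv (a ∷ b ∷ zs))) (F (a ∷ b ∷ zs)) ⟩
        sign (inv (a ∷ b ∷ zs)) * F (a ∷ b ∷ zs) ∎)
      ... | tri> _ _ b<a = begin
        sign (inv (a ∷ b ∷ zs)) * F (a ∷ b ∷ zs)
          ≈⟨ *-cong (trans (^-congʳ _ (inversions-swap (map key zs) b<a)) (sign-suc (inv (b ∷ a ∷ zs))))
               (neg [] a b zs) ⟩
        (- sign (inv (b ∷ a ∷ zs))) * (- F (b ∷ a ∷ zs))
          ≈⟨ solve 2 (λ s f → (:- s) :* (:- f) := s :* f) refl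
               (sign (inv (b ∷ a ∷ zs))) (F (b ∷ a ∷ zs)) ⟩
        sign (inv (b ∷ a ∷ zs)) * F (b ∷ a ∷ zs) ∎

    -- Exchanging neighbours with distinct keys changes the number of inversions by one and negates
    -- `F`, so the product is unchanged. Equal keys mean equal elements by injectivity, and the
    -- exchange is then trivial. It is applied to columns with `toℕ` and to residues with `id`.
    sign-↭ : ∀ {F : List A → Carrier} → SwapNegates F → ∀ {xs ys} → xs ↭ ys →
      sign (inv xs) * F xs ≈ sign (inv ys) * F ys
    sign-↭ neg ↭.refl          = refl
    sign-↭ {F} neg (↭.prep a p) = prep′ {F} a p (sign-↭ {F ∘ (a ∷_)} (neg ∘ (a ∷_)) p)
    sign-↭ {F} neg (↭.swap {ys = ys} a b p) = trans
      (prep′ {F} a (↭.prep b p) (prep′ {F ∘ (a ∷_)} b p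
        (sign-↭ {F ∘ (a ∷_) ∘ (b ∷_)} (λ xs → neg (a ∷ b ∷ xs)) p)))
      (swap′ {F} neg a b ys)
    sign-↭ {F} neg (↭.trans p q)   = trans (sign-↭ {F} neg p) (sign-↭ {F} neg q)

-- Expansion along two extra rows, and the factorisation of their minor

module TwoExtraRows {c ℓ} (R : CommutativeRing c ℓ) where
  open CommutativeRing R hiding (zero)
  open Exp semiring using (_^_; ^-homo-*; ^-congʳ)
  open IntegerCoefficients R using (solve; _:=_; con; _:+_; _:*_; _:-_; :-_)
  open Determinants R
  open SetoidReasoning setoid

  expand-vanishes : ∀ {r h} → (∀ cs → h cs ≈ 0#) → ∀ cs → expand r h cs ≈ 0#
  expand-vanishes h≈0 cs = trans (expand-congᵍ h≈0 cs) (expand-0 cs)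

  module _ {rs g} (alt : Alternating rs g) (y₁ y₂ : Carrier) where

    expandTwice : List Column → Carrier
    expandTwice = expand y₁ (expand y₂ g)

    expandTwice-alternating : Alternating (y₁ ∷ y₂ ∷ rs) expandTwice
    expandTwice-alternating = expand-alternating (expand-alternating alt)

    -- A term that leaves `u` or `v` inside `g` vanishes, so the two extra rows must take their
    -- entries from exactly these two columns.
    expandTwice-minor : ∀ {u v} → Agree rs u (λ _ → 0#) → Agree rs v (λ _ → 0#) → ∀ cs →
      expandTwice (u ∷ v ∷ cs) ≈ (u y₁ * v y₂ - v y₁ * u y₂) * g cs
    expandTwice-minor {u} {v} u≈0 v≈0 cs = begin
      u y₁ * (v y₂ * g cs - expand y₂ (g ∘ (v ∷_)) cs)
        - (v y₁ * (u y₂ * g cs - expand y₂ (g ∘ (u ∷_)) cs)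
           - expand y₁ (λ ds → u y₂ * g (v ∷ ds) - (v y₂ * g (u ∷ ds)
               - expand y₂ (λ es → g (u ∷ v ∷ es)) ds)) cs)
        ≈⟨ +-cong (*-congˡ (+-congˡ (-‿cong (expand-vanishes gv cs))))
             (-‿cong (+-cong (*-congˡ (+-congˡ (-‿cong (expand-vanishes gu cs))))
               (-‿cong (expand-vanishes (λ ds → trans
                 (+-cong (*-congˡ (gv ds)) (-‿cong (+-cong (*-congˡ (gu ds))
                   (-‿cong (expand-vanishes (λ es → gu (v ∷ es)) ds)))))
                 (solve 2 (λ a b → a :* con 0ℤ :- (b :* con 0ℤ :- con 0ℤ) := con 0ℤ) refl
                   (u y₂) (v y₂))) cs)))) ⟩
      u y₁ * (v y₂ * g cs - 0#) - (v y₁ * (u y₂ * g cs - 0#) - 0#)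
        ≈⟨ solve 5 (λ a b c d G → a :* (b :* G :- con 0ℤ) :- (c :* (d :* G :- con 0ℤ) :- con 0ℤ)
             := (a :* b :- c :* d) :* G) refl (u y₁) (v y₂) (v y₁) (u y₂) (g cs) ⟩
      (u y₁ * v y₂ - v y₁ * u y₂) * g cs ∎
      where
      gu : ∀ ds → g (u ∷ ds) ≈ 0#
      gu = vanishing-column alt u≈0 []
      gv : ∀ ds → g (v ∷ ds) ≈ 0#
      gv = vanishing-column alt v≈0 []

    -- The order of the subtractions matters: `u′` may be `v` itself, so it is used before `v` is
    -- altered, whereas `v′` must lie in `cs`.
    expandTwice-pairs : ∀ {u u′ v v′ cs} → u′ ∈ v ∷ cs → v′ ∈ cs →
      Agree rs u u′ → Agree rs v v′ →
      expandTwice (u ∷ v ∷ cs) ≈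
        ((u y₁ - u′ y₁) * (v y₂ - v′ y₂) - (v y₁ - v′ y₁) * (u y₂ - u′ y₂)) * g cs
    expandTwice-pairs {u} {u′} {v} {v′} {cs} u′∈ v′∈ u≈u′ v≈v′ = begin
      expandTwice (u ∷ v ∷ cs)
        ≈⟨ subtract-column expandTwice-alternating u′∈ ⟩
      expandTwice ((λ r → u r - u′ r) ∷ v ∷ cs)
        ≈⟨ subtract-column (prefix _ expandTwice-alternating) v′∈ ⟩
      expandTwice ((λ r → u r - u′ r) ∷ (λ r → v r - v′ r) ∷ cs)
        ≈⟨ expandTwice-minor (All.map cancel u≈u′) (All.map cancel v≈v′) cs ⟩
      ((u y₁ - u′ y₁) * (v y₂ - v′ y₂) - (v y₁ - v′ y₁) * (u y₂ - u′ y₂)) * g cs ∎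
      where
      cancel : ∀ {a b} → a ≈ b → a - b ≈ 0#
      cancel a≈b = trans (+-congʳ a≈b) (-‿inverseʳ _)

  -- The inverse is a separate argument, so that exchanging the two arguments negates the exponent.
  intPower : Carrier → Carrier → ℤ → Carrier
  intPower w w̄ (+ n)    = w ^ n
  intPower w w̄ -[1+ n ] = w̄ ^ suc n

  intPower-neg : ∀ w w̄ i → intPower w w̄ (ℤ.- i) ≈ intPower w̄ w i
  intPower-neg w w̄ +0       = refl
  intPower-neg w w̄ +[1+ n ] = refl
  intPower-neg w w̄ -[1+ n ] = refl

  module _ {w w̄ : Carrier} (ww̄ : w * w̄ ≈ 1#) where

    power-inverse : ∀ n → w ^ n * w̄ ^ n ≈ 1#
    power-inverse zero    = *-identityˡ 1#
    power-inverse (suc n) = begin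
      (w * w ^ n) * (w̄ * w̄ ^ n)
        ≈⟨ solve 4 (λ a b c d → (a :* b) :* (c :* d) := (a :* c) :* (b :* d)) refl
             w (w ^ n) w̄ (w̄ ^ n) ⟩
      (w * w̄) * (w ^ n * w̄ ^ n)   ≈⟨ *-cong ww̄ (power-inverse n) ⟩
      1# * 1#                      ≈⟨ *-identityˡ 1# ⟩
      1#                           ∎

    intPower-⊖ : ∀ m n → intPower w w̄ (m ℤ.⊖ n) ≈ w ^ m * w̄ ^ n
    intPower-⊖ zero    zero    = sym (*-identityˡ _)
    intPower-⊖ zero    (suc n) = sym (*-identityˡ _)
    intPower-⊖ (suc m) zero    = sym (*-identityʳ _)
    intPower-⊖ (suc m) (suc n) = begin
      intPower w w̄ (suc m ℤ.⊖ suc n)   ≡⟨ ≡.cong (intPower w w̄) (ℤ.[1+m]⊖[1+n]≡m⊖n m n) ⟩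
      intPower w w̄ (m ℤ.⊖ n)           ≈⟨ trans (intPower-⊖ m n) (sym (*-identityˡ _)) ⟩
      1# * (w ^ m * w̄ ^ n)             ≈⟨ *-congʳ ww̄ ⟨
      (w * w̄) * (w ^ m * w̄ ^ n)
        ≈⟨ solve 4 (λ a b c d → (a :* c) :* (b :* d) := (a :* b) :* (c :* d)) refl
             w (w ^ m) w̄ (w̄ ^ n) ⟩
      (w * w ^ m) * (w̄ * w̄ ^ n)       ∎

    intPower-+ : ∀ i j → intPower w w̄ (i ℤ.+ j) ≈ intPower w w̄ i * intPower w w̄ j
    intPower-+ (+ m)    (+ n)    = ^-homo-* w m n
    intPower-+ (+ m)    -[1+ n ] = intPower-⊖ m (suc n)
    intPower-+ -[1+ m ] (+ n)    = trans (intPower-⊖ n (suc m)) (*-comm _ _)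
    intPower-+ -[1+ m ] -[1+ n ] = trans
      (^-congʳ w̄ (≡.cong suc (≡.sym (ℕ.+-suc m n)))) (^-homo-* w̄ (suc m) (suc n))

  intPower-natNeg : ∀ w w̄ n → intPower w w̄ (ℤ.- (+ n)) ≈ w̄ ^ n
  intPower-natNeg w w̄ n = intPower-neg w w̄ (+ n)

  module _ {w w̄ : Carrier} (ww̄ : w * w̄ ≈ 1#) where

    private
      w̄w = trans (*-comm w̄ w) ww̄

    -- For w = exp(θ/2) this is 2 sinh(iθ/2).
    difference : ℤ → Carrier
    difference i = intPower w w̄ i - intPower w w̄ (ℤ.- i)

    private
      difference₂ : ∀ m n → difference (+ m ℤ.- + n) ≈ w ^ m * w̄ ^ n - w̄ ^ m * w ^ n
      difference₂ m n = +-cong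
        (trans (intPower-+ ww̄ (+ m) (ℤ.- (+ n))) (*-congˡ (intPower-natNeg w w̄ n)))
        (-‿cong (trans (intPower-neg w w̄ (+ m ℤ.- + n))
          (trans (intPower-+ w̄w (+ m) (ℤ.- (+ n))) (*-congˡ (intPower-natNeg w̄ w n)))))

      half : ∀ {w w̄} → w * w̄ ≈ 1# → ∀ a b c d →
        intPower w w̄ (+ a ℤ.+ + b ℤ.- + c ℤ.- + d) ≈ w ^ a * w ^ b * w̄ ^ c * w̄ ^ d
      half {w} {w̄} ww̄ a b c d = trans (intPower-+ ww̄ (+ a ℤ.+ + b ℤ.- + c) (ℤ.- (+ d))) (*-cong
        (trans (intPower-+ ww̄ (+ a ℤ.+ + b) (ℤ.- (+ c)))
          (*-cong (intPower-+ ww̄ (+ a) (+ b)) (intPower-natNeg w w̄ c)))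
        (intPower-natNeg w w̄ d))

      difference₄ : ∀ a b c d → difference (+ a ℤ.+ + b ℤ.- + c ℤ.- + d) ≈
        w ^ a * w ^ b * w̄ ^ c * w̄ ^ d - w̄ ^ a * w̄ ^ b * w ^ c * w ^ d
      difference₄ a b c d = +-cong (half ww̄ a b c d)
        (-‿cong (trans (intPower-neg w w̄ (+ a ℤ.+ + b ℤ.- + c ℤ.- + d)) (half w̄w a b c d)))

      -- Each of the eight terms of the product of three differences contains two factors of the
      -- kind p p̄, and cancelling them leaves the eight terms of the minor. The solver cannot use p
      -- p̄ = 1, so it first isolates these factors; they are replaced by `1#`, and a second call
      -- finishes.
      polynomialIdentity : ∀ p q r s p̄ q̄ r̄ s̄ →
        p * p̄ ≈ 1# → q * q̄ ≈ 1# → r * r̄ ≈ 1# → s * s̄ ≈ 1# →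
        (p̄ * p̄ - q̄ * q̄) * (r * r - s * s) - (r̄ * r̄ - s̄ * s̄) * (p * p - q * q)
        ≈ (p * q̄ - p̄ * q) * (r * s̄ - r̄ * s) * (p * q * r̄ * s̄ - p̄ * q̄ * r * s)
      polynomialIdentity p q r s p̄ q̄ r̄ s̄ pp qq rr ss = sym (begin
        (p * q̄ - p̄ * q) * (r * s̄ - r̄ * s) * (p * q * r̄ * s̄ - p̄ * q̄ * r * s)
          ≈⟨ solve 8 (λ p q r s P Q R S →
               (p :* Q :- P :* q) :* (r :* S :- R :* s) :* (p :* q :* R :* S :- P :* Q :* r :* s)
               := (r :* R) :* (S :* S) :* (p :* p :* (q :* Q) :- q :* q :* (p :* P))
                  :- (s :* S) :* (R :* R) :* (p :* p :* (q :* Q) :- q :* q :* (p :* P))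
                  :- (s :* S) :* (r :* r) :* (Q :* Q :* (p :* P) :- P :* P :* (q :* Q))
                  :+ (r :* R) :* (s :* s) :* (Q :* Q :* (p :* P) :- P :* P :* (q :* Q)))
               refl p q r s p̄ q̄ r̄ s̄ ⟩
        rr̄ * (s̄ * s̄) * (p * p * qq̄ - q * q * pp̄)
          - ss̄ * (r̄ * r̄) * (p * p * qq̄ - q * q * pp̄)
          - ss̄ * (r * r) * (q̄ * q̄ * pp̄ - p̄ * p̄ * qq̄)
          + rr̄ * (s * s) * (q̄ * q̄ * pp̄ - p̄ * p̄ * qq̄)
          ≈⟨ +-cong (+-cong (+-cong
               (*-cong (*-congʳ rr) (+-cong (*-congˡ qq) (-‿cong (*-congˡ pp))))
               (-‿cong (*-cong (*-congʳ ss) (+-cong (*-congˡ qq) (-‿cong (*-congˡ pp))))))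
               (-‿cong (*-cong (*-congʳ ss) (+-cong (*-congˡ pp) (-‿cong (*-congˡ qq))))))
               (*-cong (*-congʳ rr) (+-cong (*-congˡ pp) (-‿cong (*-congˡ qq)))) ⟩
        1# * (s̄ * s̄) * (p * p * 1# - q * q * 1#)
          - 1# * (r̄ * r̄) * (p * p * 1# - q * q * 1#)
          - 1# * (r * r) * (q̄ * q̄ * 1# - p̄ * p̄ * 1#)
          + 1# * (s * s) * (q̄ * q̄ * 1# - p̄ * p̄ * 1#)
          ≈⟨ solve 9 (λ p q r s P Q R S u →
               u :* (S :* S) :* (p :* p :* u :- q :* q :* u)
               :- u :* (R :* R) :* (p :* p :* u :- q :* q :* u)
               :- u :* (r :* r) :* (Q :* Q :* u :- P :* P :* u)
               :+ u :* (s :* s) :* (Q :* Q :* u :- P :* P :* u)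
               := (u :* u) :* ((P :* P :- Q :* Q) :* (r :* r :- s :* s)
                    :- (R :* R :- S :* S) :* (p :* p :- q :* q)))
               refl p q r s p̄ q̄ r̄ s̄ 1# ⟩
        (1# * 1#) *
          ((p̄ * p̄ - q̄ * q̄) * (r * r - s * s) - (r̄ * r̄ - s̄ * s̄) * (p * p - q * q))
          ≈⟨ trans (*-congʳ (*-identityˡ 1#)) (*-identityˡ _) ⟩
        (p̄ * p̄ - q̄ * q̄) * (r * r - s * s) - (r̄ * r̄ - s̄ * s̄) * (p * p - q * q) ∎)
        where
        pp̄ = p * p̄
        qq̄ = q * q̄
        rr̄ = r * r̄
        ss̄ = s * s̄

      square-power : ∀ v n → (v * v) ^ n ≈ v ^ n * v ^ n
      square-power v n = CommutativeExp.^-distrib-* commutativeSemiring v v n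

    -- With z = w² = exp θ, the left side is the minor of the columns A₁ - A₂ and
    -- B₁ - B₂ in the rows z̄ and z.
    minor-identity : ∀ a₁ a₂ b₁ b₂ →
      ((w̄ * w̄) ^ a₁ - (w̄ * w̄) ^ a₂) * ((w * w) ^ b₁ - (w * w) ^ b₂)
        - ((w̄ * w̄) ^ b₁ - (w̄ * w̄) ^ b₂) * ((w * w) ^ a₁ - (w * w) ^ a₂)
      ≈ difference (+ a₁ ℤ.- + a₂) * difference (+ b₁ ℤ.- + b₂)
          * difference (+ a₁ ℤ.+ + a₂ ℤ.- + b₁ ℤ.- + b₂)
    minor-identity a₁ a₂ b₁ b₂ = trans
      (+-cong
        (*-cong (+-cong (square-power w̄ a₁) (-‿cong (square-power w̄ a₂)))
                (+-cong (square-power w b₁) (-‿cong (square-power w b₂))))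
        (-‿cong (*-cong (+-cong (square-power w̄ b₁) (-‿cong (square-power w̄ b₂)))
                (+-cong (square-power w a₁) (-‿cong (square-power w a₂))))))
      (trans
        (polynomialIdentity (w ^ a₁) (w ^ a₂) (w ^ b₁) (w ^ b₂)
          (w̄ ^ a₁) (w̄ ^ a₂) (w̄ ^ b₁) (w̄ ^ b₂)
          (power-inverse ww̄ a₁) (power-inverse ww̄ a₂)
          (power-inverse ww̄ b₁) (power-inverse ww̄ b₂))
        (sym (*-cong (*-cong (difference₂ a₁ a₂) (difference₂ b₁ b₂))
          (difference₄ a₁ a₂ b₁ b₂))))

-- Columns and residue classes

filter-map : ∀ {A B : Set} {P : B → Set} (P? : ∀ y → Dec (P y)) (f : A → B) xs →
  filter P? (map f xs) ≡ map f (filter (P? ∘ f) xs)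
filter-map P? f []       = ≡.refl
filter-map P? f (x ∷ xs) with does (P? (f x))
... | true  = ≡.cong (f x ∷_) (filter-map P? f xs)
... | false = filter-map P? f xs

-- The lengths leave no room in `ys` for repetitions or further elements. For the word of residues
-- this replaces a direct proof that the residues are distinct.
⊆∧length⇒↭ : ∀ {A : Set} {xs ys : List A} → Unique xs → (∀ {z} → z ∈ xs → z ∈ ys) →
  length ys ℕ.≤ length xs → xs ↭ ys
⊆∧length⇒↭ {ys = []}         []          _     _ = ↭-refl
⊆∧length⇒↭ {xs = x ∷ xs} (x∉xs ∷ uniq) xs⊆ys ≤
  with as , bs , ≡.refl ← ∈.∈-∃++ (xs⊆ys (here ≡.refl)) = ↭-trans
    (↭.prep x (⊆∧length⇒↭ uniq rest (ℕ.≤-pred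
      (ℕ.≤-trans (ℕ.≤-reflexive (≡.sym (↭.↭-length (↭.shift x as bs)))) ≤))))
    (↭-sym (↭.shift x as bs))
  where
  rest : ∀ {z} → z ∈ xs → z ∈ as ++ bs
  rest z∈xs with ↭.∈-resp-↭ (↭.shift x as bs) (xs⊆ys (there z∈xs))
  ... | here ≡.refl = contradiction ≡.refl (All.lookup x∉xs z∈xs)
  ... | there z∈    = z∈

sameElements⇒↭ : ∀ {A : Set} {xs ys : List A} → Unique xs → Unique ys →
  (∀ {z} → z ∈ xs → z ∈ ys) → (∀ {z} → z ∈ ys → z ∈ xs) → xs ↭ ys
sameElements⇒↭ u v ⊆ ⊇ = ∼bag⇒↭ (unique∧set⇒bag u v (mk⇔ ⊆ ⊇))

countBelow-downFrom : ∀ a n → countBelow a (downFrom n) ≡ a ℕ.⊓ n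
countBelow-downFrom a zero    = ≡.sym (ℕ.⊓-zeroʳ a)
countBelow-downFrom a (suc n) with n ℕ.<? a
... | yes n<a = ≡.trans (countBelow-< (downFrom n) n<a) (≡.trans
  (≡.cong suc (≡.trans (countBelow-downFrom a n) (ℕ.m≥n⇒m⊓n≡n (ℕ.<⇒≤ n<a))))
  (≡.sym (ℕ.m≥n⇒m⊓n≡n n<a)))
... | no n≮a = ≡.trans (countBelow-≮ (downFrom n) n≮a) (≡.trans (countBelow-downFrom a n)
  (≡.trans (ℕ.m≤n⇒m⊓n≡m (ℕ.≮⇒≥ n≮a)) (≡.sym (ℕ.m≤n⇒m⊓n≡m (ℕ.m≤n⇒m≤1+n (ℕ.≮⇒≥ n≮a))))))

inversions-downFrom : ∀ n → inversions (downFrom n) ≡ n C 2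
inversions-downFrom zero    = ≡.refl
inversions-downFrom (suc n) = ≡.trans
  (≡.cong₂ ℕ._+_ (≡.trans (countBelow-downFrom n n) (≡.trans (ℕ.⊓-idem n) (≡.sym (nC1≡n n))))
    (inversions-downFrom n))
  (nCk+nC[k+1]≡[n+1]C[k+1] n 1)

countBelow-All : ∀ {x} xs → All (x ℕ.<_) xs → countBelow x xs ≡ 0
countBelow-All {x} xs x<xs =
  ≡.cong length (List.filter-none (ℕ._<? x) (All.map (ℕ.<⇒≯) x<xs))

inversions-increasing : ∀ {xs} → AllPairs ℕ._<_ xs → inversions xs ≡ 0
inversions-increasing []               = ≡.refl
inversions-increasing (x<xs ∷ incr) =
  ≡.cong₂ ℕ._+_ (countBelow-All _ x<xs) (inversions-increasing incr)

allFin-increasing : ∀ N → AllPairs Fin._<_ (allFin N)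
allFin-increasing N = AllPairs.tabulate⁺-< id

map-toℕ-allFin : ∀ N → map toℕ (allFin N) ↭ downFrom N
map-toℕ-allFin N = sameElements⇒↭
  (Unique.map⁺ Fin.toℕ-injective (Unique.allFin⁺ N)) (Unique.downFrom⁺ N)
  (λ z∈ → let k , _ , eq = ∈.∈-map⁻ toℕ z∈ in
    ∈.∈-downFrom⁺ (≡.subst (ℕ._< N) (≡.sym eq) (Fin.toℕ<n k)))
  (λ z∈ → let z<N = ∈.∈-downFrom⁻ z∈ in
    ≡.subst (_∈ map toℕ (allFin N)) (Fin.toℕ-fromℕ< z<N)
      (∈.∈-map⁺ toℕ (∈.∈-allFin (fromℕ< z<N))))

remaining : ∀ {N} → Fin N → Fin N → List (Fin N)
remaining {N} A B = filter (λ j → ¬? (j Fin.≟ A) ×-dec ¬? (j Fin.≟ B)) (allFin N)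

module _ {N} {A B : Fin N} where

  private
    S : List (Fin N)
    S = remaining A B

    P? : ∀ j → Dec (¬ j ≡ A × ¬ j ≡ B)
    P? j = ¬? (j Fin.≟ A) ×-dec ¬? (j Fin.≟ B)

  ∈-remaining⁺ : ∀ {j} → j ≢ A → j ≢ B → j ∈ S
  ∈-remaining⁺ {j} j≢A j≢B = ∈.∈-filter⁺ P? (∈.∈-allFin j) (j≢A , j≢B)

  allFin-↭ : A ≢ B → allFin N ↭ A ∷ B ∷ S
  allFin-↭ A≢B = sameElements⇒↭ (Unique.allFin⁺ N)
    ((A≢B ∷ All.tabulate λ z∈ eq → proj₁ (proj₂ (∈.∈-filter⁻ P? {xs = allFin N} z∈)) (≡.sym eq))
      ∷ (All.tabulate λ z∈ eq → proj₂ (proj₂ (∈.∈-filter⁻ P? {xs = allFin N} z∈)) (≡.sym eq))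
      ∷ Unique.filter⁺ P? (Unique.allFin⁺ N))
    (λ {j} _ → place j)
    (λ {j} _ → ∈.∈-allFin j)
    where
    place : ∀ j → j ∈ A ∷ B ∷ S
    place j with j Fin.≟ A | j Fin.≟ B
    ... | yes eq | _      = here eq
    ... | no _   | yes eq = there (here eq)
    ... | no j≢A | no j≢B = there (there (∈-remaining⁺ j≢A j≢B))

  private
    countBelow-column : A ≢ B → ∀ j → countBelow (toℕ j) (map toℕ (A ∷ B ∷ S)) ≡ toℕ j
    countBelow-column A≢B j = ≡.trans
      (countBelow-↭ (toℕ j) (↭-trans (↭.map⁺ toℕ (↭-sym (allFin-↭ A≢B))) (map-toℕ-allFin N)))
      (≡.trans (countBelow-downFrom (toℕ j) N) (ℕ.m≤n⇒m⊓n≡m (ℕ.<⇒≤ (Fin.toℕ<n j))))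

    inversions-A∷B∷ : A ≢ B → inversions (map toℕ (A ∷ B ∷ S)) ≡
      toℕ A ℕ.+ countBelow (toℕ B) (map toℕ S)
    inversions-A∷B∷ A≢B = ≡.cong₂ ℕ._+_
      (≡.trans (≡.sym (countBelow-≮ _ (ℕ.n≮n (toℕ A)))) (countBelow-column A≢B A))
      (≡.trans (≡.cong (countBelow (toℕ B) (map toℕ S) ℕ.+_)
        (inversions-increasing (AllPairs.map⁺ (AllPairs.filter⁺ P? (allFin-increasing N)))))
        (ℕ.+-identityʳ _))

  -- A column j has `toℕ j` columns to its left. All of these follow `A` in the list, but for `B`
  -- one of them is `A`, which now precedes it. In the other order, `inversions->`, none is lost.
  inversions-< : A Fin.< B → suc (inversions (map toℕ (A ∷ B ∷ S))) ≡ toℕ A ℕ.+ toℕ B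
  inversions-< A<B = ≡.trans (≡.cong suc (inversions-A∷B∷ A≢B)) (≡.trans
    (≡.sym (ℕ.+-suc (toℕ A) _))
    (≡.cong (toℕ A ℕ.+_) (≡.trans
      (≡.cong suc (≡.sym (countBelow-≮ _ (ℕ.n≮n (toℕ B)))))
      (≡.trans (≡.sym (countBelow-< _ A<B)) (countBelow-column A≢B B)))))
    where
    A≢B : A ≢ B
    A≢B ≡.refl = ℕ.n≮n _ A<B

  inversions-> : B Fin.< A → inversions (map toℕ (A ∷ B ∷ S)) ≡ toℕ A ℕ.+ toℕ B
  inversions-> B<A = ≡.trans (inversions-A∷B∷ A≢B) (≡.cong (toℕ A ℕ.+_) (≡.trans
    (≡.sym (countBelow-≮ _ (ℕ.n≮n (toℕ B))))
    (≡.trans (≡.sym (countBelow-≮ _ (ℕ.<⇒≯ B<A))) (countBelow-column A≢B B))))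
    where
    A≢B : A ≢ B
    A≢B ≡.refl = ℕ.n≮n _ B<A

-- The sizes of the residue classes

sumOf : (ℕ → ℕ) → List ℕ → ℕ
sumOf c is = ℕ.sum (map c is)

sumOf-+ : ∀ c d is → sumOf (λ i → c i ℕ.+ d i) is ≡ sumOf c is ℕ.+ sumOf d is
sumOf-+ c d []       = ≡.refl
sumOf-+ c d (i ∷ is) = ≡.trans (≡.cong (c i ℕ.+ d i ℕ.+_) (sumOf-+ c d is)) 
  (CommutativeSemigroupProperties.interchange ℕ.+-commutativeSemigroup (c i) _ _ _)

sumOf-0 : ∀ c is → All (λ i → c i ≡ 0) is → sumOf c is ≡ 0
sumOf-0 c []       []        = ≡.refl
sumOf-0 c (i ∷ is) (eq ∷ eqs) = ≡.cong₂ ℕ._+_ eq (sumOf-0 c is eqs)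

private
  indicator : ℕ → ℕ → ℕ
  indicator a i = if does (a ℕ.≟ i) then 1 else 0

  indicator-≢ : ∀ {a i} → a ≢ i → indicator a i ≡ 0
  indicator-≢ {a} {i} a≢i = ≡.cong (if_then 1 else 0) (Dec.dec-false (a ℕ.≟ i) a≢i)

  indicator-≡ : ∀ a → indicator a a ≡ 1
  indicator-≡ a = ≡.cong (if_then 1 else 0) (Dec.dec-true (a ℕ.≟ a) ≡.refl)

  sumOf-indicator : ∀ {a is} → Unique is → a ∈ is → sumOf (indicator a) is ≡ 1
  sumOf-indicator {a} (a∉ ∷ _)   (here ≡.refl) =
    ≡.cong₂ ℕ._+_ (indicator-≡ a) (sumOf-0 (indicator a) _ (All.map indicator-≢ a∉))
  sumOf-indicator {a} (i∉ ∷ uniq) (there a∈)   =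
    ≡.cong₂ ℕ._+_ (indicator-≢ (λ eq → All.lookup i∉ a∈ (≡.sym eq))) (sumOf-indicator uniq a∈)

sumOf-fibres : ∀ {A : Set} (f : A → ℕ) {is} xs → Unique is → (∀ x → f x ∈ is) →
  sumOf (λ i → length (filter (λ x → f x ℕ.≟ i) xs)) is ≡ length xs
sumOf-fibres f {is} []       uniq f∈ = sumOf-0 _ is (All.universal (λ _ → ≡.refl) is)
sumOf-fibres f {is} (x ∷ xs) uniq f∈ = ≡.trans
  (≡.trans (≡.cong ℕ.sum (List.map-cong step is)) (sumOf-+ (indicator (f x)) _ is))
  (≡.cong₂ ℕ._+_ (sumOf-indicator uniq (f∈ x)) (sumOf-fibres f xs uniq f∈))
  where
  step : ∀ i → length (filter (λ x → f x ℕ.≟ i) (x ∷ xs)) ≡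
    indicator (f x) i ℕ.+ length (filter (λ x → f x ℕ.≟ i) xs)
  step i with does (f x ℕ.≟ i)
  ... | true  = ≡.refl
  ... | false = ≡.refl

module _ (c : ℕ → ℕ) where

  large : List ℕ → List ℕ
  large = filter (λ i → 2 ℕ.≤? c i)

  private
    Positive : List ℕ → Set
    Positive = All (λ i → 1 ℕ.≤ c i)

    length≤sumOf : ∀ is → Positive is → length is ℕ.≤ sumOf c is
    length≤sumOf []       []        = z≤n
    length≤sumOf (i ∷ is) (p ∷ ps)  = ℕ.+-mono-≤ p (length≤sumOf is ps)

    large-accept : ∀ {i k} is → c i ≡ 2 ℕ.+ k → large (i ∷ is) ≡ i ∷ large is
    large-accept is eq = List.filter-accept (λ i → 2 ℕ.≤? c i)
      (≡.subst (2 ℕ.≤_) (≡.sym eq) (s≤s (s≤s z≤n)))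

    large-reject : ∀ {i} is → c i ≡ 1 → large (i ∷ is) ≡ large is
    large-reject is eq = List.filter-reject (λ i → 2 ℕ.≤? c i)
      (λ le → contradiction (≡.subst (2 ℕ.≤_) eq le) λ { (s≤s ()) })

    tooLarge : ∀ {k e} is → Positive is → k ℕ.+ sumOf c is ≡ e ℕ.+ length is → ¬ e ℕ.< k
    tooLarge {k} {e} is ps total e<k = ℕ.<⇒≢
      (ℕ.+-mono-<-≤ e<k (length≤sumOf is ps)) (≡.sym total)

    size : ∀ {i e} is → 1 ℕ.≤ c i → sumOf c (i ∷ is) ≡ e ℕ.+ length (i ∷ is) →
      ∃ λ k → c i ≡ suc k × k ℕ.+ sumOf c is ≡ e ℕ.+ length is
    size {i} {e} is p total with c i | p
    ... | suc k | _ =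
      k , ≡.refl , ℕ.suc-injective (≡.trans total (ℕ.+-suc e (length is)))

  large₀ : ∀ is → Positive is → sumOf c is ≡ length is → large is ≡ []
  large₀ []       ps       total = ≡.refl
  large₀ (i ∷ is) (p ∷ ps) total with size {e = 0} is p total
  ... | zero  , eq , total′ = ≡.trans (large-reject is eq) (large₀ is ps total′)
  ... | suc k , _  , total′ = contradiction (s≤s z≤n) (tooLarge {suc k} {0} is ps total′)

  large₁ : ∀ is → Positive is → sumOf c is ≡ 1 ℕ.+ length is →
    ∃ λ i → large is ≡ i ∷ [] × c i ≡ 2
  large₁ (i ∷ is) (p ∷ ps) total with size {e = 1} is p total
  ... | zero , eq , total′ with j , eq′ , two ← large₁ is ps total′ =
    j , ≡.trans (large-reject is eq) eq′ , two
  large₁ (i ∷ is) (p ∷ ps) total | suc zero , eq , total′ = i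
    , ≡.trans (large-accept is eq) (≡.cong (i ∷_) (large₀ is ps (ℕ.suc-injective total′))) , eq
  large₁ (i ∷ is) (p ∷ ps) total | suc (suc k) , _ , total′ =
    contradiction (s≤s (s≤s z≤n)) (tooLarge {suc (suc k)} {1} is ps total′)

  -- The sizes exceed the number of classes by 2 in total, and a class of size k + 1 uses up k of
  -- this excess. It is therefore spent either as 1 + 1 or as 2; `large₁` and `large₀` treat what is
  -- left after the first expense.
  large₂ : ∀ is → Positive is → sumOf c is ≡ 2 ℕ.+ length is →
    (∃ λ i → ∃ λ j → large is ≡ i ∷ j ∷ [] × c i ≡ 2 × c j ≡ 2) ⊎
    (∃ λ i → large is ≡ i ∷ [] × c i ≡ 3)
  large₂ (i ∷ is) (p ∷ ps) total with size {e = 2} is p total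
  ... | zero , eq , total′ with large₂ is ps total′
  ...   | inj₁ (j , k , eq′ , two) = inj₁ (j , k , ≡.trans (large-reject is eq) eq′ , two)
  ...   | inj₂ (j , eq′ , three)   = inj₂ (j , ≡.trans (large-reject is eq) eq′ , three)
  large₂ (i ∷ is) (p ∷ ps) total | suc zero , eq , total′
    with j , eq′ , two ← large₁ is ps (ℕ.suc-injective total′) =
    inj₁ (i , j , ≡.trans (large-accept is eq) (≡.cong (i ∷_) eq′) , eq , two)
  large₂ (i ∷ is) (p ∷ ps) total | suc (suc zero) , eq , total′ = inj₂ (i
    , ≡.trans (large-accept is eq) (≡.cong (i ∷_)
        (large₀ is ps (ℕ.suc-injective (ℕ.suc-injective total′)))) , eq)
  large₂ (i ∷ is) (p ∷ ps) total | suc (suc (suc k)) , _ , total′ =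
    contradiction (s≤s (s≤s (s≤s z≤n))) (tooLarge {suc (suc (suc k))} {2} is ps total′)

private
  two : ∀ {A : Set} (xs : List A) → length xs ≡ 2 → ∃ λ a → ∃ λ b → xs ≡ a ∷ b ∷ []
  two (a ∷ b ∷ []) ≡.refl = a , b , ≡.refl

  three : ∀ {A : Set} (xs : List A) → length xs ≡ 3 →
    ∃ λ a → ∃ λ b → ∃ λ c → xs ≡ a ∷ b ∷ c ∷ []
  three (a ∷ b ∷ c ∷ []) ≡.refl = a , b , c , ≡.refl

  nonempty : ∀ {A : Set} {x : A} {xs} → x ∈ xs → 1 ℕ.≤ length xs
  nonempty {xs = _ ∷ _} _ = s≤s z≤n

-- The selected columns and the remaining residues

module _ (t : ℕ) .{{_ : NonZero t}} (lam : Shape (t ℕ.+ 2)) where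

  private
    N = t ℕ.+ 2
    res = residue t lam
    class = residueClass t lam

    res<t : ∀ j → res j ℕ.< t
    res<t j = ℕ.m%n<n (beta lam j) t

    ∈-class⁻ : ∀ {i j} → j ∈ class i → res j ≡ i
    ∈-class⁻ {i} j∈ = proj₂ (∈.∈-filter⁻ (λ j → res j ℕ.≟ i) {xs = allFin N} j∈)

    ∈-class⁺ : ∀ j → j ∈ class (res j)
    ∈-class⁺ j = ∈.∈-filter⁺ (λ k → res k ℕ.≟ res j) (∈.∈-allFin j) ≡.refl

    class-unique : ∀ i → Unique (class i)
    class-unique i = Unique.filter⁺ (λ j → res j ℕ.≟ i) (Unique.allFin⁺ N)

  -- No field separates `A₂` from `B₁`: they coincide for a class of size three, so that both kinds
  -- of selection satisfy the same conditions.
  record Selected (P : Pairs N) : Set where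
    open Pairs P
    field
      A₁≢A₂ : A₁ ≢ A₂
      A₁≢B₁ : A₁ ≢ B₁
      A₁≢B₂ : A₁ ≢ B₂
      B₁≢B₂ : B₁ ≢ B₂
      resA  : res A₁ ≡ res A₂
      resB  : res B₁ ≡ res B₂

  module _ (noEmpty : ¬ HasEmptyClass t lam) where

    residue-surjective : ∀ {i} → i ℕ.< t → ∃ λ j → res j ≡ i
    residue-surjective {i} i<t with Fin.any? (λ j → res j ℕ.≟ i)
    ... | yes found = found
    ... | no ¬found = contradiction
      (fromℕ< i<t , λ j eq → ¬found (j , ≡.trans eq (Fin.toℕ-fromℕ< i<t))) noEmpty

    private
      sizes : ℕ → ℕ
      sizes i = length (class i)

      positive : ∀ {i} → i ∈ upTo t → 1 ℕ.≤ sizes i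
      positive i∈ with j , ≡.refl ← residue-surjective (∈.∈-upTo⁻ i∈) = nonempty (∈-class⁺ j)

      total : sumOf sizes (upTo t) ≡ 2 ℕ.+ length (upTo t)
      total = ≡.trans
        (sumOf-fibres res (allFin N) (Unique.upTo⁺ t) (λ j → ∈.∈-upTo⁺ (res<t j)))
        (≡.trans (List.length-tabulate {n = N} id)
          (≡.trans (ℕ.+-comm t 2) (≡.cong (2 ℕ.+_) (≡.sym (List.length-upTo t)))))

      large-unique : Unique (large sizes (upTo t))
      large-unique = Unique.filter⁺ (λ i → 2 ℕ.≤? sizes i) (Unique.upTo⁺ t)

      classes : ∀ {is} → large sizes (upTo t) ≡ is → multipleClasses t lam ≡ map class is
      classes eq = ≡.trans (filter-map (λ c → 2 ℕ.≤? length c) class (upTo t))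
        (≡.cong (map class) eq)

    selection : ∃ λ P → selectPairs (multipleClasses t lam) ≡ just P × Selected P
    selection with large₂ sizes (upTo t) (All.tabulate positive) total
    ... | inj₁ (i , j , eq , #i , #j)
      with a₁ , a₂ , eqi ← two (class i) #i | b₁ , b₂ , eqj ← two (class j) #j =
        pairs a₁ a₂ b₁ b₂
      , ≡.cong selectPairs (≡.trans (classes eq) (≡.cong₂ (λ c d → c ∷ d ∷ []) eqi eqj))
      , record
        { A₁≢A₂ = A₁≢A₂ (≡.subst Unique eqi (class-unique i))
        ; A₁≢B₁ = λ a≡b → i≢j (≡.trans (≡.sym ra₁) (≡.trans (≡.cong res a≡b) rb₁))
        ; A₁≢B₂ = λ a≡b → i≢j (≡.trans (≡.sym ra₁) (≡.trans (≡.cong res a≡b) rb₂))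
        ; B₁≢B₂ = A₁≢A₂ (≡.subst Unique eqj (class-unique j))
        ; resA  = ≡.trans ra₁ (≡.sym ra₂)
        ; resB  = ≡.trans rb₁ (≡.sym rb₂)
        }
      where
      A₁≢A₂ : ∀ {a b : Fin N} → Unique (a ∷ b ∷ []) → a ≢ b
      A₁≢A₂ ((a≢b ∷ []) ∷ _) = a≢b
      i≢j : i ≢ j
      i≢j with (i≢j ∷ []) ∷ _ ← ≡.subst Unique eq large-unique = i≢j
      ra₁ = ∈-class⁻ (≡.subst (a₁ ∈_) (≡.sym eqi) (here ≡.refl))
      ra₂ = ∈-class⁻ (≡.subst (a₂ ∈_) (≡.sym eqi) (there (here ≡.refl)))
      rb₁ = ∈-class⁻ (≡.subst (b₁ ∈_) (≡.sym eqj) (here ≡.refl))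
      rb₂ = ∈-class⁻ (≡.subst (b₂ ∈_) (≡.sym eqj) (there (here ≡.refl)))
    selection | inj₂ (i , eq , #i) with p , q , r , eqi ← three (class i) #i
      with (p≢q ∷ p≢r ∷ []) ∷ (q≢r ∷ []) ∷ _ ← ≡.subst Unique eqi (class-unique i) =
        pairs p q q r
      , ≡.cong selectPairs (≡.trans (classes eq) (≡.cong (_∷ []) eqi))
      , record
        { A₁≢A₂ = p≢q ; A₁≢B₁ = p≢q ; A₁≢B₂ = p≢r ; B₁≢B₂ = q≢r
        ; resA = ≡.trans rp (≡.sym rq) ; resB = ≡.trans rq (≡.sym rr) }
      where
      rp = ∈-class⁻ (≡.subst (p ∈_) (≡.sym eqi) (here ≡.refl))
      rq = ∈-class⁻ (≡.subst (q ∈_) (≡.sym eqi) (there (here ≡.refl)))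
      rr = ∈-class⁻ (≡.subst (r ∈_) (≡.sym eqi) (there (there (here ≡.refl))))

    module _ {P : Pairs N} (sel : Selected P) where
      open Pairs P
      open Selected sel

      private
        S = remaining A₁ B₁

      B₂∈remaining : B₂ ∈ S
      B₂∈remaining = ∈-remaining⁺ (A₁≢B₂ ∘ ≡.sym) (B₁≢B₂ ∘ ≡.sym)

      A₂∈remaining : A₂ ∈ B₁ ∷ S
      A₂∈remaining with A₂ Fin.≟ B₁
      ... | yes eq   = here eq
      ... | no A₂≢B₁ = there (∈-remaining⁺ (A₁≢A₂ ∘ ≡.sym) A₂≢B₁)

      private
        represented : ∀ j → ∃ λ k → k ∈ S × res k ≡ res j
        represented j with j Fin.≟ A₁ | j Fin.≟ B₁
        ... | no j≢A₁    | no j≢B₁     = j , ∈-remaining⁺ j≢A₁ j≢B₁ , ≡.refl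
        ... | _          | yes ≡.refl  = B₂ , B₂∈remaining , ≡.sym resB
        ... | yes ≡.refl | no _ with A₂∈remaining
        ...   | there A₂∈S  = A₂ , A₂∈S , ≡.sym resA
        -- In a class of size three `A₂` is removed as well, and its third element `B₂` stands for
        -- the class.
        ...   | here A₂≡B₁  = B₂ , B₂∈remaining
          , ≡.trans (≡.sym resB) (≡.trans (≡.cong res (≡.sym A₂≡B₁)) (≡.sym resA))

      -- Every residue survives the removal of the two columns, and t columns are left, so each
      -- residue occurs once.
      residueWord-↭ : residueWord t lam P ↭ downFrom t
      residueWord-↭ = ↭-sym (⊆∧length⇒↭ (Unique.downFrom⁺ t)
        (λ i∈ → let j , rj = residue-surjective (∈.∈-downFrom⁻ i∈)
                    k , k∈ , rk = represented j
                in ≡.subst (_∈ map res S) (≡.trans rk rj) (∈.∈-map⁺ res k∈))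
        (ℕ.≤-reflexive (≡.trans (length-map res S) (≡.trans #S (≡.sym (List.length-downFrom t))))))
        where
        #S : length S ≡ t
        #S = ℕ.+-cancelˡ-≡ 2 (length S) t (≡.trans
          (≡.sym (↭.↭-length (allFin-↭ A₁≢B₁)))
          (≡.trans (List.length-tabulate {n = N} id) (ℕ.+-comm t 2)))

-- Evaluation at roots of unity

-- Deleting the missed value with `punchOut` leaves n - 1 values for at least n arguments.
pigeonhole-missing : ∀ {n l} (k : Fin n) (h : Fin l → Fin n) → n ℕ.≤ l → (∀ j → k ≢ h j) →
  ∃ λ i → ∃ λ j → i Fin.< j × h i ≡ h j
pigeonhole-missing {suc n} k h n≤l k≢h
  with i , j , i<j , eq ← Fin.pigeonhole n≤l (λ j → Fin.punchOut (k≢h j)) =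
  i , j , i<j , Fin.punchOut-injective (k≢h i) (k≢h j) eq

lookup-collision : ∀ {A : Set} {n i} (f : A → ℕ) → i ℕ.< n → ∀ xs → n ℕ.≤ length xs →
  (∀ x → f x ℕ.< n) → All (λ x → f x ≢ i) xs →
  ∃ λ j → ∃ λ k → j Fin.< k × f (lookup xs j) ≡ f (lookup xs k)
lookup-collision f i<n xs n≤ f<n misses =
  let j , k , j<k , eq = pigeonhole-missing (fromℕ< i<n) (λ j → fromℕ< (f<n (lookup xs j))) n≤
        λ j eq → All.lookup misses (∈.∈-lookup {xs = xs} j) (Fin.fromℕ<-injective _ _ (f<n _) i<n (≡.sym eq))
  in j , k , j<k , Fin.fromℕ<-injective _ _ (f<n _) (f<n _) eq

module RootsOfUnity {c ℓ} (R : CommutativeRing c ℓ) where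
  open CommutativeRing R hiding (zero)
  open Exp semiring using (_^_; ^-homo-*; ^-congʳ; ^-congˡ; ^-assocʳ)
  open IntegerCoefficients R using (solve; _:=_; con; _:*_; _:-_; :-_)
  open Determinants R
  open Branching R
  open Bialternants R
  open Permutations R
  open TwoExtraRows R
  open SetoidReasoning setoid

  one-power : ∀ n → 1# ^ n ≈ 1#
  one-power zero    = refl
  one-power (suc n) = trans (*-identityˡ _) (one-power n)

  repeated-lookup : ∀ {rs g} → Alternating rs g → ∀ βs (i j : Fin (length βs)) → i Fin.< j →
    Agree rs (monomial (lookup βs i)) (monomial (lookup βs j)) → g (monomials βs) ≈ 0#
  repeated-lookup alt (β ∷ βs) zero    (suc j) _         p = trans
    (respects alt (p ∷ ≋-refl))
    (repeated-∈ alt (∈.∈-map⁺ monomial (∈.∈-lookup {xs = βs} j)))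
  repeated-lookup alt (β ∷ βs) (suc i) (suc j) (s≤s i<j) p =
    repeated-lookup (prefix (monomial β) alt) βs i j i<j p

  -- Each minor omits one column, and `All P` passes to the others. The helper `rest` carries along
  -- the columns already pushed into `g`.
  expand-vanishing : ∀ {A : Set} {P : A → Set} {r} {g : List Column → Carrier} (h : A → Column) n →
    (∀ xs → length xs ≡ n → All P xs → g (map h xs) ≈ 0#) →
    ∀ xs → length xs ≡ suc n → All P xs → expand r g (map h xs) ≈ 0#
  expand-vanishing {P = P} {r} {g} h n g≈0 (x ∷ xs) #xs (px ∷ pxs) = begin
    h x r * g (map h xs) - expand r (g ∘ (h x ∷_)) (map h xs)
      ≈⟨ +-cong (*-congˡ (g≈0 xs (ℕ.suc-injective #xs) pxs))
           (-‿cong (rest n xs (ℕ.suc-injective #xs) pxs λ ys #ys pys →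
             g≈0 (x ∷ ys) #ys (px ∷ pys))) ⟩
    h x r * 0# - 0#
      ≈⟨ solve 1 (λ a → a :* con 0ℤ :- con 0ℤ := con 0ℤ) refl (h x r) ⟩
    0# ∎
    where
    rest : ∀ m ys → length ys ≡ m → All P ys →
      (∀ zs → suc (length zs) ≡ m → All P zs → g (h x ∷ map h zs) ≈ 0#) →
      expand r (g ∘ (h x ∷_)) (map h ys) ≈ 0#
    rest zero    []  _   _   _  = refl
    rest (suc m) ys  #ys pys g≈ = expand-vanishing {g = g ∘ (h x ∷_)} h m
      (λ zs #zs → g≈ zs (≡.cong suc #zs)) ys #ys pys

  module _ (x : ℕ → Carrier) where

    All-points : ∀ {p} {P : Carrier → Set p} n → (∀ k → k ℕ.< n → P (x k)) → All P (points x n)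
    All-points zero    _ = []
    All-points (suc n) p = p n ℕ.≤-refl ∷ All-points n λ k k<n → p k (ℕ.m<n⇒m<1+n k<n)

    private
      sumBelow-zeros : ∀ n m p → sumBelow x n p (Vec.replicate m 0) ≈ 1#
      sumBelow-zeros n zero    p = refl
      sumBelow-zeros n (suc m) p = trans (sumSorted-[] n _) (trans
        (*-cong (*-identityˡ _) (sumBelow-zeros n m [])) (*-identityˡ _))

      schur-zeros : ∀ n m → schur x n (Vec.replicate m 0) ≈ 1#
      schur-zeros n zero    = refl
      schur-zeros n (suc m) = trans (sumSorted-[] n _)
        (trans (*-identityˡ _) (sumBelow-zeros n m []))

      betas-zeros : ∀ n → betas (Vec.replicate n 0) ≡ downFrom n
      betas-zeros zero    = ≡.refl
      betas-zeros (suc n) = ≡.cong (n ∷_) (betas-zeros n)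

      Decreasing-zeros : ∀ n → Decreasing 0 (Vec.replicate n 0)
      Decreasing-zeros zero    = tt
      Decreasing-zeros (suc n) = z≤n , Decreasing-zeros n

    -- The bialternant formula for the empty partition, whose Schur polynomial is 1.
    det-downFrom : ∀ n → det (points x n) (monomials (downFrom n)) ≈ vandermonde x n
    det-downFrom n = begin
      det (points x n) (monomials (downFrom n))
        ≡⟨ ≡.cong (det (points x n) ∘ monomials) (≡.sym (betas-zeros n)) ⟩
      det (points x n) (monomials (betas (Vec.replicate n 0)))
        ≈⟨ bialternant x (Vec.replicate n 0) (Decreasing-zeros n) ⟩
      vandermonde x n * schur x n (Vec.replicate n 0)
        ≈⟨ trans (*-congˡ (schur-zeros n n)) (*-identityʳ _) ⟩
      vandermonde x n ∎

    module _ (t : ℕ) .{{_ : NonZero t}} (root : ∀ k → k ℕ.< t → x k ^ t ≈ 1#) where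

      power-% : ∀ {r} → r ^ t ≈ 1# → ∀ n → r ^ n ≈ r ^ (n % t)
      power-% {r} rt n = begin
        r ^ n                                   ≡⟨ ≡.cong (r ^_) (ℕ.m≡m%n+[m/n]*n n t) ⟩
        r ^ (n % t ℕ.+ n ℕ./ t ℕ.* t)           ≈⟨ ^-homo-* r (n % t) _ ⟩
        r ^ (n % t) * r ^ (n ℕ./ t ℕ.* t)
          ≈⟨ *-congˡ (^-congʳ r (ℕ.*-comm (n ℕ./ t) t)) ⟩
        r ^ (n % t) * r ^ (t ℕ.* (n ℕ./ t))     ≈⟨ *-congˡ (^-assocʳ r t (n ℕ./ t)) ⟨
        r ^ (n % t) * (r ^ t) ^ (n ℕ./ t)
          ≈⟨ *-congˡ (trans (^-congˡ (n ℕ./ t) rt) (one-power (n ℕ./ t))) ⟩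
        r ^ (n % t) * 1#                        ≈⟨ *-identityʳ _ ⟩
        r ^ (n % t)                             ∎

      monomial-% : ∀ n → Agree (points x t) (monomial n) (monomial (n % t))
      monomial-% n = All-points t λ k k<t → power-% (root k k<t) n

      monomial-≡ : ∀ {m n} → m % t ≡ n % t → Agree (points x t) (monomial m) (monomial n)
      monomial-≡ {m} {n} eq = All-points t λ k k<t → trans (power-% (root k k<t) m)
        (trans (^-congʳ (x k) eq) (sym (power-% (root k k<t) n)))

      private
        g : List Column → Carrier
        g = det (points x t)

        alt : Alternating (points x t) g
        alt = det-alternating (points x t)

      -- Exponents count only modulo t on these rows, and sorting the residues leads to the
      -- Vandermonde determinant. The sorted order is decreasing, and its own inversions produce
      -- `sign (t C 2)`.
      det-residues : ∀ βs → map (_% t) βs ↭ downFrom t →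
        g (monomials βs) ≈
          sign (inversions (map (_% t) βs)) * (sign (t C 2) * vandermonde x t)
      det-residues βs p = begin
        g (monomials βs)
          ≈⟨ respects alt (reduce βs) ⟩
        g (monomials rs)
          ≈⟨ trans (*-congʳ (sign-square (inversions rs))) (*-identityˡ _) ⟨
        sign (inversions rs) * sign (inversions rs) * g (monomials rs)
          ≈⟨ *-assoc _ _ _ ⟩
        sign (inversions rs) * (sign (inversions rs) * g (monomials rs))
          ≡⟨ ≡.cong (λ ks → sign (inversions rs) * (sign (inversions ks) * g (monomials rs)))
               (≡.sym (List.map-id rs)) ⟩
        sign (inversions rs) * (sign (inversions (map id rs)) * g (monomials rs))
          ≈⟨ *-congˡ (sign-↭ id id {g ∘ monomials} (alternating⇒swapNegates monomial alt) p) ⟩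
        sign (inversions rs) * (sign (inversions (map id (downFrom t))) * g (monomials (downFrom t)))
          ≈⟨ *-congˡ (*-cong
               (^-congʳ _ (≡.trans (≡.cong inversions (List.map-id (downFrom t)))
                 (inversions-downFrom t)))
               (det-downFrom t)) ⟩
        sign (inversions rs) * (sign (t C 2) * vandermonde x t) ∎
        where
        rs = map (_% t) βs
        reduce : ∀ ks → Pointwise (Agree (points x t)) (monomials ks) (monomials (map (_% t) ks))
        reduce []       = []
        reduce (k ∷ ks) = monomial-% k ∷ reduce ks

      Misses : ℕ → List ℕ → Set
      Misses i = All (λ β → β % t ≢ i)

      det-missing : ∀ {i} → i ℕ.< t → ∀ βs → length βs ≡ t → Misses i βs →
        g (monomials βs) ≈ 0#
      det-missing i<t βs #βs misses
        with j , k , j<k , eq ← lookup-collision (_% t) i<t βs (ℕ.≤-reflexive (≡.sym #βs))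
          (λ β → ℕ.m%n<n β t) misses =
        repeated-lookup alt βs j k j<k (monomial-≡ {lookup βs j} {lookup βs k} eq)

      det₂-missing : ∀ {i} → i ℕ.< t → ∀ βs → length βs ≡ 2 ℕ.+ t → Misses i βs →
        det (points x (2 ℕ.+ t)) (monomials βs) ≈ 0#
      det₂-missing i<t = expand-vanishing monomial (suc t)
        (expand-vanishing monomial t (det-missing i<t))

      module _ {w w̄ : Carrier} (ww̄ : w * w̄ ≈ 1#)
               (x-z : x t ≈ w * w) (x-z̄ : x (suc t) ≈ w̄ * w̄) where

        det₂-pairs : ∀ a₁ a₂ b₁ b₂ βs → a₂ ∈ b₁ ∷ βs → b₂ ∈ βs →
          a₁ % t ≡ a₂ % t → b₁ % t ≡ b₂ % t →
          det (points x (2 ℕ.+ t)) (monomials (a₁ ∷ b₁ ∷ βs)) ≈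
            difference ww̄ (+ a₁ ℤ.- + a₂) * difference ww̄ (+ b₁ ℤ.- + b₂)
              * difference ww̄ (+ a₁ ℤ.+ + a₂ ℤ.- + b₁ ℤ.- + b₂) * g (monomials βs)
        det₂-pairs a₁ a₂ b₁ b₂ βs a₂∈ b₂∈ eqa eqb = begin
          det (points x (2 ℕ.+ t)) (monomials (a₁ ∷ b₁ ∷ βs))
            ≈⟨ expandTwice-pairs alt (x (suc t)) (x t)
                 (∈.∈-map⁺ monomial a₂∈) (∈.∈-map⁺ monomial b₂∈)
                 (monomial-≡ eqa) (monomial-≡ eqb) ⟩
          ((x (suc t) ^ a₁ - x (suc t) ^ a₂) * (x t ^ b₁ - x t ^ b₂)
            - (x (suc t) ^ b₁ - x (suc t) ^ b₂) * (x t ^ a₁ - x t ^ a₂)) * g (monomials βs)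
            ≈⟨ *-congʳ (trans
                 (+-cong (*-cong (z̄-cong a₁ a₂) (z-cong b₁ b₂))
                   (-‿cong (*-cong (z̄-cong b₁ b₂) (z-cong a₁ a₂))))
                 (minor-identity ww̄ a₁ a₂ b₁ b₂)) ⟩
          difference ww̄ (+ a₁ ℤ.- + a₂) * difference ww̄ (+ b₁ ℤ.- + b₂)
            * difference ww̄ (+ a₁ ℤ.+ + a₂ ℤ.- + b₁ ℤ.- + b₂) * g (monomials βs) ∎
          where
          z-cong : ∀ m n → x t ^ m - x t ^ n ≈ (w * w) ^ m - (w * w) ^ n
          z-cong m n = +-cong (^-congˡ m x-z) (-‿cong (^-congˡ n x-z))
          z̄-cong : ∀ m n → x (suc t) ^ m - x (suc t) ^ n ≈ (w̄ * w̄) ^ m - (w̄ * w̄) ^ n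
          z̄-cong m n = +-cong (^-congˡ m x-z̄) (-‿cong (^-congˡ n x-z̄))

        vandermonde₂ : 2 ℕ.≤ t → vandermonde x (2 ℕ.+ t) ≈
          difference ww̄ (+ t) * difference ww̄ (+ t) * difference ww̄ (+ 2) * vandermonde x t
        vandermonde₂ 2≤t = begin
          vandermonde x (2 ℕ.+ t)
            ≈⟨ det-downFrom (2 ℕ.+ t) ⟨
          det (points x (2 ℕ.+ t)) (monomials (suc t ∷ t ∷ downFrom t))
            -- The pairs are t + 1, 1 and t, 0: both differences equal t, and the third quantity is
            -- (t + 1) + 1 - t - 0 = 2. The bound `2≤t` places 1 among the remaining exponents.
            ≈⟨ det₂-pairs (suc t) 1 t 0 (downFrom t)
                 (there (∈.∈-downFrom⁺ 2≤t)) (∈.∈-downFrom⁺ (ℕ.<⇒≤ 2≤t))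
                 (ℕ.[m+n]%n≡m%n 1 t) (≡.trans (ℕ.n%n≡0 t) (≡.sym (ℕ.m<n⇒m%n≡m (ℕ.<⇒≤ 2≤t)))) ⟩
          difference ww̄ (+ suc t ℤ.- + 1) * difference ww̄ (+ t ℤ.- + 0)
            * difference ww̄ (+ suc t ℤ.+ + 1 ℤ.- + t ℤ.- + 0) * g (monomials (downFrom t))
            ≡⟨ ≡.cong₂ (λ i j → difference ww̄ i * difference ww̄ (+ t ℤ.- + 0)
                 * difference ww̄ j * g (monomials (downFrom t)))
                 (ℤ.⊖-≥ {suc t} {1} (s≤s z≤n)) last ⟩
          difference ww̄ (+ t) * difference ww̄ (+ t ℤ.- + 0)
            * difference ww̄ (+ 2) * g (monomials (downFrom t))
            ≡⟨ ≡.cong (λ i → difference ww̄ (+ t) * difference ww̄ i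
                 * difference ww̄ (+ 2) * g (monomials (downFrom t))) (ℤ.+-identityʳ (+ t)) ⟩
          difference ww̄ (+ t) * difference ww̄ (+ t)
            * difference ww̄ (+ 2) * g (monomials (downFrom t))
            ≈⟨ *-congˡ (det-downFrom t) ⟩
          difference ww̄ (+ t) * difference ww̄ (+ t)
            * difference ww̄ (+ 2) * vandermonde x t ∎
          where
          last : + suc t ℤ.+ + 1 ℤ.- + t ℤ.- + 0 ≡ + 2
          last = ≡.trans (ℤ.+-identityʳ _) (≡.trans (ℤ.m-n≡m⊖n (suc t ℕ.+ 1) t) (≡.trans
            (≡.cong (ℤ._⊖ t) (ℕ.+-comm (suc t) 1))
            (≡.trans (ℤ.⊖-≥ (ℕ.m≤n+m t 2)) (≡.cong +_ (ℕ.m+n∸n≡m 2 t)))))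

-- Beta-numbers of a shape, signs and multiplicities

map-betas : ∀ {N} (lam : Shape N) → betas (Vec.tabulate lam) ≡ map (beta lam) (allFin N)
map-betas lam = ≡.trans (betas-tabulate lam) (≡.sym (List.map-tabulate id (beta lam)))
  where
  betas-tabulate : ∀ {N} (lam : Shape N) → betas (Vec.tabulate lam) ≡ tabulate (beta lam)
  betas-tabulate {zero}  lam = ≡.refl
  betas-tabulate {suc N} lam = ≡.cong (beta lam zero ∷_) (betas-tabulate (lam ∘ suc))

Decreasing-tabulate : ∀ {N b} (lam : Shape N) → (∀ i → lam i ℕ.≤ b) → IsPartition lam →
  Decreasing b (Vec.tabulate lam)
Decreasing-tabulate {zero}  lam ≤b part = tt
Decreasing-tabulate {suc N} lam ≤b part = ≤b zero
  , Decreasing-tabulate (lam ∘ suc) (λ i → part {zero} {suc i} z≤n) (λ i≤j → part (s≤s i≤j))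

beta-decreasing : ∀ {N} {lam : Shape N} → IsPartition lam → ∀ {i j} → i Fin.< j →
  beta lam j ℕ.< beta lam i
beta-decreasing part {i} {j} i<j =
  ℕ.+-mono-≤-< (part (ℕ.<⇒≤ i<j)) (ℕ.∸-monoʳ-< (s≤s i<j) (Fin.toℕ<n j))

sgn-> : ∀ {m n} → n ℕ.< m → sgn (+ m ℤ.- + n) ≡ 1ℤ
sgn-> {m} {n} n<m = ≡.trans
  (≡.cong sgn (≡.trans (ℤ.m-n≡m⊖n m n) (ℤ.⊖-≥ (ℕ.<⇒≤ n<m)))) (positive (ℕ.m<n⇒0<n∸m n<m))
  where
  positive : ∀ {k} → 0 ℕ.< k → sgn (+ k) ≡ 1ℤ
  positive {suc k} _ = ≡.refl

sgn-< : ∀ {m n} → m ℕ.< n → sgn (+ m ℤ.- + n) ≡ -1ℤ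
sgn-< {m} {n} m<n = ≡.trans
  (≡.cong sgn (≡.trans (ℤ.m-n≡m⊖n m n) (ℤ.⊖-≤ (ℕ.<⇒≤ m<n)))) (negative (ℕ.m<n⇒0<n∸m m<n))
  where
  negative : ∀ {k} → 0 ℕ.< k → sgn (ℤ.- (+ k)) ≡ -1ℤ
  negative {suc k} _ = ≡.refl

private
  open Sum ℕ.+-0-monoid using () renaming (sum to sumℕ; sum-cong-≗ to sumℕ-cong)
  open CommutativeSum ℕ.+-0-commutativeMonoid using () renaming (∑-distrib-+ to sumℕ-+)

  sumℕ-0 : ∀ {n} (f : Fin n → ℕ) → (∀ i → f i ≡ 0) → sumℕ f ≡ 0
  sumℕ-0 {zero}  f f≡0 = ≡.refl
  sumℕ-0 {suc n} f f≡0 = ≡.cong₂ ℕ._+_ (f≡0 zero) (sumℕ-0 (f ∘ suc) (f≡0 ∘ suc))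

  sumℕ-single : ∀ {n} (f : Fin n → ℕ) i → (∀ j → i ≢ j → f j ≡ 0) → sumℕ f ≡ f i
  sumℕ-single f zero    f≡0 = ≡.trans
    (≡.cong (f zero ℕ.+_) (sumℕ-0 (f ∘ suc) λ j → f≡0 (suc j) λ ())) (ℕ.+-identityʳ _)
  sumℕ-single f (suc i) f≡0 = ≡.cong₂ ℕ._+_ (f≡0 zero λ ())
    (sumℕ-single (f ∘ suc) i λ j i≢j → f≡0 (suc j) (i≢j ∘ Fin.suc-injective))

  δ : ∀ {n} → Fin n → Fin n → ℕ
  δ i j = if does (i Fin.≟ j) then 1 else 0

  δ-≡ : ∀ {n} (i : Fin n) → δ i i ≡ 1
  δ-≡ i = ≡.cong (if_then 1 else 0) (Dec.dec-true (i Fin.≟ i) ≡.refl)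

  δ-≢ : ∀ {n} {i j : Fin n} → i ≢ j → δ i j ≡ 0
  δ-≢ {i = i} {j} i≢j = ≡.cong (if_then 1 else 0) (Dec.dec-false (i Fin.≟ j) i≢j)

  count : ∀ {l N} → (Fin l → Fin N) → Fin N → ℕ
  count {l} u k = length (filter (λ j → u j Fin.≟ k) (allFin l))

  count-suc : ∀ {l N} (u : Fin (suc l) → Fin N) k →
    count u k ≡ δ (u zero) k ℕ.+ count (u ∘ suc) k
  count-suc {l} u k = ≡.trans head (≡.cong (δ (u zero) k ℕ.+_) tail)
    where
    head : count u k ≡ δ (u zero) k ℕ.+ length (filter (λ j → u j Fin.≟ k) (tabulate suc))
    head with does (u zero Fin.≟ k)
    ... | true  = ≡.refl
    ... | false = ≡.refl
    tail : length (filter (λ j → u j Fin.≟ k) (tabulate suc)) ≡ count (u ∘ suc) k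
    tail = ≡.trans
      (≡.cong (λ js → length (filter (λ j → u j Fin.≟ k) js)) (≡.sym (List.map-tabulate id suc)))
      (≡.trans (≡.cong length (filter-map (λ j → u j Fin.≟ k) suc (allFin l)))
        (length-map suc (filter (λ j → u (suc j) Fin.≟ k) (allFin l))))

  ↑ˡ≢↑ʳ : ∀ {m n} (i : Fin m) (j : Fin n) → i ↑ˡ n ≢ m ↑ʳ j
  ↑ˡ≢↑ʳ {m} {n} i j eq = ℕ.<⇒≢
    (ℕ.<-≤-trans (Fin.toℕ<n i) (ℕ.m≤m+n m (toℕ j)))
    (≡.trans (≡.sym (Fin.toℕ-↑ˡ i n)) (≡.trans (≡.cong toℕ eq) (Fin.toℕ-↑ʳ m j)))

-- The weight of a tableau as a product over its boxes

module Weights {c ℓ} (R : CommutativeRing c ℓ) (t : ℕ)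
  (ζ z z̄ : CommutativeRing.Carrier R) where
  open CommutativeRing R hiding (zero)
  open Exp semiring using (_^_; ^-homo-*; ^-congʳ)
  open IntegerCoefficients R using (solve; _:=_; _:*_)
  open Branching R
  open TableauSums R
  open SetoidReasoning setoid

  letter : ℕ → Carrier
  letter k = if k ℕ.<ᵇ t then ζ ^ k else (if k ℕ.≡ᵇ t then z else z̄)

  letter-< : ∀ {k} → k ℕ.< t → letter k ≡ ζ ^ k
  letter-< {k} k<t = ≡.cong (if_then ζ ^ k else (if k ℕ.≡ᵇ t then z else z̄)) (<⇒<ᵇ≡true k<t)

  private
    letter-≥ : ∀ {k} → t ℕ.≤ k → letter k ≡ (if k ℕ.≡ᵇ t then z else z̄)
    letter-≥ {k} t≤k = ≡.cong (if_then ζ ^ k else (if k ℕ.≡ᵇ t then z else z̄)) (≤⇒<ᵇ≡false t≤k)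

  letter-t : letter t ≡ z
  letter-t = ≡.trans (letter-≥ ℕ.≤-refl)
    (≡.cong (if_then z else z̄) (Dec.dec-true (t ℕ.≟ t) ≡.refl))

  letter-1+t : letter (suc t) ≡ z̄
  letter-1+t = ≡.trans (letter-≥ (ℕ.n≤1+n t))
    (≡.cong (if_then z else z̄) (Dec.dec-false (suc t ℕ.≟ t) ℕ.1+n≢n))

  -- The monomial of a vector of multiplicities. It turns sums into products, so comparing it with
  -- `letter` on the vectors `δ a` of single boxes is enough.
  powerProduct : (Fin (t ℕ.+ 2) → ℕ) → Carrier
  powerProduct m = ζ ^ sumℕ (λ (k : Fin t) → toℕ k ℕ.* m (k ↑ˡ 2))
    * (z ^ m (t ↑ʳ zero) * z̄ ^ m (t ↑ʳ suc zero))

  private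
    powerProduct-cong : ∀ {m m′} → (∀ k → m k ≡ m′ k) → powerProduct m ≈ powerProduct m′
    powerProduct-cong m≗m′ = *-cong
      (^-congʳ ζ (sumℕ-cong λ k → ≡.cong (toℕ k ℕ.*_) (m≗m′ (k ↑ˡ 2))))
      (*-cong (^-congʳ z (m≗m′ (t ↑ʳ zero))) (^-congʳ z̄ (m≗m′ (t ↑ʳ suc zero))))

    powerProduct-+ : ∀ m m′ →
      powerProduct (λ k → m k ℕ.+ m′ k) ≈ powerProduct m * powerProduct m′
    powerProduct-+ m m′ = trans
      (*-cong
        (trans (^-congʳ ζ (≡.trans
            (sumℕ-cong λ k → ℕ.*-distribˡ-+ (toℕ k) (m (k ↑ˡ 2)) (m′ (k ↑ˡ 2)))
            (sumℕ-+ (λ k → toℕ k ℕ.* m (k ↑ˡ 2)) (λ k → toℕ k ℕ.* m′ (k ↑ˡ 2)))))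
          (^-homo-* ζ (e m) (e m′)))
        (*-cong (^-homo-* z (m (t ↑ʳ zero)) (m′ (t ↑ʳ zero)))
          (^-homo-* z̄ (m (t ↑ʳ suc zero)) (m′ (t ↑ʳ suc zero)))))
      (solve 6 (λ a a′ b b′ c c′ →
          (a :* a′) :* ((b :* b′) :* (c :* c′)) := (a :* (b :* c)) :* (a′ :* (b′ :* c′))) refl
        (ζ ^ e m) (ζ ^ e m′) (z ^ m (t ↑ʳ zero)) (z ^ m′ (t ↑ʳ zero))
        (z̄ ^ m (t ↑ʳ suc zero)) (z̄ ^ m′ (t ↑ʳ suc zero)))
      where
      e : (Fin (t ℕ.+ 2) → ℕ) → ℕ
      e m = sumℕ (λ (k : Fin t) → toℕ k ℕ.* m (k ↑ˡ 2))

    powerProduct-0 : ∀ m → (∀ k → m k ≡ 0) → powerProduct m ≈ 1#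
    powerProduct-0 m m≡0 = trans
      (*-cong (^-congʳ ζ (sumℕ-0 (λ k → toℕ k ℕ.* m (k ↑ˡ 2)) λ k →
          ≡.trans (≡.cong (toℕ k ℕ.*_) (m≡0 (k ↑ˡ 2))) (ℕ.*-zeroʳ (toℕ k))))
        (trans (*-cong (^-congʳ z (m≡0 (t ↑ʳ zero))) (^-congʳ z̄ (m≡0 (t ↑ʳ suc zero)))) (*-identityˡ 1#)))
      (*-identityˡ 1#)

    δ-sum-0 : ∀ j → sumℕ (λ (k : Fin t) → toℕ k ℕ.* δ (t ↑ʳ j) (k ↑ˡ 2)) ≡ 0
    δ-sum-0 j = sumℕ-0 (λ (k : Fin t) → toℕ k ℕ.* δ (t ↑ʳ j) (k ↑ˡ 2)) λ k → ≡.trans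
      (≡.cong (toℕ k ℕ.*_) (δ-≢ (↑ˡ≢↑ʳ {n = 2} k j ∘ ≡.sym))) (ℕ.*-zeroʳ (toℕ k))

    δ-sum : ∀ i → sumℕ (λ (k : Fin t) → toℕ k ℕ.* δ (i ↑ˡ 2) (k ↑ˡ 2)) ≡ toℕ i
    δ-sum i = ≡.trans
      (sumℕ-single (λ (k : Fin t) → toℕ k ℕ.* δ (i ↑ˡ 2) (k ↑ˡ 2)) i λ k i≢k → ≡.trans
        (≡.cong (toℕ k ℕ.*_) (δ-≢ (i≢k ∘ Fin.↑ˡ-injective 2 i k))) (ℕ.*-zeroʳ (toℕ k)))
      (≡.trans (≡.cong (toℕ i ℕ.*_) (δ-≡ (i ↑ˡ 2))) (ℕ.*-identityʳ (toℕ i)))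

    ↑ʳ-≢ : t ↑ʳ Fin.zero {1} ≢ t ↑ʳ suc zero
    ↑ʳ-≢ eq with () ← Fin.↑ʳ-injective t zero (suc zero) eq

    powerProduct-δ : ∀ a → powerProduct (δ a) ≈ letter (toℕ a)
    powerProduct-δ a with Fin.splitAt t a in eq
    ... | inj₁ i with ≡.refl ← Fin.splitAt⁻¹-↑ˡ eq = begin
      powerProduct (δ (i ↑ˡ 2))
        ≈⟨ *-cong (^-congʳ ζ (δ-sum i))
             (*-cong (^-congʳ z (δ-≢ (↑ˡ≢↑ʳ {n = 2} i zero)))
                (^-congʳ z̄ (δ-≢ (↑ˡ≢↑ʳ {n = 2} i (suc zero))))) ⟩
      ζ ^ toℕ i * (1# * 1#)   ≈⟨ trans (*-congˡ (*-identityˡ 1#)) (*-identityʳ _) ⟩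
      ζ ^ toℕ i               ≡⟨ letter-< (Fin.toℕ<n i) ⟨
      letter (toℕ i)          ≡⟨ ≡.cong letter (Fin.toℕ-↑ˡ i 2) ⟨
      letter (toℕ (i ↑ˡ 2))   ∎
    ... | inj₂ zero with ≡.refl ← Fin.splitAt⁻¹-↑ʳ {t} eq = begin
      powerProduct (δ (t ↑ʳ zero))
        ≈⟨ *-cong (^-congʳ ζ (δ-sum-0 zero))
             (*-cong (^-congʳ z (δ-≡ (t ↑ʳ zero))) (^-congʳ z̄ (δ-≢ ↑ʳ-≢))) ⟩
      1# * ((z * 1#) * 1#)
        ≈⟨ trans (*-identityˡ _) (trans (*-identityʳ _) (*-identityʳ _)) ⟩
      z                       ≡⟨ letter-t ⟨
      letter t
        ≡⟨ ≡.cong letter (≡.trans (Fin.toℕ-↑ʳ t zero) (ℕ.+-identityʳ t)) ⟨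
      letter (toℕ (t ↑ʳ zero)) ∎
    ... | inj₂ (suc zero) with ≡.refl ← Fin.splitAt⁻¹-↑ʳ {t} eq = begin
      powerProduct (δ (t ↑ʳ suc zero))
        ≈⟨ *-cong (^-congʳ ζ (δ-sum-0 (suc zero)))
             (*-cong (^-congʳ z (δ-≢ (↑ʳ-≢ ∘ ≡.sym))) (^-congʳ z̄ (δ-≡ (t ↑ʳ suc zero)))) ⟩
      1# * (1# * (z̄ * 1#))
        ≈⟨ trans (*-identityˡ _) (trans (*-identityˡ _) (*-identityʳ _)) ⟩
      z̄                       ≡⟨ letter-1+t ⟨
      letter (suc t)
        ≡⟨ ≡.cong letter (≡.trans (Fin.toℕ-↑ʳ t (suc zero)) (ℕ.+-comm t 1)) ⟨
      letter (toℕ (t ↑ʳ suc zero)) ∎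

    powerProduct-count : ∀ {l} (u : Fin l → Fin (t ℕ.+ 2)) →
      powerProduct (count u) ≈ weight letter (word u)
    powerProduct-count {zero}  u = powerProduct-0 (count u) λ _ → ≡.refl
    powerProduct-count {suc l} u = trans (powerProduct-cong (count-suc u)) (trans
      (powerProduct-+ (δ (u zero)) (count (u ∘ suc)))
      (*-cong (powerProduct-δ (u zero)) (powerProduct-count (u ∘ suc))))

  powerProduct-words : ∀ {M} {lam : Shape M} (T : ∀ i → Fin (lam i) → Fin (t ℕ.+ 2)) →
    powerProduct (λ k → sumℕ (λ i → count (T i) k)) ≈ weights letter (words T)
  powerProduct-words {zero}  T = powerProduct-0 (λ _ → 0) λ _ → ≡.refl
  powerProduct-words {suc M} T = trans
    (powerProduct-+ (count (T zero)) (λ k → sumℕ (λ i → count (T (suc i)) k)))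
    (*-cong (powerProduct-count (T zero)) (powerProduct-words (λ i → T (suc i))))

-- The theorem

private
  choose₂ : ∀ n → suc n C 2 ≡ n ℕ.+ n C 2
  choose₂ n = ≡.trans (≡.sym (nCk+nC[k+1]≡[n+1]C[k+1] n 1)) (≡.cong (ℕ._+ n C 2) (nC1≡n n))

module Evaluation {c ℓ₁ ℓ₂} (F : HeytingField c ℓ₁ ℓ₂) where
  open HeytingField F using (heytingCommutativeRing; _#_; #⇒invertible)
  open HeytingProperties heytingCommutativeRing
    using (x-0≈x; 1#0; x#0y#0→xy#0; invertibleˡ⇒#; #-congʳ)

  R : CommutativeRing c ℓ₁
  R = HeytingCommutativeRing.commutativeRing heytingCommutativeRing

  open CommutativeRing R hiding (zero)
  open Exp semiring using (_^_; ^-homo-*; ^-congʳ; ^-congˡ; ^-assocʳ)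
  open IntegerCoefficients R
  open Determinants R
  open Branching R
  open Bialternants R
  open TableauSums R
  open Permutations R
  open TwoExtraRows R
  open RootsOfUnity R using (All-points; one-power; det-residues; det₂-missing; det₂-pairs; vandermonde₂)
  open SetoidReasoning setoid

  inverse-right : ∀ {x} (x#0 : x # 0#) → x * inverse F x#0 ≈ 1#
  inverse-right x#0 =
    trans (*-congʳ (sym (x-0≈x _))) (proj₂ (proj₂ (#⇒invertible x#0)))

  *-cancel-# : ∀ {x a b} → x # 0# → x * a ≈ x * b → a ≈ b
  *-cancel-# {x} {a} {b} x#0 xa≈xb = trans (sym (undo a)) (trans (*-congˡ xa≈xb) (undo b))
    where
    undo : ∀ a → inverse F x#0 * (x * a) ≈ a
    undo a = trans (sym (*-assoc _ _ _)) (trans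
      (*-congʳ (trans (*-comm _ _) (inverse-right x#0))) (*-identityˡ a))

  fromℤ≡integer : ∀ i → fromℤ F i ≡ integer i
  fromℤ≡integer (+ n)    = ≡.refl
  fromℤ≡integer -[1+ n ] = ≡.refl

  zpow≡intPower : ∀ {x} (x#0 : x # 0#) i → zpow F x#0 i ≡ intPower x (inverse F x#0) i
  zpow≡intPower x#0 (+ n)    = ≡.refl
  zpow≡intPower x#0 -[1+ n ] = ≡.refl

  ∏# : ∀ {h rs} → All (λ r → h r # 0#) rs → ∏ h rs # 0#
  ∏# []         = 1#0
  ∏# (hr ∷ hrs) = x#0y#0→xy#0 hr (∏# hrs)

  difference# : ∀ {x y} → x # y → x - y # 0#
  difference# x#y with v , v* , _ ← #⇒invertible x#y =
    invertibleˡ⇒# (v , trans (*-congˡ (x-0≈x _)) v*)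

  module _ {t : ℕ} .{{_ : NonZero t}} {ζ : Carrier} (isPrimitive : IsPrimitiveRoot F t ζ)
           (x : ℕ → Carrier) (x≈ : ∀ k → k ℕ.< t → x k ≈ ζ ^ k) where

    private
      ζ#0 : ζ # 0#
      ζ#0 = invertibleˡ⇒# (ζ ^ ℕ.pred t , (begin
        ζ ^ ℕ.pred t * (ζ - 0#)     ≈⟨ *-congˡ (x-0≈x ζ) ⟩
        ζ ^ ℕ.pred t * ζ            ≈⟨ *-comm _ _ ⟩
        ζ ^ suc (ℕ.pred t)          ≈⟨ ^-congʳ ζ (ℕ.suc-pred t) ⟩
        ζ ^ t                       ≈⟨ proj₁ isPrimitive ⟩
        1#                          ∎))

      power# : ∀ k → ζ ^ k # 0#
      power# zero    = 1#0
      power# (suc k) = x#0y#0→xy#0 ζ#0 (power# k)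

      -- The factor ζ^m splits off and is invertible; primitivity applies to the exponent n - m,
      -- which lies strictly between 0 and t.
      powers# : ∀ {m n} → m ℕ.< n → n ℕ.< t → ζ ^ n - ζ ^ m # 0#
      powers# {m} {n} m<n n<t = #-congʳ (begin
        ζ ^ m * (ζ ^ (n ∸ m) - 1#)
          ≈⟨ solve 3 (λ a b u → a :* (b :- u) := a :* b :- a :* u) refl
               (ζ ^ m) (ζ ^ (n ∸ m)) 1# ⟩
        ζ ^ m * ζ ^ (n ∸ m) - ζ ^ m * 1#
          ≈⟨ +-cong (sym (^-homo-* ζ m (n ∸ m))) (-‿cong (*-identityʳ _)) ⟩
        ζ ^ (m ℕ.+ (n ∸ m)) - ζ ^ m
          ≈⟨ +-congʳ (^-congʳ ζ (ℕ.m+[n∸m]≡n (ℕ.<⇒≤ m<n))) ⟩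
        ζ ^ n - ζ ^ m ∎)
        (x#0y#0→xy#0 (power# m) (difference# (proj₂ isPrimitive (n ∸ m)
          (ℕ.m<n⇒0<n∸m m<n) (ℕ.≤-<-trans (ℕ.m∸n≤m n m) n<t))))

    root : ∀ k → k ℕ.< t → x k ^ t ≈ 1#
    root k k<t = begin
      x k ^ t            ≈⟨ ^-congˡ t (x≈ k k<t) ⟩
      (ζ ^ k) ^ t        ≈⟨ ^-assocʳ ζ k t ⟩
      ζ ^ (k ℕ.* t)      ≡⟨ ≡.cong (ζ ^_) (ℕ.*-comm k t) ⟩
      ζ ^ (t ℕ.* k)      ≈⟨ ^-assocʳ ζ t k ⟨
      (ζ ^ t) ^ k        ≈⟨ ^-congˡ k (proj₁ isPrimitive) ⟩
      1# ^ k             ≈⟨ one-power k ⟩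
      1#                 ∎

    vandermonde# : ∀ n → n ℕ.≤ t → vandermonde x n # 0#
    vandermonde# zero    _   = 1#0
    vandermonde# (suc n) n<t = x#0y#0→xy#0
      (∏# (All-points x n λ k k<n → #-congʳ
        (sym (+-cong (x≈ n n<t) (-‿cong (x≈ k (ℕ.<-trans k<n n<t)))))
        (powers# k<n n<t)))
      (vandermonde# n (ℕ.<⇒≤ n<t))

  integer-sign : ∀ n → integer (-1ℤ ℤ.^ n) ≈ sign n
  integer-sign zero    = +-identityʳ 1#
  integer-sign (suc n) = trans (integer-* -1ℤ (-1ℤ ℤ.^ n))
    (*-cong (-‿cong (+-identityʳ 1#)) (integer-sign n))

  sign-even : ∀ n k → sign (n ℕ.+ n ℕ.+ k) ≈ sign k
  sign-even n k = trans (sign-+ (n ℕ.+ n) k)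
    (trans (*-congʳ (trans (sign-+ n n) (sign-square n))) (*-identityˡ _))

  private module ℕSolver = NatSolver.+-*-Solver

  -- Since binom(t+3, 2) = 3t + 3 + binom(t, 2), the exponent is 4t + 3 + binom(t, 2).
  sign-ε₁ : ∀ t → sign (t ℕ.+ (t ℕ.+ 2 ℕ.+ 1) C 2) ≈ - sign (t C 2)
  sign-ε₁ t = begin
    sign (t ℕ.+ (t ℕ.+ 2 ℕ.+ 1) C 2)   ≡⟨ ≡.cong sign shape ⟩
    sign (suc t ℕ.+ t ℕ.+ (suc t ℕ.+ t) ℕ.+ suc (t C 2))
      ≈⟨ sign-even (suc t ℕ.+ t) (suc (t C 2)) ⟩
    sign (suc (t C 2))                 ≈⟨ sign-suc (t C 2) ⟩
    - sign (t C 2)                     ∎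
    where
    shape : t ℕ.+ (t ℕ.+ 2 ℕ.+ 1) C 2 ≡ suc t ℕ.+ t ℕ.+ (suc t ℕ.+ t) ℕ.+ suc (t C 2)
    shape = ≡.trans
      (≡.cong (λ n → t ℕ.+ n C 2) (≡.trans (ℕ.+-assoc t 2 1) (ℕ.+-comm t 3)))
      (≡.trans (≡.cong (t ℕ.+_) (≡.trans (choose₂ (2 ℕ.+ t)) (≡.cong (2 ℕ.+ t ℕ.+_)
          (≡.trans (choose₂ (1 ℕ.+ t)) (≡.cong (1 ℕ.+ t ℕ.+_) (choose₂ t))))))
        (ℕSolver.solve 2 (λ t c →
            t ℕSolver.:+ (ℕSolver.con 2 ℕSolver.:+ t ℕSolver.:+
              (ℕSolver.con 1 ℕSolver.:+ t ℕSolver.:+ (t ℕSolver.:+ c)))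
            ℕSolver.:=
            (ℕSolver.con 1 ℕSolver.:+ t) ℕSolver.:+ t ℕSolver.:+
              ((ℕSolver.con 1 ℕSolver.:+ t) ℕSolver.:+ t)
              ℕSolver.:+ (ℕSolver.con 1 ℕSolver.:+ c))
          ≡.refl t (t C 2)))

  -- The sign of the theorem counts columns from 1 and `toℕ` from 0; the two shifts cancel modulo 2.
  sign-ε₂ : ∀ a b i → sign (suc a ℕ.+ suc b ℕ.+ i) ≈ sign (a ℕ.+ b) * sign i
  sign-ε₂ a b i = begin
    sign (suc a ℕ.+ suc b ℕ.+ i)
      ≡⟨ ≡.cong (λ n → sign (suc n ℕ.+ i)) (ℕ.+-suc a b) ⟩
    sign (1 ℕ.+ 1 ℕ.+ (a ℕ.+ b ℕ.+ i))   ≈⟨ sign-even 1 (a ℕ.+ b ℕ.+ i) ⟩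
    sign (a ℕ.+ b ℕ.+ i)                 ≈⟨ sign-+ (a ℕ.+ b) i ⟩
    sign (a ℕ.+ b) * sign i              ∎

  module _ (char0 : CharacteristicZero F) (t : ℕ) .{{_ : NonZero t}} (2≤t : 2 ℕ.≤ t)
           (ζ : Carrier) (isPrimitive : IsPrimitiveRoot F t ζ)
           (lam : Shape (t ℕ.+ 2)) (partition : IsPartition lam)
           (w : Carrier) (w#0 : w # 0#) (den#0 : denominator F w#0 char0 t # 0#) where

    private
      N = t ℕ.+ 2
      w̄ = inverse F w#0
      h = inverse F (char0 1)

      ww̄ : w * w̄ ≈ 1#
      ww̄ = inverse-right w#0

      open Weights R t ζ (w * w) (w̄ * w̄)

      x : ℕ → Carrier
      x = letter

      x≈ : ∀ k → k ℕ.< t → x k ≈ ζ ^ k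
      x≈ k k<t = reflexive (letter-< k<t)

      x-root : ∀ k → k ℕ.< t → x k ^ t ≈ 1#
      x-root = root isPrimitive x x≈

      Z V : Carrier
      Z = schur x N (Vec.tabulate lam)
      V = vandermonde x t

      D : ℤ → Carrier
      D = difference ww̄

      den : Carrier
      den = denominator F w#0 char0 t

      sinhHalf≈ : ∀ i → sinhHalf F w#0 char0 i ≈ D i * h
      sinhHalf≈ i = *-congʳ (reflexive
        (≡.cong₂ _-_ (zpow≡intPower w#0 i) (zpow≡intPower w#0 (ℤ.- i))))

      den≈ : den ≈ h * h * h * (D (+ t) * D (+ t) * D (+ 2))
      den≈ = trans
        (*-cong (*-cong (sinhHalf≈ (+ t)) (trans (*-identityʳ _) (sinhHalf≈ (+ t))))
          (sinhHalf≈ (+ 2)))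
        (solve 3 (λ h a b → (a :* h) :* (a :* h) :* (b :* h) := h :* h :* h :* (a :* a :* b)) refl
          h (D (+ t)) (D (+ 2)))

      inverse-unique : ∀ {y v} (y#0 : y # 0#) → y * v ≈ 1# → inverse F y#0 ≈ v
      inverse-unique y#0 yv≈1 = *-cancel-# y#0 (trans (inverse-right y#0) (sym yv≈1))

      -- The inverse inside `tableauSum` comes from the apartness of w * w and is identified by
      -- uniqueness of inverses.
      z-inverse : inverse F (z#0 F w#0) ≈ w̄ * w̄
      z-inverse = inverse-unique (z#0 F w#0) (trans
        (solve 2 (λ a b → (a :* a) :* (b :* b) := (a :* b) :* (a :* b)) refl w w̄)
        (trans (*-cong ww̄ ww̄) (*-identityˡ 1#)))

      zpow-difference : ∀ m n →
        zpow F (z#0 F w#0) (+ m ℤ.- + n) ≈ (w * w) ^ m * (w̄ * w̄) ^ n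
      zpow-difference m n = begin
        zpow F (z#0 F w#0) (+ m ℤ.- + n)
          ≡⟨ zpow≡intPower (z#0 F w#0) (+ m ℤ.- + n) ⟩
        intPower (w * w) (inverse F (z#0 F w#0)) (+ m ℤ.- + n)
          ≡⟨ ≡.cong (intPower (w * w) (inverse F (z#0 F w#0))) (ℤ.m-n≡m⊖n m n) ⟩
        intPower (w * w) (inverse F (z#0 F w#0)) (m ℤ.⊖ n)
          ≈⟨ intPower-⊖ (inverse-right (z#0 F w#0)) m n ⟩
        (w * w) ^ m * inverse F (z#0 F w#0) ^ n
          ≈⟨ *-congˡ (^-congˡ n z-inverse) ⟩
        (w * w) ^ m * (w̄ * w̄) ^ n ∎

      tableauSum≈Z : tableauSum F w#0 t ζ lam ≈ Z
      tableauSum≈Z = trans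
        (sumList-cong (ssyt lam) λ T → trans
          (*-congˡ (zpow-difference (multiplicity T (t ↑ʳ zero)) (multiplicity T (t ↑ʳ suc zero))))
          (powerProduct-words T))
        (schur-ssyt x lam partition)

      -- Written with `2 + t` rather than `N`, so that `points` unfolds to the rows z̄ and z
      -- followed by the powers of ζ.
      detβ : List ℕ → Carrier
      detβ βs = det (points x (2 ℕ.+ t)) (monomials βs)

      bialternantβ : detβ (map (beta lam) (allFin N)) ≈
        D (+ t) * D (+ t) * D (+ 2) * V * Z
      bialternantβ = begin
        detβ (map (beta lam) (allFin N))
          ≡⟨ ≡.cong detβ (map-betas lam) ⟨
        detβ (betas (Vec.tabulate lam))
          ≡⟨ ≡.cong (λ n → det (points x n) (monomials (betas (Vec.tabulate lam)))) (ℕ.+-comm 2 t) ⟩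
        det (points x N) (monomials (betas (Vec.tabulate lam)))
          ≈⟨ bialternant x (Vec.tabulate lam) (Decreasing-tabulate lam bounded partition) ⟩
        vandermonde x N * Z
          ≡⟨ ≡.cong (λ n → vandermonde x n * Z) (ℕ.+-comm t 2) ⟩
        vandermonde x (2 ℕ.+ t) * Z
          ≈⟨ *-congʳ (vandermonde₂ x t x-root ww̄ (reflexive letter-t) (reflexive letter-1+t) 2≤t) ⟩
        D (+ t) * D (+ t) * D (+ 2) * V * Z ∎
        where
        0<N : 0 ℕ.< N
        0<N = ℕ.<-≤-trans (s≤s z≤n) (ℕ.m≤n+m 2 t)
        bounded : ∀ i → lam i ℕ.≤ lam (fromℕ< 0<N)
        bounded i = partition (≡.subst (ℕ._≤ toℕ i) (≡.sym (Fin.toℕ-fromℕ< 0<N)) z≤n)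

      -- `den` shares the factor D(t) D(t) D(2) with the Vandermonde determinant in all variables,
      -- so a value of the determinant divisible by `V` determines `den * Z`. The three factors `h`
      -- are the halves in the three sines.
      cancelV : ∀ {y} → detβ (map (beta lam) (allFin N)) ≈ V * y → den * Z ≈ h * h * h * y
      cancelV {y} eq = *-cancel-# (vandermonde# isPrimitive x x≈ t ℕ.≤-refl) (begin
        V * (den * Z)
          ≈⟨ *-congˡ (*-congʳ den≈) ⟩
        V * (h * h * h * (D (+ t) * D (+ t) * D (+ 2)) * Z)
          ≈⟨ solve 4 (λ v h d z → v :* (h :* h :* h :* d :* z) := h :* h :* h :* (d :* v :* z))
               refl V h (D (+ t) * D (+ t) * D (+ 2)) Z ⟩
        h * h * h * (D (+ t) * D (+ t) * D (+ 2) * V * Z)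
          ≈⟨ *-congˡ (trans (sym bialternantβ) eq) ⟩
        h * h * h * (V * y)
          ≈⟨ solve 3 (λ v h y → h :* h :* h :* (v :* y) := v :* (h :* h :* h :* y)) refl V h y ⟩
        V * (h * h * h * y) ∎)

      Z≈0 : HasEmptyClass t lam → Z ≈ 0#
      Z≈0 (i , misses) = *-cancel-# den#0 (trans
        (cancelV {0#} (trans
          (det₂-missing x t x-root (Fin.toℕ<n i) (map (beta lam) (allFin N))
            (≡.trans (length-map (beta lam) (allFin N))
              (≡.trans (List.length-tabulate {n = N} id) (ℕ.+-comm t 2)))
            (All.map⁺ (All.universal misses (allFin N))))
          (sym (zeroʳ V))))
        (trans (zeroʳ _) (sym (zeroʳ den))))

      module _ (noEmpty : ¬ HasEmptyClass t lam) (P : Pairs N) (sel : Selected t lam P) where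
        open Pairs P
        open Selected sel

        β : Fin N → ℕ
        β = beta lam

        S : List (Fin N)
        S = remaining A₁ B₁

        word-inversions columns-inversions : ℕ
        word-inversions    = inversions (residueWord t lam P)
        columns-inversions = inversions (map toℕ (A₁ ∷ B₁ ∷ S))

        σ : Carrier
        σ = sign columns-inversions * (sign word-inversions * sign (t C 2))

        numerator : Carrier
        numerator = D (d₁ t lam P) * D (d₂ t lam P) * D (d̃₃ t lam P)

        det-selected : detβ (map β (allFin N)) ≈ V * (σ * numerator)
        det-selected = begin
          detβ (map β (allFin N))
            ≈⟨ *-identityˡ _ ⟨
          -- Initially the columns are in increasing order and have no inversions; this factor puts
          -- the expression in the form of `sign-↭`.
          sign 0 * detβ (map β (allFin N))
            ≈⟨ *-cong (^-congʳ _ (≡.sym (inversions-increasing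
                 (AllPairs.map⁺ (allFin-increasing N)))))
                 (reflexive (≡.cong (det (points x (2 ℕ.+ t))) (≡.sym (List.map-∘ (allFin N))))) ⟩
          sign (inversions (map toℕ (allFin N))) *
            det (points x (2 ℕ.+ t)) (map (monomial ∘ β) (allFin N))
            ≈⟨ sign-↭ toℕ Fin.toℕ-injective {det (points x (2 ℕ.+ t)) ∘ map (monomial ∘ β)}
                 (alternating⇒swapNegates (monomial ∘ β) (det-alternating (points x (2 ℕ.+ t))))
                 (allFin-↭ A₁≢B₁) ⟩
          sign columns-inversions *
            det (points x (2 ℕ.+ t)) (map (monomial ∘ β) (A₁ ∷ B₁ ∷ S))
            ≡⟨ ≡.cong (λ cs → sign columns-inversions * det (points x (2 ℕ.+ t)) cs)
                 (List.map-∘ (A₁ ∷ B₁ ∷ S)) ⟩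
          sign columns-inversions * detβ (β A₁ ∷ β B₁ ∷ map β S)
            ≈⟨ *-congˡ (det₂-pairs x t x-root ww̄ (reflexive letter-t) (reflexive letter-1+t)
                 (β A₁) (β A₂) (β B₁) (β B₂) (map β S)
                 (∈.∈-map⁺ β (A₂∈remaining t lam noEmpty sel))
                 (∈.∈-map⁺ β (B₂∈remaining t lam noEmpty sel)) resA resB) ⟩
          sign columns-inversions * (numerator * det (points x t) (monomials (map β S)))
            ≈⟨ *-congˡ (*-congˡ (det-residues x t x-root (map β S)
                 (≡.subst (_↭ downFrom t) (List.map-∘ S) (residueWord-↭ t lam noEmpty sel)))) ⟩
          sign columns-inversions *
            (numerator * (sign (inversions (map (_% t) (map β S))) * (sign (t C 2) * V)))
            ≡⟨ ≡.cong (λ rs → sign columns-inversions *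
                 (numerator * (sign (inversions rs) * (sign (t C 2) * V)))) (List.map-∘ S) ⟨
          sign columns-inversions * (numerator * (sign word-inversions * (sign (t C 2) * V)))
            ≈⟨ solve 5 (λ a n b c v → a :* (n :* (b :* (c :* v))) := v :* (a :* (b :* c) :* n)) refl
                 (sign columns-inversions) numerator (sign word-inversions) (sign (t C 2)) V ⟩
          V * (σ * numerator) ∎

        -- Beta-numbers decrease with the column, so their difference is positive exactly when `A₁`
        -- lies to the left. In that order alone the inversions fall one short of the sum of the
        -- columns, and the two effects combine to the same sign in both orders.
        columns-sign : sign (toℕ A₁ ℕ.+ toℕ B₁) * integer (sgn (+ β A₁ ℤ.- + β B₁)) ≈
          - sign columns-inversions
        columns-sign with Fin.<-cmp A₁ B₁
        ... | tri≈ _ A₁≡B₁ _ = contradiction A₁≡B₁ A₁≢B₁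
        ... | tri< A₁<B₁ _ _ = begin
          sign (toℕ A₁ ℕ.+ toℕ B₁) * integer (sgn (+ β A₁ ℤ.- + β B₁))
            ≈⟨ *-cong (trans (^-congʳ _ (≡.sym (inversions-< A₁<B₁))) (sign-suc columns-inversions))
                 (trans (reflexive (≡.cong integer (sgn-> (beta-decreasing {lam = lam} partition A₁<B₁))))
                   (+-identityʳ 1#)) ⟩
          - sign columns-inversions * 1#   ≈⟨ *-identityʳ _ ⟩
          - sign columns-inversions        ∎
        ... | tri> _ _ B₁<A₁ = begin
          sign (toℕ A₁ ℕ.+ toℕ B₁) * integer (sgn (+ β A₁ ℤ.- + β B₁))
            ≈⟨ *-cong (^-congʳ _ (≡.sym (inversions-> B₁<A₁)))
                 (trans (reflexive (≡.cong integer (sgn-< (beta-decreasing {lam = lam} partition B₁<A₁))))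
                   (-‿cong (+-identityʳ 1#))) ⟩
          sign columns-inversions * - 1#
            ≈⟨ solve 2 (λ s u → s :* (:- u) := :- (s :* u)) refl (sign columns-inversions) 1# ⟩
          - (sign columns-inversions * 1#) ≈⟨ -‿cong (*-identityʳ _) ⟩
          - sign columns-inversions        ∎

        signε≈ : fromℤ F (signε t lam P) ≈ σ * integer (sgn (d̃₃ t lam P))
        signε≈ = begin
          fromℤ F (signε t lam P)
            ≡⟨ fromℤ≡integer (signε t lam P) ⟩
          integer (s₁ ℤ.* s₂ ℤ.* s₃ ℤ.* s₄)
            ≈⟨ trans (integer-* (s₁ ℤ.* s₂ ℤ.* s₃) s₄) (*-congʳ
                 (trans (integer-* (s₁ ℤ.* s₂) s₃) (*-congʳ (integer-* s₁ s₂)))) ⟩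
          integer s₁ * integer s₂ * integer s₃ * integer s₄
            ≈⟨ *-congʳ (*-congʳ (*-cong
                 (trans (integer-sign (t ℕ.+ (N ℕ.+ 1) C 2)) (sign-ε₁ t))
                 (trans (integer-sign (suc (toℕ A₁) ℕ.+ suc (toℕ B₁) ℕ.+ word-inversions))
                   (sign-ε₂ (toℕ A₁) (toℕ B₁) word-inversions)))) ⟩
          - sign (t C 2) * (sign (toℕ A₁ ℕ.+ toℕ B₁) * sign word-inversions)
            * integer s₃ * integer s₄
            ≈⟨ solve 5 (λ c ab i s r → (:- c) :* (ab :* i) :* s :* r := (:- (ab :* s)) :* (i :* c) :* r)
                 refl (sign (t C 2)) (sign (toℕ A₁ ℕ.+ toℕ B₁)) (sign word-inversions)
                 (integer s₃) (integer s₄) ⟩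
          - (sign (toℕ A₁ ℕ.+ toℕ B₁) * integer s₃) * (sign word-inversions * sign (t C 2))
            * integer s₄
            ≈⟨ *-congʳ (*-congʳ (trans (-‿cong columns-sign)
                 (solve 1 (λ a → :- (:- a) := a) refl (sign columns-inversions)))) ⟩
          σ * integer s₄ ∎
          where
          s₁ = -1ℤ ℤ.^ (t ℕ.+ (N ℕ.+ 1) C 2)
          s₂ = -1ℤ ℤ.^ (suc (toℕ A₁) ℕ.+ suc (toℕ B₁) ℕ.+ word-inversions)
          s₃ = sgn (+ β A₁ ℤ.- + β B₁)
          s₄ = sgn (d̃₃ t lam P)

        -- `D` is odd. Thus the factor sgn d̃₃ of the sign compensates for the absolute value in d₃.
        D-abs : ∀ i → integer (sgn i) * D (+ ∣ i ∣) ≈ D i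
        D-abs +0       = trans (zeroˡ _) (sym (-‿inverseʳ 1#))
        D-abs +[1+ n ] = trans (*-congʳ (+-identityʳ 1#)) (*-identityˡ _)
        D-abs -[1+ n ] = trans (*-congʳ (-‿cong (+-identityʳ 1#))) (trans
          (solve 3 (λ u a b → (:- u) :* (a :- b) := u :* (b :- a)) refl 1# (w ^ suc n) (w̄ ^ suc n))
          (*-identityˡ _))

        quotient : Carrier
        quotient = fromℤ F (signε t lam P) * divide F
          (sinhHalf F w#0 char0 (d₁ t lam P) * sinhHalf F w#0 char0 (d₂ t lam P)
            * sinhHalf F w#0 char0 (d₃ t lam P)) den#0

        Z≈quotient : Z ≈ quotient
        Z≈quotient = *-cancel-# den#0 (begin
          den * Z
            ≈⟨ cancelV det-selected ⟩
          h * h * h * (σ * numerator)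
            ≈⟨ *-congˡ (*-congˡ (*-congˡ (sym (D-abs (d̃₃ t lam P))))) ⟩
          h * h * h * (σ * (D₁ * D₂ * (integer (sgn (d̃₃ t lam P)) * D₃)))
            ≈⟨ solve 6 (λ h s a b i c → h :* h :* h :* (s :* (a :* b :* (i :* c)))
                 := s :* i :* (a :* h :* (b :* h) :* (c :* h))) refl
                 h σ D₁ D₂ (integer (sgn (d̃₃ t lam P))) D₃ ⟩
          σ * integer (sgn (d̃₃ t lam P)) * (D₁ * h * (D₂ * h) * (D₃ * h))
            ≈⟨ *-cong (sym signε≈) (sym (*-cong (*-cong
                 (sinhHalf≈ (d₁ t lam P)) (sinhHalf≈ (d₂ t lam P))) (sinhHalf≈ (d₃ t lam P)))) ⟩
          fromℤ F (signε t lam P) * product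
            ≈⟨ trans (*-congʳ (inverse-right den#0)) (*-identityˡ _) ⟨
          den * inverse F den#0 * (fromℤ F (signε t lam P) * product)
            ≈⟨ solve 4 (λ d i e p → d :* i :* (e :* p) := d :* (e :* (p :* i))) refl
                 den (inverse F den#0) (fromℤ F (signε t lam P)) product ⟩
          den * quotient ∎)
          where
          D₁ = D (d₁ t lam P)
          D₂ = D (d₂ t lam P)
          D₃ = D (d₃ t lam P)
          product = sinhHalf F w#0 char0 (d₁ t lam P) * sinhHalf F w#0 char0 (d₂ t lam P)
            * sinhHalf F w#0 char0 (d₃ t lam P)

        -- As `sgn 0ℤ` is 0, the sign vanishes, and the formula agrees with the value that
        -- `sinhQuotient` prescribes in this case.
        quotient≈0 : d̃₃ t lam P ≡ 0ℤ → quotient ≈ 0#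
        quotient≈0 eq = trans
          (*-congʳ (trans signε≈ (trans
            (*-congˡ (reflexive (≡.cong (integer ∘ sgn) eq))) (zeroʳ σ))))
          (zeroˡ _)

        Z≈sinhQuotient : Z ≈ sinhQuotient F w#0 char0 t den#0 lam P
        Z≈sinhQuotient with d̃₃ t lam P ℤ.≟ 0ℤ
        ... | yes eq = trans Z≈quotient (quotient≈0 eq)
        ... | no _   = Z≈quotient

    tableauSum≈rightHandSide :
      tableauSum F w#0 t ζ lam ≈ rightHandSide F w#0 char0 t den#0 lam
    tableauSum≈rightHandSide with hasEmptyClass? t lam
    ... | yes empty  = trans tableauSum≈Z (Z≈0 empty)
    ... | no noEmpty with P , selected , sel ← selection t lam noEmpty = trans tableauSum≈Z (trans
      (Z≈sinhQuotient noEmpty P sel)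
      (reflexive (≡.cong (maybe′ (sinhQuotient F w#0 char0 t den#0 lam) 0#) (≡.sym selected))))

corollary6p1 : ∀ {c ℓ₁ ℓ₂} (F : HeytingField c ℓ₁ ℓ₂) → let open HeytingField F in
    (char0 : CharacteristicZero F) →
    (t : ℕ) .{{_ : NonZero t}} → 2 ℕ.≤ t →
    (ζ : Carrier) → IsPrimitiveRoot F t ζ →
    (lam : Shape (t ℕ.+ 2)) → IsPartition lam →
    (w : Carrier) (w#0 : w # 0#) (den#0 : denominator F w#0 char0 t # 0#) →
    tableauSum F w#0 t ζ lam ≈ rightHandSide F w#0 char0 t den#0 lam
corollary6p1 F char0 t 2≤t ζ isPrimitive lam partition w w#0 den#0 =
  Evaluation.tableauSum≈rightHandSide F char0 t 2≤t ζ isPrimitive lam partition w w#0 den#0
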